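{- For every $n\ge 1$, the map $\gamma:S_n\to\mathrm{gRec}_n$ is surjective.
   Context: **Permutations.** Permutations $x\in S_n$ are written in one-line notation $x=x_1x_2\cdots x_n$. **Generic rectangulations.** Consider tilings of a rectangle $S$ (with horizontal and vertical edges) by finitely many rectangles. A tiling is *generic* if no point is a corner of four distinct tiles. A tile $U$ is *below* a tile $V$ if the top edge of $U$ intersects the bottom edge of $V$; $U$ is *left of* $V$ if the right edge of $U$ intersects the left edge of $V$. Two tilings (of possibly different rectangles) are combinatorially equivalent if there is a bijection between their tiles that exactly preserves the relations "below" and "left of". A *generic rectangulation* is an equivalence class of generic tilings; $\mathrm{gRec}_n$ is the set of generic rectangulations with $n$ rectangles. Rectangulations are described by representative tilings. **Diagonal rectangulations.** The diagonal of $S$ is the segment from its top-left corner to its bottom-right corner. A *diagonal rectangulation* is a rectangulation having a representative in which the interior of every rectangle meets the diagonal; it is automatically generic. Its rectangles are numbered $1,\dots,n$ in the order in which they meet the diagonal, from top-left to bottom-right. **The map $\rho$ from $S_n$ to diagonal rectangulations with $n$ rectangles.** Place $n+1$ distinct points on the diagonal of $S$, including the top-left and bottom-right corners of $S$, and label the spaces between consecutive points $1,\dots,n$ from top-left to bottom-right. Given $x\in S_n$, draw rectangles in steps $i=1,\dots,n$. In step $i$, let $T$ be the union of the left and bottom edges of $S$ with the rectangles drawn in the first $i-1$ steps ($T$ is left- and bottom-justified). Let $p$ and $p'$ be the diagonal points immediately above/left of, respectively immediately below/right of, the label $x_i$. The new rectangle has the following corners. Top-left corner: if $p\notin T$, the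 rightmost point of $T$ directly left of $p$; if $p\in T$, the highest point of $T$ directly above $p$ (possibly $p$ itself). Bottom-right corner: if $p'\notin T$, the highest point of $T$ directly below $p'$; if $p'\in T$, the rightmost point of $T$ directly to the right of $p'$ (possibly $p'$ itself). The result after $n$ steps is $\rho(x)$; the rectangle drawn in step $i$ is the one numbered $x_i$. **Walls, wall slides, numbering.** A *wall* of a rectangulation is a line segment in $S$, not contained in an edge of $S$, that is maximal with respect to not intersecting the interior of any rectangle. A *wall slide* along a wall $W$ takes two walls that end in $W$ from opposite sides and slides them past each other, changing no other incidences. Two generic rectangulations are *equivalent as mosaic floorplans* if they are related by a sequence of wall slides. It is known that each generic rectangulation $R$ is equivalent as a mosaic floorplan to a unique diagonal rectangulation $R'$. The walls and rectangles of $R$ correspond to those of $R'$ along wall slides (preserving, for each wall, which rectangles are adjacent to it on each side and their order), and the rectangles of $R$ inherit the numbering $1,\dots,n$ from $R'$. **Wall shuffles.** For a vertical wall $W$ of $R$, the *wall shuffle* $\sigma_W$ is the following sequence: moving along $W$ from bottom to top, at each wall $W'$ that ends at $W$ on the left, record the number of the rectangle with right edge in $W$ and bottom edge in $W'$; at each wall $W'$ that ends at $W$ on the right, record the number of the rectangle with left edge in $W$ and top edge in $W'$. Thus $\sigma_W$ is a shuffle of the (decreasing) sequence of numbers, from bottom to top, of rectangles whose right edge is in $W$, excluding the bottom one, with the (decreasing) sequence of numbers, from bottom to top, of rectangles whose left edge is in $W$, excluding the top one. For a horizontal wall $W$: moving from left to right, at each wall $W'$ that ends at $W$ from above, record the number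 of the rectangle with bottom edge in $W$ and right edge in $W'$; at each $W'$ that ends at $W$ from below, record the number of the rectangle with top edge in $W$ and left edge in $W'$. Thus $\sigma_W$ is a shuffle of the (increasing) sequence of numbers, from left to right, of rectangles whose bottom edge is in $W$, excluding the rightmost, with the (increasing) sequence of numbers, from left to right, of rectangles whose top edge is in $W$, excluding the leftmost. Specifying a generic rectangulation is equivalent to specifying its diagonal rectangulation $R'$ together with an arbitrary, independently chosen wall shuffle (a shuffle of the two sequences just described) for each wall of $R'$. **The map $\gamma:S_n\to\mathrm{gRec}_n$.** Given $x\in S_n$, let $R'=\rho(x)$. For each wall $W$ of $R'$, each of the two sequences of rectangle numbers to be shuffled for $W$ is a subsequence of $x_1\cdots x_n$, so a wall shuffle $\sigma_W$ is obtained as the subsequence of $x_1\cdots x_n$ consisting of all numbers occurring in these two sequences. Then $\gamma(x)$ is the generic rectangulation determined by $R'=\rho(x)$ and these wall shuffles.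
   Formalization: Generic rectangulations are represented by tilings whose corner coordinates are rational rather than real; combinatorial equivalence depends only on the order of the coordinates, so each class has such a representative. -}

module Defs where

open import Data.Nat as ℕ using (ℕ; suc; _∸_)
open import Data.Integer using (+_)
open import Data.Rational using (ℚ; 0ℚ; _/_; _≤_; _<_)
open import Data.Fin as Fin using (Fin; toℕ)
open import Data.Fin.Permutation using (Permutation′; _⟨$⟩ʳ_)
open import Data.List using (List; map; filter; tabulate)
open import Data.List.Membership.Propositional using (_∈_)
import Data.List.Membership.DecPropositional as DecMembership
open import Data.List.Relation.Unary.Linked using (Linked)
open import Data.Product using (Σ; ∃; ∃-syntax; _×_; _,_; proj₁; proj₂)
open import Data.Sum using (_⊎_)
open import Function using (_on_; _⇔_; Injective)
open import Relation.Binary.Construct.Closure.Equivalence using (EqClosure)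
open import Relation.Binary.PropositionalEquality using (_≡_; _≢_)
open import Relation.Nullary using (¬_)

------------------------------------------------------------------------
-- Plane geometry over ℚ

-- Everything below except the drawing procedure is symmetric under
-- exchanging (X, left, right) with (Y, bottom, top), so it is stated once for
-- an arbitrary axis.
data Axis : Set where
  X Y : Axis

other : Axis → Axis
other X = Y
other Y = X

Point : Set
Point = Axis → ℚ

-- lo is the bottom-left and hi the top-right corner.
record Rect : Set where
  field
    lo hi : Point

open Rect public

-- A segment perpendicular to `normal`, which is X for a vertical segment.
record Segment : Set where
  field
    normal : Axis
    pos start stop : ℚ

open Segment public

-- Rectangles and segments are closed point sets.
_∈ᴿ_ : Point → Rect → Set
p ∈ᴿ r = ∀ c → lo r c ≤ p c × p c ≤ hi r c

_∈Interior_ : Point → Rect → Set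
p ∈Interior r = ∀ c → lo r c < p c × p c < hi r c

_IsCornerOf_ : Point → Rect → Set
p IsCornerOf r = ∀ c → p c ≡ lo r c ⊎ p c ≡ hi r c

_∈ˢ_ : Point → Segment → Set
p ∈ˢ s = p (normal s) ≡ pos s
       × start s ≤ p (other (normal s))
       × p (other (normal s)) ≤ stop s

_⊆ˢ_ : Segment → Segment → Set
s ⊆ˢ s′ = ∀ p → p ∈ˢ s → p ∈ˢ s′

-- The left edge (X) or bottom edge (Y).
lowEdge : Axis → Rect → Segment
lowEdge c r = record
  { normal = c ; pos = lo r c ; start = lo r (other c) ; stop = hi r (other c) }

-- The right edge (X) or top edge (Y).
highEdge : Axis → Rect → Segment
highEdge c r = record
  { normal = c ; pos = hi r c ; start = lo r (other c) ; stop = hi r (other c) }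

------------------------------------------------------------------------
-- Generic tilings

record Layout (n : ℕ) : Set where
  field
    frame : Rect
    tile  : Fin n → Rect

open Layout public

record IsTiling {n} (R : Layout n) : Set where
  field
    nondegenerate : ∀ i c → lo (tile R i) c < hi (tile R i) c
    inside        : ∀ i p → p ∈ᴿ tile R i → p ∈ᴿ frame R
    disjoint      : ∀ i j p → p ∈Interior tile R i → p ∈Interior tile R j → i ≡ j
    covering      : ∀ p → p ∈ᴿ frame R → ∃[ i ] p ∈ᴿ tile R i

record IsGenericTiling {n} (R : Layout n) : Set where
  field
    isTiling : IsTiling R
    generic  : ∀ p (f : Fin 4 → Fin n) → Injective _≡_ _≡_ f →
               ¬ (∀ k → p IsCornerOf tile R (f k))

-- Precedes X is "left of" and Precedes Y is "below".
Precedes : ∀ {n} → Axis → Layout n → Fin n → Fin n → Set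
Precedes c R i j = ∃[ p ] p ∈ˢ highEdge c (tile R i) × p ∈ˢ lowEdge c (tile R j)

-- Combinatorial equivalence; a generic rectangulation is a class of generic
-- tilings for it.
_≅_ : ∀ {n} → Layout n → Layout n → Set
_≅_ {n} R R′ = Σ (Permutation′ n) λ π → ∀ c i j →
  Precedes c R i j ⇔ Precedes c R′ (π ⟨$⟩ʳ i) (π ⟨$⟩ʳ j)

-- Combinatorial equivalence respecting the numbers of the tiles.
_≅ₙ_ : ∀ {n} → Layout n → Layout n → Set
R ≅ₙ R′ = ∀ c i j → Precedes c R i j ⇔ Precedes c R′ i j

------------------------------------------------------------------------
-- Walls

record IsAvoidingSegment {n} (R : Layout n) (s : Segment) : Set where
  field
    proper   : start s < stop s
    inFrame  : ∀ p → p ∈ˢ s → p ∈ᴿ frame R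
    avoiding : ∀ i p → p ∈ˢ s → ¬ (p ∈Interior tile R i)

-- Only axis-parallel segments can avoid the interiors of all tiles.
record IsWall {n} (R : Layout n) (w : Segment) : Set where
  field
    isAvoiding : IsAvoidingSegment R w
    notInEdge  : ∀ c → ¬ (w ⊆ˢ lowEdge c (frame R)) × ¬ (w ⊆ˢ highEdge c (frame R))
    maximal    : ∀ s → IsAvoidingSegment R s → w ⊆ˢ s → s ⊆ˢ w

-- v ends at w from the left of w or from below w.
_EndsFromLow_ : Segment → Segment → Set
v EndsFromLow w = normal v ≡ other (normal w) × stop v ≡ pos w
                × start w ≤ pos v × pos v ≤ stop w

-- v ends at w from the right of w or from above w.
_EndsFromHigh_ : Segment → Segment → Set
v EndsFromHigh w = normal v ≡ other (normal w) × start v ≡ pos w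
                 × start w ≤ pos v × pos v ≤ stop w

-- Slides v₁, ending at w from its low side, past v₂, ending at w from its high
-- side.  Tiles a⁻ and a⁺ meet w at the end of v₁, and b⁻ and b⁺ at the end of
-- v₂, in the order along w.  While v₁ ends before v₂, a⁺ faces b⁻ across w;
-- once v₁ has passed v₂, a⁻ faces b⁺ instead.  This is the only change, so in
-- particular no other wall ends at w between v₁ and v₂.
record WallSlide {n} (R R′ : Layout n) : Set where
  field
    w v₁ v₂     : Segment
    isWall-w    : IsWall R w
    isWall-v₁   : IsWall R v₁
    isWall-v₂   : IsWall R v₂
    ends₁       : v₁ EndsFromLow w
    ends₂       : v₂ EndsFromHigh w
    v₁-first    : pos v₁ < pos v₂
    a⁻ a⁺ b⁻ b⁺ : Fin n

  across : Axis
  across = normal w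

  along : Axis
  along = other (normal w)

  field
    a⁻-at-w     : highEdge across (tile R a⁻) ⊆ˢ w
    a⁻-at-v₁    : highEdge along  (tile R a⁻) ⊆ˢ v₁
    a⁺-at-w     : highEdge across (tile R a⁺) ⊆ˢ w
    a⁺-at-v₁    : lowEdge  along  (tile R a⁺) ⊆ˢ v₁
    b⁻-at-w     : lowEdge  across (tile R b⁻) ⊆ˢ w
    b⁻-at-v₂    : highEdge along  (tile R b⁻) ⊆ˢ v₂
    b⁺-at-w     : lowEdge  across (tile R b⁺) ⊆ˢ w
    b⁺-at-v₂    : lowEdge  along  (tile R b⁺) ⊆ˢ v₂
    lost        : Precedes across R a⁺ b⁻ × ¬ Precedes across R′ a⁺ b⁻
    gained      : ¬ Precedes across R a⁻ b⁺ × Precedes across R′ a⁻ b⁺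
    same-along  : ∀ i j → Precedes along R i j ⇔ Precedes along R′ i j
    same-across : ∀ i j → (i , j) ≢ (a⁺ , b⁻) → (i , j) ≢ (a⁻ , b⁺) →
                  Precedes across R i j ⇔ Precedes across R′ i j

MosaicStep : ∀ {n} → Layout n → Layout n → Set
MosaicStep R R′ =
  IsGenericTiling R × IsGenericTiling R′ × (R ≅ₙ R′ ⊎ WallSlide R R′)

-- Equivalence as mosaic floorplans.  Corresponding tiles carry the same number.
MosaicEquivalent : ∀ {n} → Layout n → Layout n → Set
MosaicEquivalent = EqClosure MosaicStep

------------------------------------------------------------------------
-- Wall shuffles

-- Number k is recorded at position h on the wall w.  The first alternative
-- reads, for vertical w: the right edge of k is in w and its bottom edge is in
-- a wall ending at w on the left.  For horizontal w: its top edge is in w and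
-- its left edge is in a wall ending at w from below.
Recorded : ∀ {n} → Layout n → Segment → ℚ → Fin n → Set
Recorded R w h k = ∃[ v ] IsWall R v × pos v ≡ h ×
  ( v EndsFromLow w × highEdge (normal w) (tile R k) ⊆ˢ w
                    × lowEdge (other (normal w)) (tile R k) ⊆ˢ v
  ⊎ v EndsFromHigh w × lowEdge (normal w) (tile R k) ⊆ˢ w
                     × highEdge (other (normal w)) (tile R k) ⊆ˢ v )

IsWallShuffle : ∀ {n} → Layout n → Segment → List (Fin n) → Set
IsWallShuffle {n} R w σ = ∃[ ps ]
  map proj₂ ps ≡ σ ×
  Linked (_<_ on proj₁) ps ×
  (∀ h k → (h , k) ∈ ps ⇔ Recorded R w h k)

oneLine : ∀ {n} → Permutation′ n → List (Fin n)
oneLine x = tabulate (x ⟨$⟩ʳ_)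

subsequenceOn : ∀ {n} → List (Fin n) → Permutation′ n → List (Fin n)
subsequenceOn σ x = filter (_∈? σ) (oneLine x)
  where open DecMembership Fin._≟_ using (_∈?_)

------------------------------------------------------------------------
-- The map ρ

-- The diagonal points of the square [0,n]², numbered 0,…,n from top-left to
-- bottom-right.  With labels counted from 0, label k lies between points k and
-- k + 1.
diagonalPoint : ℕ → ℕ → Point
diagonalPoint n k X = + k / 1
diagonalPoint n k Y = + (n ∸ k) / 1

square : ℕ → Rect
square n = record { lo = λ _ → 0ℚ ; hi = λ _ → + n / 1 }

topLeft bottomRight : Rect → Point
topLeft r X = lo r X
topLeft r Y = hi r Y
bottomRight r X = hi r X
bottomRight r Y = lo r Y

-- q has the largest c-coordinate among the points satisfying P.
Furthest : Axis → (Point → Set) → Point → Set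
Furthest c P q = P q × (∀ q′ → P q′ → q′ c ≤ q c)

module _ (T : Point → Set) where

  IsTopLeftFor : Point → Point → Set
  IsTopLeftFor p q =
      (¬ T p → Furthest X (λ s → T s × s Y ≡ p Y × s X < p X) q)
    × (T p   → Furthest Y (λ s → T s × s X ≡ p X × p Y ≤ s Y) q)

  IsBottomRightFor : Point → Point → Set
  IsBottomRightFor p q =
      (¬ T p → Furthest Y (λ s → T s × s X ≡ p X × s Y < p Y) q)
    × (T p   → Furthest X (λ s → T s × s Y ≡ p Y × p X ≤ s X) q)

-- The set T before step i.
Drawn : ∀ {n} → Permutation′ n → Layout n → Fin n → Point → Set
Drawn x D i p = p ∈ˢ lowEdge X (frame D) ⊎ p ∈ˢ lowEdge Y (frame D)
  ⊎ ∃[ j ] j Fin.< i × p ∈ᴿ tile D (x ⟨$⟩ʳ j)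

-- D is the numbered layout ρ(x): the tile drawn in step i has number x_i.
record IsRho {n} (x : Permutation′ n) (D : Layout n) : Set where
  field
    frame-square : frame D ≡ square n
    draw-topLeft : ∀ i → IsTopLeftFor (Drawn x D i)
      (diagonalPoint n (toℕ (x ⟨$⟩ʳ i)))
      (topLeft (tile D (x ⟨$⟩ʳ i)))
    draw-bottomRight : ∀ i → IsBottomRightFor (Drawn x D i)
      (diagonalPoint n (suc (toℕ (x ⟨$⟩ʳ i))))
      (bottomRight (tile D (x ⟨$⟩ʳ i)))

------------------------------------------------------------------------
-- The map γ

-- γ(x) is the class of R.  The tiling G represents this class with its tiles
-- numbered as in ρ(x); its walls correspond to those of ρ(x) along the slides,
-- and corresponding walls have the same numbers to be shuffled.
record IsGamma {n} (x : Permutation′ n) (R : Layout n) : Set where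
  field
    D G       : Layout n
    isRho     : IsRho x D
    D-generic : IsGenericTiling D
    G-generic : IsGenericTiling G
    mosaic    : MosaicEquivalent G D
    shuffles  : ∀ w → IsWall G w → ∃[ σ ] IsWallShuffle G w σ × σ ≡ subsequenceOn σ x
    same      : R ≅ G

{-# OPTIONS --safe #-}

-- The walls of a rectangulation with n tiles are labelled 1, …, n - 1 so that in
-- the order from top left to bottom right the walls and the numbered tiles
-- alternate; the edges of the frame get the labels 0 and n.  Such a labelling is
-- found by removing the tile in the top left corner together with the wall that
-- only separates it from its neighbours.
--
-- Labelling the sides of the tiles by their walls makes the signed sum of any
-- function of two labels over all corners of all tiles equal to the signed sum
-- over the corners of the frame, since the two corners at the end of a wall
-- cancel.  Applied to indicator functions this shows that every choice of
-- coordinates of the walls that gives each tile a positive size is a tiling.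
-- The given rectangulation R and the diagonal rectangulation are two such
-- choices, and R is led to the diagonal one by sorting its coordinates: exchanging
-- two walls that are adjacent in the order is a wall slide if they end at a common
-- wall from opposite sides, and changes nothing otherwise.
--
-- The permutation x is any linear extension of adjacency (left of, below) and of
-- the relations prescribed by the wall shuffles.  It exists because among the
-- tiles outside of an initial segment that have no unused predecessor to their
-- left the lowest one has no unused predecessor below it either.

module Submission where

open import Defs
open import Data.Bool using (Bool; true; false; if_then_else_)
import Data.Bool.Properties as Bool
open import Data.Empty using (⊥; ⊥-elim)
open import Data.Fin as Fin using (Fin; zero; suc; toℕ; fromℕ; punchIn; punchOut)
open import Data.Fin.Permutation as Perm using (Permutation′; _⟨$⟩ʳ_; _⟨$⟩ˡ_; insert)
import Data.Fin.Properties as Fin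
open import Data.Integer as ℤ using (ℤ; +_; 0ℤ; 1ℤ)
import Data.Integer.Properties as ℤ
open import Data.Integer.Tactic.RingSolver using (solve-∀)
open import Data.List using (List; []; _∷_; map; filter)
open import Data.List.Membership.Propositional using (_∈_)
open import Data.List.Membership.Propositional.Properties using (∈-filter⁺; ∈-filter⁻; ∈-map⁺; ∈-map⁻; ∈-tabulate⁺)
import Data.List.Membership.DecPropositional as DecMembership
import Data.List.Properties as List
open import Data.List.Relation.Unary.All as All using (All; []; _∷_)
import Data.List.Relation.Unary.All.Properties as All
open import Data.List.Relation.Unary.AllPairs as AllPairs using (AllPairs; []; _∷_)
import Data.List.Relation.Unary.AllPairs.Properties as AllPairs
open import Data.List.Relation.Unary.Linked.Properties using (AllPairs⇒Linked)
open import Data.Nat as ℕ using (ℕ; zero; suc; _≥_; s≤s; z≤n)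
import Data.Nat.Coprimality as Coprime
open import Data.Nat.Induction using (<-wellFounded)
import Data.Nat.Properties as ℕ
open import Data.Product using (∃; ∃-syntax; _×_; _,_; proj₁; proj₂)
open import Data.Rational as ℚ using (ℚ; mkℚ; _≤_; _<_; _≤?_; _<?_; *<*)
import Data.Rational.Properties as ℚ
open import Data.Sum using (_⊎_; inj₁; inj₂; [_,_]′)
open import Function using (_∘_; Injective; _⇔_; mk⇔; Equivalence)
open import Induction.WellFounded using (Acc; acc)
open import Relation.Binary.Construct.Closure.ReflexiveTransitive using (ε; _◅_; _◅◅_)
open import Relation.Binary.Construct.Closure.Symmetric using (fwd; bwd)
open import Relation.Binary.Definitions using (tri<; tri≈; tri>)
open import Relation.Binary.PropositionalEquality hiding ([_])
open import Relation.Nullary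
open import Relation.Nullary.Decidable using (_×-dec_; _⊎-dec_; ¬?; dec-true; dec-false)
open import Algebra.Properties.CommutativeMonoid.Sum ℤ.+-0-commutativeMonoid
  using (sum; sum-cong-≗; ∑-distrib-+)

-- Sums over the corners of boxes

-- A slide changes coordinates, but neither the labels of the sides of the tiles nor the two labels
-- in which each wall starts and stops. `Mosaic` keeps exactly these data, so the given
-- rectangulation and ρ(x) are two choices of `Coordinates` for one `Mosaic`, and nothing has to be
-- transported along slides. Two obstacles shape the rest. In R different walls may have equal
-- coordinates, so its walls cannot be exchanged one pair at a time. Its coordinates are therefore
-- replaced by distinct ranks, ties being broken by label, and genericity shows that no adjacency
-- changes. Moreover, x is built from the adjacencies of R, whereas the drawing procedure depends on
-- those of ρ(x). These differ, but two tiles adjacent across a wall of ρ(x) always include the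
-- first tile on its low side or the last one on its high side, and these two are the same for all
-- coordinates. A linear extension for R thus orders the adjacencies of ρ(x) as well.

sumℕ : ∀ {n} → (Fin n → ℕ) → ℕ
sumℕ {zero}  w = 0
sumℕ {suc n} w = w zero ℕ.+ sumℕ (w ∘ suc)

sum-+ : ∀ {n} (w : Fin n → ℕ) → sum (λ i → + w i) ≡ + sumℕ w
sum-+ {zero}  w = refl
sum-+ {suc n} w = cong (λ z → + w zero ℤ.+ z) (sum-+ (w ∘ suc))

≤sumℕ : ∀ {n} (w : Fin n → ℕ) i → w i ℕ.≤ sumℕ w
≤sumℕ w zero    = ℕ.m≤m+n _ _
≤sumℕ w (suc i) = ℕ.≤-trans (≤sumℕ (w ∘ suc) i) (ℕ.m≤n+m _ _)

sumℕ-pair : ∀ {n} (w : Fin n → ℕ) {i j} → i ≢ j → w i ℕ.+ w j ℕ.≤ sumℕ w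
sumℕ-pair w {zero}  {zero}  i≢j = ⊥-elim (i≢j refl)
sumℕ-pair w {zero}  {suc j} i≢j = ℕ.+-monoʳ-≤ (w zero) (≤sumℕ (w ∘ suc) j)
sumℕ-pair w {suc i} {zero}  i≢j =
  subst (ℕ._≤ sumℕ w) (ℕ.+-comm (w zero) _) (ℕ.+-monoʳ-≤ (w zero) (≤sumℕ (w ∘ suc) i))
sumℕ-pair w {suc i} {suc j} i≢j =
  ℕ.≤-trans (sumℕ-pair (w ∘ suc) (i≢j ∘ cong suc)) (ℕ.m≤n+m _ _)

sumℕ-positive : ∀ {n} (w : Fin n → ℕ) → 0 ℕ.< sumℕ w → ∃[ i ] 0 ℕ.< w i
sumℕ-positive {suc n} w 0<Σ with w zero in eq
... | suc m = zero , subst (0 ℕ.<_) (sym eq) (s≤s z≤n)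
... | zero with i , 0<wᵢ ← sumℕ-positive (w ∘ suc) 0<Σ = suc i , 0<wᵢ

sumℕ-mono-≤ : ∀ {n} {v w : Fin n → ℕ} → (∀ i → v i ℕ.≤ w i) → sumℕ v ℕ.≤ sumℕ w
sumℕ-mono-≤ {zero}  v≤w = z≤n
sumℕ-mono-≤ {suc n} v≤w = ℕ.+-mono-≤ (v≤w zero) (sumℕ-mono-≤ (v≤w ∘ suc))

sumℕ-mono-< : ∀ {n} {v w : Fin n → ℕ} → (∀ i → v i ℕ.≤ w i) → ∀ i → v i ℕ.< w i → sumℕ v ℕ.< sumℕ w
sumℕ-mono-< v≤w zero    v<w = ℕ.+-mono-<-≤ v<w (sumℕ-mono-≤ (v≤w ∘ suc))
sumℕ-mono-< v≤w (suc i) v<w = ℕ.+-mono-≤-< (v≤w zero) (sumℕ-mono-< (v≤w ∘ suc) i v<w)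

[_] : Bool → ℤ
[ b ] = if b then 1ℤ else 0ℤ

[_]ℕ : Bool → ℕ
[ b ]ℕ = if b then 1 else 0

indicator-mono : ∀ {P Q : Set} (P? : Dec P) (Q? : Dec Q) → (P → Q) → [ does P? ]ℕ ℕ.≤ [ does Q? ]ℕ
indicator-mono (no _)  _        _   = z≤n
indicator-mono (yes _) (yes _)  _   = s≤s z≤n
indicator-mono (yes p) (no ¬q)  P⇒Q = ⊥-elim (¬q (P⇒Q p))

indicator-< : ∀ {P Q : Set} (P? : Dec P) (Q? : Dec Q) → ¬ P → Q → [ does P? ]ℕ ℕ.< [ does Q? ]ℕ
indicator-< (yes p) _       ¬p _ = ⊥-elim (¬p p)
indicator-< (no _)  (yes _) _  _ = s≤s z≤n
indicator-< (no _)  (no ¬q) _  q = ⊥-elim (¬q q)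

[]-+ : ∀ b → [ b ] ≡ + [ b ]ℕ
[]-+ true  = refl
[]-+ false = refl

module _ {n} (χ : Fin n → Bool) where

  private
    total : sum ([_] ∘ χ) ≡ + sumℕ ([_]ℕ ∘ χ)
    total = trans (sum-cong-≗ ([]-+ ∘ χ)) (sum-+ ([_]ℕ ∘ χ))

    to-true : ∀ b → 0 ℕ.< [ b ]ℕ → b ≡ true
    to-true true _ = refl

  count-exists : ∀ {z} → sum ([_] ∘ χ) ≡ z → 1ℤ ℤ.≤ z → ∃[ i ] χ i ≡ true
  count-exists eq 1≤z
    with i , 0<wᵢ ← sumℕ-positive ([_]ℕ ∘ χ) (ℤ.drop‿+≤+ (subst (1ℤ ℤ.≤_) (trans (sym eq) total) 1≤z))
    = i , to-true (χ i) 0<wᵢ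

  count-positive : ∀ {z} → sum ([_] ∘ χ) ≡ z → ∀ {i} → χ i ≡ true → 1ℤ ℤ.≤ z
  count-positive eq {i} χᵢ = subst (1ℤ ℤ.≤_) (trans (sym total) eq)
    (ℤ.+≤+ (subst (ℕ._≤ _) (cong [_]ℕ χᵢ) (≤sumℕ ([_]ℕ ∘ χ) i)))

  count-unique : ∀ {z} → sum ([_] ∘ χ) ≡ z → z ℤ.≤ 1ℤ → ∀ {i j} → χ i ≡ true → χ j ≡ true → i ≡ j
  count-unique eq z≤1 {i} {j} χᵢ χⱼ with i Fin.≟ j
  ... | yes i≡j = i≡j
  ... | no  i≢j = ⊥-elim (ℕ.<-irrefl refl (ℕ.≤-trans
    (subst₂ (λ a b → [ a ]ℕ ℕ.+ [ b ]ℕ ℕ.≤ sumℕ ([_]ℕ ∘ χ)) χᵢ χⱼ (sumℕ-pair ([_]ℕ ∘ χ) i≢j))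
    (ℤ.drop‿+≤+ (subst (ℤ._≤ 1ℤ) (trans (sym eq) total) z≤1))))

-- The signs are such that for a product `F x y = g x * h y` the sum factors into
-- `(g a - g a′) * (h b - h b′)`.
□ : ∀ {A B : Set} → (A → B → ℤ) → A → A → B → B → ℤ
□ F a a′ b b′ = (F a b ℤ.+ F a′ b′) ℤ.- (F a b′ ℤ.+ F a′ b)

record Balanced {n} {L : Set} (a a′ b b′ : Fin n → L) (A A′ B B′ : L) : Set where
  field
    balance : ∀ (F : L → L → ℤ) → sum (λ i → □ F (a i) (a′ i) (b i) (b′ i)) ≡ □ F A A′ B B′

open Balanced public

module _ {n} {L : Set} {a a′ b b′ : Fin n → L} {A A′ B B′ : L} where

  Balanced-transpose : Balanced a a′ b b′ A A′ B B′ → Balanced b b′ a a′ B B′ A A′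
  balance (Balanced-transpose bal) F = trans (sum-cong-≗ (λ i → flipped (a i) (a′ i) (b i) (b′ i)))
    (trans (balance bal (λ x y → F y x)) (sym (flipped A A′ B B′)))
    where
    flipped : ∀ x x′ y y′ → □ F y y′ x x′ ≡ □ (λ x y → F y x) x x′ y y′
    flipped x x′ y y′ = cong (λ z → (F y x ℤ.+ F y′ x′) ℤ.- z) (ℤ.+-comm (F y x′) (F y′ x))

  Balanced-flip : Balanced a a′ b b′ A A′ B B′ → Balanced a a′ b′ b A A′ B′ B
  balance (Balanced-flip bal) F = trans (sum-cong-≗ (λ i → flipped (a i) (a′ i) (b i) (b′ i)))
    (trans (balance bal (λ x y → ℤ.- F x y)) (sym (flipped A A′ B B′)))
    where
    lemma : ∀ p q r s → (p ℤ.+ q) ℤ.- (r ℤ.+ s) ≡ (ℤ.- r ℤ.+ ℤ.- s) ℤ.- (ℤ.- p ℤ.+ ℤ.- q)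
    lemma = solve-∀
    flipped : ∀ x x′ y y′ → □ F x x′ y′ y ≡ □ (λ x y → ℤ.- F x y) x x′ y y′
    flipped x x′ y y′ = lemma (F x y′) (F x′ y) (F x y) (F x′ y′)

-- A cut e : L → Bool says which labels lie before a point; it is inside [x, x′)
-- when it holds of x and not of x′.
record Inside {L : Set} (e : L → Bool) (x x′ : L) : Set where
  constructor cut-at
  field
    before : e x ≡ true
    after  : e x′ ≡ false

record Monotone {L : Set} (e : L → Bool) (x x′ : L) : Set where
  constructor monotone
  field
    descend : e x′ ≡ true → e x ≡ true

open Monotone public

inside? : Bool → Bool → Bool
inside? true false = true
inside? _    _     = false

inside-true : ∀ {L : Set} {e : L → Bool} {x x′} → inside? (e x) (e x′) ≡ true → Inside e x x′
inside-true {e = e} {x} {x′} eq with e x in p | e x′ in q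
... | true | false = cut-at p q

true-inside : ∀ {L : Set} {e : L → Bool} {x x′} → Inside e x x′ → inside? (e x) (e x′) ≡ true
true-inside (cut-at p q) = cong₂ inside? p q

-- With `F` the product of the two indicators, the corner sum of a box factors into two differences,
-- each 0 or 1 by monotonicity. It is the indicator of the box, so the balance says that the number
-- of tiles containing the point is the indicator of the frame.
module Covering {n} {L : Set} {a a′ b b′ : Fin n → L} {A A′ B B′ : L}
  (bal : Balanced a a′ b b′ A A′ B B′)
  (e f : L → Bool)
  (e-mono : ∀ i → Monotone e (a i) (a′ i)) (f-mono : ∀ i → Monotone f (b i) (b′ i))
  (e-frame : Monotone e A A′) (f-frame : Monotone f B B′)
  where

  private
    F : L → L → ℤ
    F x y = [ e x ] ℤ.* [ f y ]

    and : Bool → Bool → Bool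
    and true  y = y
    and false y = false

    and-true : ∀ {x y} → and x y ≡ true → x ≡ true × y ≡ true
    and-true {true} {true} refl = refl , refl

    χ : L → L → L → L → Bool
    χ x x′ y y′ = and (inside? (e x) (e x′)) (inside? (f y) (f y′))

    value : ∀ p p′ q q′ → (p′ ≡ true → p ≡ true) → (q′ ≡ true → q ≡ true) →
      ([ p ] ℤ.* [ q ] ℤ.+ [ p′ ] ℤ.* [ q′ ]) ℤ.- ([ p ] ℤ.* [ q′ ] ℤ.+ [ p′ ] ℤ.* [ q ])
      ≡ [ and (inside? p p′) (inside? q q′) ]
    value true  true  true  true  _ _ = refl
    value true  true  true  false _ _ = refl
    value true  true  false true  _ m with () ← m refl
    value true  true  false false _ _ = refl
    value true  false true  true  _ _ = refl
    value true  false true  false _ _ = refl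
    value true  false false true  _ m with () ← m refl
    value true  false false false _ _ = refl
    value false true  _     _     m _ with () ← m refl
    value false false true  true  _ _ = refl
    value false false true  false _ _ = refl
    value false false false true  _ _ = refl
    value false false false false _ _ = refl

    counted : sum (λ i → [ χ (a i) (a′ i) (b i) (b′ i) ]) ≡ [ χ A A′ B B′ ]
    counted = trans
      (sum-cong-≗ (λ i → sym (value (e (a i)) (e (a′ i)) (f (b i)) (f (b′ i)) (descend (e-mono i)) (descend (f-mono i)))))
      (trans (balance bal F) (value (e A) (e A′) (f B) (f B′) (descend e-frame) (descend f-frame)))

    χ-intro : ∀ {x x′ y y′} → Inside e x x′ → Inside f y y′ → χ x x′ y y′ ≡ true
    χ-intro p q = cong₂ and (true-inside p) (true-inside q)

    χ-elim : ∀ {x x′ y y′} → χ x x′ y y′ ≡ true → Inside e x x′ × Inside f y y′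
    χ-elim {x} {x′} {y} {y′} eq with p , q ← and-true {inside? (e x) (e x′)} eq =
      inside-true p , inside-true q

    [_]≤1 : ∀ x → [ x ] ℤ.≤ 1ℤ
    [ true  ]≤1 = ℤ.≤-refl
    [ false ]≤1 = ℤ.+≤+ z≤n

    1≤[_] : ∀ x → 1ℤ ℤ.≤ [ x ] → x ≡ true
    1≤[ true  ] _ = refl
    1≤[ false ] (ℤ.+≤+ ())

  covered : Inside e A A′ → Inside f B B′ → ∃[ i ] Inside e (a i) (a′ i) × Inside f (b i) (b′ i)
  covered p q with i , eq ← count-exists (λ i → χ (a i) (a′ i) (b i) (b′ i)) counted (ℤ.≤-reflexive (cong [_] (sym (χ-intro p q)))) = i , χ-elim eq

  covered-once : ∀ {i j} → Inside e (a i) (a′ i) → Inside f (b i) (b′ i) →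
                 Inside e (a j) (a′ j) → Inside f (b j) (b′ j) → i ≡ j
  covered-once p q p′ q′ = count-unique (λ i → χ (a i) (a′ i) (b i) (b′ i)) counted [ _ ]≤1 (χ-intro p q) (χ-intro p′ q′)

  covered-inside : ∀ {i} → Inside e (a i) (a′ i) → Inside f (b i) (b′ i) → Inside e A A′ × Inside f B B′
  covered-inside p q = χ-elim (1≤[ _ ] (count-positive (λ i → χ (a i) (a′ i) (b i) (b′ i)) counted (χ-intro p q)))

-- One-dimensional counterpart of `Covering`: for `g` the indicator of the cut, `g (b i) - g (b′ i)`
-- tells whether the interval of `i` contains the point.
module Selection {n} {L : Set} (P : Fin n → Bool) (b b′ : Fin n → L)
  (f : L → Bool) (f-mono : ∀ i → Monotone f (b i) (b′ i)) where

  selected : Fin n → Bool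
  selected i = if P i then inside? (f (b i)) (f (b′ i)) else false

  private
    value : ∀ s x y → (y ≡ true → x ≡ true) → [ s ] ℤ.* ([ x ] ℤ.- [ y ]) ≡ [ if s then inside? x y else false ]
    value true  true  true  _ = refl
    value true  true  false _ = refl
    value true  false true  m with () ← m refl
    value true  false false _ = refl
    value false x     y     _ = refl

  selected-count : sum ([_] ∘ selected) ≡ sum (λ i → [ P i ] ℤ.* ([ f (b i) ] ℤ.- [ f (b′ i) ]))
  selected-count = sum-cong-≗ (λ i → sym (value (P i) (f (b i)) (f (b′ i)) (descend (f-mono i))))

  select : ∀ {i} → P i ≡ true → Inside f (b i) (b′ i) → selected i ≡ true
  select eq ins rewrite eq = true-inside ins

  selected-inside : ∀ {i} → selected i ≡ true → P i ≡ true × Inside f (b i) (b′ i)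
  selected-inside {i} eq with P i
  ... | true = refl , inside-true eq

-- Equal signed sums for all `g` mean that every point lies in as many intervals of `P` as of `Q`.
transfer : ∀ {n} {L : Set} (P Q : Fin n → Bool) (b b′ : Fin n → L) (f : L → Bool) →
  (∀ i → Monotone f (b i) (b′ i)) →
  (∀ (g : L → ℤ) → sum (λ i → [ P i ] ℤ.* (g (b i) ℤ.- g (b′ i))) ≡ sum (λ i → [ Q i ] ℤ.* (g (b i) ℤ.- g (b′ i)))) →
  ∀ i → P i ≡ true → Inside f (b i) (b′ i) → ∃[ j ] Q j ≡ true × Inside f (b j) (b′ j)
transfer P Q b b′ f f-mono equal i Pᵢ ins =
  let j , selⱼ = count-exists Q′.selected (trans Q′.selected-count (sym (equal ([_] ∘ f))))
                   (count-positive P′.selected P′.selected-count {i} (P′.select Pᵢ ins))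
  in j , Q′.selected-inside {j} selⱼ
  where
  module P′ = Selection P b b′ f f-mono
  module Q′ = Selection Q b b′ f f-mono

-- The boxes selected by P, stacked in the second direction, fill [p, q) exactly.
record Chain {n} {L : Set} (P : Fin n → Bool) (b b′ : Fin n → L) (p q : L) : Set where
  field
    fill : ∀ (g : L → ℤ) → sum (λ i → [ P i ] ℤ.* (g (b i) ℤ.- g (b′ i))) ≡ g p ℤ.- g q

open Chain public

module Chaining {n} {L : Set} {P : Fin n → Bool} {b b′ : Fin n → L} {p q : L}
  (chain : Chain P b b′ p q) (f : L → Bool) (f-mono : ∀ i → Monotone f (b i) (b′ i)) where

  private
    open Selection P b b′ f f-mono

    counted : sum ([_] ∘ selected) ≡ [ f p ] ℤ.- [ f q ]
    counted = trans selected-count (fill chain ([_] ∘ f))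

    1≤ : ∀ {x y} → 1ℤ ℤ.≤ [ f x ] ℤ.- [ f y ] → Inside f x y
    1≤ {x} {y} 1≤z with f x in eqx | f y in eqy
    1≤ _         | true  | false = cut-at eqx eqy
    1≤ (ℤ.+≤+ ()) | true  | true
    1≤ (ℤ.+≤+ ()) | false | false
    1≤ ()        | false | true

  chain-covered : Inside f p q → ∃[ i ] P i ≡ true × Inside f (b i) (b′ i)
  chain-covered (cut-at eq₁ eq₂)
    with i , eq ← count-exists selected counted
      (ℤ.≤-reflexive (sym (cong₂ (λ x y → [ x ] ℤ.- [ y ]) eq₁ eq₂))) = i , selected-inside {i} eq

  chain-inside : ∀ {i} → P i ≡ true → Inside f (b i) (b′ i) → Inside f p q
  chain-inside eq ins = 1≤ (count-positive selected counted (select eq ins))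

sum-zero : ∀ {n} {h : Fin n → ℤ} → (∀ i → h i ≡ 0ℤ) → sum h ≡ 0ℤ
sum-zero {zero}  h≡0 = refl
sum-zero {suc n} h≡0 = cong₂ ℤ._+_ (h≡0 zero) (sum-zero (h≡0 ∘ suc))

sum-single : ∀ {n} {h : Fin n → ℤ} v → (∀ i → i ≢ v → h i ≡ 0ℤ) → sum h ≡ h v
sum-single {h = h} zero    h≡0 =
  trans (cong (λ z → h zero ℤ.+ z) (sum-zero (λ i → h≡0 (suc i) λ ()))) (ℤ.+-identityʳ _)
sum-single {h = h} (suc v) h≡0 =
  trans (cong₂ ℤ._+_ (h≡0 zero λ ()) (sum-single v (λ i i≢v → h≡0 (suc i) (i≢v ∘ λ { refl → refl }))))
    (ℤ.+-identityˡ _)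

sum-difference : ∀ {n} (x y : Fin n → ℤ) → sum (λ i → x i ℤ.- y i) ≡ 0ℤ → sum x ≡ sum y
sum-difference x y eq = trans
  (sum-cong-≗ (λ i → restore (x i) (y i)))
  (trans (∑-distrib-+ (λ i → x i ℤ.- y i) y) (trans (cong (ℤ._+ sum y) eq) (ℤ.+-identityˡ _)))
  where
  restore : ∀ a b → a ≡ (a ℤ.- b) ℤ.+ b
  restore = solve-∀

-- Diagonal labellings of walls

true⇒ : ∀ {A : Set} (A? : Dec A) → does A? ≡ true → A
true⇒ (yes a) _ = a

false⇒ : ∀ {A : Set} (A? : Dec A) → does A? ≡ false → ¬ A
false⇒ (no ¬a) _ = ¬a

-- Walls are labelled so that a tile numbered i lies between its near walls
-- (left L, top T), labelled at most i, and its far walls (right R, bottom B).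
record Diagonal {n} (L R T B : Fin n → Fin (suc n)) : Set where
  field
    L≤ : ∀ i → toℕ (L i) ℕ.≤ toℕ i
    <R : ∀ i → toℕ i ℕ.< toℕ (R i)
    T≤ : ∀ i → toℕ (T i) ℕ.≤ toℕ i
    <B : ∀ i → toℕ i ℕ.< toℕ (B i)
    balanced : Balanced L R T B zero (fromℕ n) zero (fromℕ n)

Diagonal-transpose : ∀ {n} {L R T B : Fin n → Fin (suc n)} → Diagonal L R T B → Diagonal T B L R
Diagonal-transpose d = record
  { L≤ = T≤ ; <R = <B ; T≤ = L≤ ; <B = <R ; balanced = Balanced-transpose balanced }
  where open Diagonal d

module DiagonalFacts {n} {L R T B : Fin n → Fin (suc n)} (D : Diagonal L R T B) where
  open Diagonal D

  private
    cut : ℕ → Fin (suc n) → Bool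
    cut y k = does (toℕ k ℕ.≤? y)

    cut-mono : ∀ y {k k′} → toℕ k ℕ.≤ toℕ k′ → Monotone (cut y) k k′
    cut-mono y k≤k′ = monotone λ eq → dec-true (_ ℕ.≤? _) (ℕ.≤-trans k≤k′ (true⇒ (_ ℕ.≤? _) eq))

    within : ∀ {y k k′} → toℕ k ℕ.≤ y → y ℕ.< toℕ k′ → Inside (cut y) k k′
    within k≤y y<k′ = cut-at (dec-true (_ ℕ.≤? _) k≤y) (dec-false (_ ℕ.≤? _) (ℕ.<⇒≱ y<k′))

    inside⁻ : ∀ {y k k′} → Inside (cut y) k k′ → toℕ k ℕ.≤ y × y ℕ.< toℕ k′
    inside⁻ (cut-at p q) = true⇒ (_ ℕ.≤? _) p , ℕ.≰⇒> (false⇒ (_ ℕ.≤? _) q)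

    L≤R : ∀ i → toℕ (L i) ℕ.≤ toℕ (R i)
    L≤R i = ℕ.≤-trans (L≤ i) (ℕ.<⇒≤ (<R i))

    T≤B : ∀ i → toℕ (T i) ℕ.≤ toℕ (B i)
    T≤B i = ℕ.≤-trans (T≤ i) (ℕ.<⇒≤ (<B i))

  -- Tile `j` covers the cell (`j`, `j`) of the grid of labels, its near walls being labelled at
  -- most `j` and its far walls more; by the count only one tile does.
  same-cell : ∀ {i j} → toℕ (L i) ℕ.≤ toℕ j → toℕ j ℕ.< toℕ (R i) →
              toℕ (T i) ℕ.≤ toℕ j → toℕ j ℕ.< toℕ (B i) → i ≡ j
  same-cell {i} {j} p q r s = covered-once (within p q) (within r s)
    (within (L≤ j) (<R j)) (within (T≤ j) (<B j))
    where
    open Covering balanced (cut (toℕ j)) (cut (toℕ j))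
      (λ i → cut-mono _ (L≤R i)) (λ i → cut-mono _ (T≤B i)) (cut-mono (toℕ j) {zero} {fromℕ n} z≤n) (cut-mono (toℕ j) {zero} {fromℕ n} z≤n)

  -- The tiles u and v meet the diagonal on the two sides of wall k.
  module Wall (k : Fin (suc n)) (u v : Fin n) (k≡1+u : toℕ k ≡ suc (toℕ u)) (v≡k : toℕ v ≡ toℕ k) where

    onLeft onRight : Fin n → Bool
    onLeft  i = does (R i Fin.≟ k)
    onRight i = does (L i Fin.≟ k)

    private
      k≢0 : zero ≢ k
      k≢0 eq = ℕ.0≢1+n (trans (cong toℕ eq) k≡1+u)

      k≢n : fromℕ n ≢ k
      k≢n eq = ℕ.<-irrefl (trans v≡k (trans (cong toℕ (sym eq)) (Fin.toℕ-fromℕ n))) (Fin.toℕ<n v)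

    -- Balance for `F x y = [x = k] * g y`: each tile contributes the difference of its two terms,
    -- and the frame nothing, because `k` is not one of its labels.
    sides : ∀ (g : Fin (suc n) → ℤ) →
      sum (λ i → [ onRight i ] ℤ.* (g (T i) ℤ.- g (B i))) ≡ sum (λ i → [ onLeft i ] ℤ.* (g (T i) ℤ.- g (B i)))
    sides g = sum-difference (λ i → [ onRight i ] ℤ.* (g (T i) ℤ.- g (B i))) (λ i → [ onLeft i ] ℤ.* (g (T i) ℤ.- g (B i))) (trans
      (sum-cong-≗ (λ i → sym (expand [ onRight i ] [ onLeft i ] (g (T i)) (g (B i)))))
      (trans (balance balanced (λ x y → [ does (x Fin.≟ k) ] ℤ.* g y))
        (trans (cong₂ (λ x y → ([ x ] ℤ.* g zero ℤ.+ [ y ] ℤ.* g (fromℕ n)) ℤ.- ([ x ] ℤ.* g (fromℕ n) ℤ.+ [ y ] ℤ.* g zero))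
          (dec-false (zero Fin.≟ k) k≢0) (dec-false (fromℕ n Fin.≟ k) k≢n))
          refl)))
      where
      expand : ∀ x y s t → (x ℤ.* s ℤ.+ y ℤ.* t) ℤ.- (x ℤ.* t ℤ.+ y ℤ.* s) ≡ x ℤ.* (s ℤ.- t) ℤ.- y ℤ.* (s ℤ.- t)
      expand = solve-∀

    -- A tile starting at wall `k` has a number of at least `k`, so if its top label is at most `k`
    -- it covers the diagonal cell of `v`.
    split-right : ∀ {j} → L j ≡ k → j ≡ v ⊎ toℕ k ℕ.< toℕ (T j)
    split-right {j} Lⱼ≡k with toℕ (T j) ℕ.≤? toℕ k
    ... | no  T≰k = inj₂ (ℕ.≰⇒> T≰k)
    ... | yes T≤k = inj₁ (same-cell
      (ℕ.≤-reflexive (trans (cong toℕ Lⱼ≡k) (sym v≡k)))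
      (ℕ.≤-<-trans v≤j (<R j))
      (subst (toℕ (T j) ℕ.≤_) (sym v≡k) T≤k)
      (ℕ.≤-<-trans v≤j (<B j)))
      where
      v≤j : toℕ v ℕ.≤ toℕ j
      v≤j = subst (ℕ._≤ toℕ j) (trans (cong toℕ Lⱼ≡k) (sym v≡k)) (L≤ j)

    -- Mirror image: the number is at most `u`, so a tile that reaches down to level `k` covers the
    -- diagonal cell of `u`.
    split-left : ∀ {i} → R i ≡ k → i ≡ u ⊎ toℕ (B i) ℕ.< toℕ k
    split-left {i} Rᵢ≡k with toℕ k ℕ.≤? toℕ (B i)
    ... | no  k≰B = inj₂ (ℕ.≰⇒> k≰B)
    ... | yes k≤B = inj₁ (same-cell
      (ℕ.≤-trans (L≤ i) i≤u) (ℕ.≤-reflexive (trans (sym k≡1+u) (cong toℕ (sym Rᵢ≡k))))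
      (ℕ.≤-trans (T≤ i) i≤u) (subst (ℕ._≤ toℕ (B i)) k≡1+u k≤B))
      where
      i≤u : toℕ i ℕ.≤ toℕ u
      i≤u = ℕ.≤-pred (subst (toℕ i ℕ.<_) (trans (cong toℕ Rᵢ≡k) k≡1+u) (<R i))

    private
      T-inside : ∀ i → Inside (cut (toℕ (T i))) (T i) (B i)
      T-inside i = within ℕ.≤-refl (ℕ.≤-<-trans (T≤ i) (<B i))

      -- Level with the top of `i` some tile `j` lies on the other side of the wall. It is `v`,
      -- since starting below level `k` contradicts `T j ≤ T i ≤ i < k`.
      v-right : ∀ {i} → R i ≡ k → L v ≡ k
      v-right {i} Rᵢ≡k =
        let j , onRⱼ , ins = transfer onLeft onRight T B (cut (toℕ (T i))) (λ j → cut-mono (toℕ (T i)) (T≤B j)) (λ g → sym (sides g)) i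
              (dec-true (R i Fin.≟ k) Rᵢ≡k) (T-inside i)
            Lⱼ≡k = true⇒ (L j Fin.≟ k) onRⱼ
        in [ (λ j≡v → subst (λ z → L z ≡ k) j≡v Lⱼ≡k)
           , (λ k<T → ⊥-elim (ℕ.<-asym (subst (λ z → toℕ i ℕ.< toℕ z) Rᵢ≡k (<R i))
               (ℕ.<-≤-trans k<T (ℕ.≤-trans (proj₁ (inside⁻ ins)) (T≤ i))))) ]′ (split-right Lⱼ≡k)

      u-left : ∀ {i} → L i ≡ k → R u ≡ k
      u-left {i} Lᵢ≡k =
        let j , onLⱼ , ins = transfer onRight onLeft T B (cut (toℕ i)) (λ j → cut-mono (toℕ i) (T≤B j)) sides i
              (dec-true (L i Fin.≟ k) Lᵢ≡k) (within {toℕ i} {T i} {B i} (T≤ i) (<B i))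
            Rⱼ≡k = true⇒ (R j Fin.≟ k) onLⱼ
            i<B = proj₂ (inside⁻ {toℕ i} {T j} {B j} ins)
            k≤i = subst (λ z → toℕ z ℕ.≤ toℕ i) Lᵢ≡k (L≤ i)
        in [ (λ j≡u → subst (λ z → R z ≡ k) j≡u Rⱼ≡k)
           , (λ B<k → ⊥-elim (ℕ.<-asym i<B (ℕ.<-≤-trans B<k k≤i))) ]′ (split-left Rⱼ≡k)

    -- A label may belong to a wall of the other direction; this says that `k` labels one of the
    -- present direction.
    Occupied : Set
    Occupied = ∃[ i ] (L i ≡ k ⊎ R i ≡ k)

    occupied : Occupied → L v ≡ k × R u ≡ k
    occupied (i , inj₁ Lᵢ≡k) = v-right (u-left Lᵢ≡k) , u-left Lᵢ≡k
    occupied (i , inj₂ Rᵢ≡k) = v-right Rᵢ≡k , u-left (v-right Rᵢ≡k)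

    -- Below the diagonal only u is adjacent to the wall from the left, and above
    -- it only v from the right, so each half of a sum along the wall can be
    -- evaluated on the side where it has a single term.
    module _ (occ : Occupied) where

      private
        Lᵥ≡k : L v ≡ k
        Lᵥ≡k = proj₁ (occupied occ)
        Rᵤ≡k : R u ≡ k
        Rᵤ≡k = proj₂ (occupied occ)

      module _ (g : Fin (suc n) → ℤ) where

        private
          above below : Fin (suc n) → ℤ
          above w = if does (toℕ w ℕ.≤? toℕ k) then g w else g k
          below w = if does (toℕ w ℕ.≤? toℕ k) then g k else g w

          above-≤ : ∀ {w} → toℕ w ℕ.≤ toℕ k → above w ≡ g w
          above-≤ {w} w≤k = cong (λ b → if b then g w else g k) (dec-true (_ ℕ.≤? _) w≤k)
          above-> : ∀ {w} → toℕ k ℕ.< toℕ w → above w ≡ g k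
          above-> {w} k<w = cong (λ b → if b then g w else g k) (dec-false (_ ℕ.≤? _) (ℕ.<⇒≱ k<w))
          below-≤ : ∀ {w} → toℕ w ℕ.≤ toℕ k → below w ≡ g k
          below-≤ {w} w≤k = cong (λ b → if b then g k else g w) (dec-true (_ ℕ.≤? _) w≤k)
          below-≥ : ∀ {w} → toℕ k ℕ.≤ toℕ w → below w ≡ g w
          below-≥ {w} k≤w with toℕ w ℕ.≤? toℕ k
          ... | no  w≰k = cong (λ b → if b then g k else g w) (dec-false (_ ℕ.≤? _) w≰k)
          ... | yes w≤k = trans (below-≤ w≤k) (cong g (Fin.toℕ-injective (ℕ.≤-antisym k≤w w≤k)))

          halves : ∀ w → g w ≡ (above w ℤ.+ below w) ℤ.- g k
          halves w with does (toℕ w ℕ.≤? toℕ k)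
          ... | true  = lemma (g w) (g k) where lemma : ∀ a b → a ≡ (a ℤ.+ b) ℤ.- b
                                                lemma = solve-∀
          ... | false = lemma (g w) (g k) where lemma : ∀ a b → a ≡ (b ℤ.+ a) ℤ.- b
                                                lemma = solve-∀

          at : (P : Fin n → Bool) → (Fin (suc n) → ℤ) → Fin n → ℤ
          at P h i = [ P i ] ℤ.* (h (T i) ℤ.- h (B i))

          above-sum : sum (at onRight above) ≡ g (T v) ℤ.- g k
          above-sum = trans (sum-single v single) (trans
            (cong₂ (λ b z → [ b ] ℤ.* z) (dec-true (L v Fin.≟ k) Lᵥ≡k)
              (cong₂ ℤ._-_ (above-≤ (subst (toℕ (T v) ℕ.≤_) v≡k (T≤ v)))
                           (above-> (subst (ℕ._< toℕ (B v)) v≡k (<B v)))))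
            (ℤ.*-identityˡ _))
            where
            single : ∀ i → i ≢ v → at onRight above i ≡ 0ℤ
            single i i≢v with L i Fin.≟ k
            ... | no  _ = refl
            ... | yes Lᵢ≡k with split-right Lᵢ≡k
            ...   | inj₁ i≡v = ⊥-elim (i≢v i≡v)
            ...   | inj₂ k<T = trans (cong (1ℤ ℤ.*_) (cong₂ ℤ._-_ (above-> k<T) (above-> (ℕ.<-≤-trans k<T (T≤B i)))))
                                 (trans (ℤ.*-identityˡ _) (ℤ.+-inverseʳ (g k)))

          below-sum : sum (at onLeft below) ≡ g k ℤ.- g (B u)
          below-sum = trans (sum-single u single) (trans
            (cong₂ (λ b z → [ b ] ℤ.* z) (dec-true (R u Fin.≟ k) Rᵤ≡k)
              (cong₂ ℤ._-_ (below-≤ (ℕ.≤-trans (T≤ u) (ℕ.<⇒≤ (ℕ.≤-reflexive (sym k≡1+u)))))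
                           (below-≥ (subst (ℕ._≤ toℕ (B u)) (sym k≡1+u) (<B u)))))
            (ℤ.*-identityˡ _))
            where
            single : ∀ i → i ≢ u → at onLeft below i ≡ 0ℤ
            single i i≢u with R i Fin.≟ k
            ... | no  _ = refl
            ... | yes Rᵢ≡k with split-left Rᵢ≡k
            ...   | inj₁ i≡u = ⊥-elim (i≢u i≡u)
            ...   | inj₂ B<k = trans (cong (1ℤ ℤ.*_) (cong₂ ℤ._-_ (below-≤ (ℕ.≤-trans (T≤B i) (ℕ.<⇒≤ B<k))) (below-≤ (ℕ.<⇒≤ B<k))))
                                 (trans (ℤ.*-identityˡ _) (ℤ.+-inverseʳ (g k)))

        right-sum : sum (at onRight g) ≡ g (T v) ℤ.- g (B u)
        right-sum = trans
          (sum-cong-≗ (λ i → trans (cong₂ (λ x y → [ onRight i ] ℤ.* (x ℤ.- y)) (halves (T i)) (halves (B i)))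
            (distribute [ onRight i ] (above (T i)) (below (T i)) (above (B i)) (below (B i)) (g k))))
          (trans (∑-distrib-+ (at onRight above) (at onRight below))
            (trans (cong₂ ℤ._+_ above-sum (trans (sides below) below-sum)) (telescope (g (T v)) (g k) (g (B u)))))
          where
          distribute : ∀ s a b c d k → s ℤ.* (((a ℤ.+ b) ℤ.- k) ℤ.- ((c ℤ.+ d) ℤ.- k)) ≡ s ℤ.* (a ℤ.- c) ℤ.+ s ℤ.* (b ℤ.- d)
          distribute = solve-∀
          telescope : ∀ a b c → (a ℤ.- b) ℤ.+ (b ℤ.- c) ≡ a ℤ.- c
          telescope = solve-∀

        left-sum : sum (at onLeft g) ≡ g (T v) ℤ.- g (B u)
        left-sum = trans (sym (sides g)) right-sum

      right-chain : Chain onRight T B (T v) (B u)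
      right-chain = record { fill = right-sum }

      left-chain : Chain onLeft T B (T v) (B u)
      left-chain = record { fill = left-sum }

Chain-flip : ∀ {n} {L : Set} {P : Fin n → Bool} {b b′ : Fin n → L} {p q} →
             Chain P b b′ p q → Chain P b′ b q p
fill (Chain-flip {P = P} {b} {b′} {p} {q} chain) g = trans
  (sum-cong-≗ (λ i → cong ([ P i ] ℤ.*_) (lemma (g (b′ i)) (g (b i)))))
  (trans (fill chain (λ w → ℤ.- g w)) (sym (lemma (g q) (g p))))
  where
  lemma : ∀ x y → x ℤ.- y ≡ ℤ.- y ℤ.- (ℤ.- x)
  lemma = solve-∀

-- Labelling the walls of a rectangulation

record Covers {n} (l r t b : Fin n → ℚ) (x y : ℚ) (i : Fin n) : Set where
  constructor covers
  field
    l≤ : l i ≤ x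
    <r : x < r i
    t≤ : t i ≤ y
    <b : y < b i

-- A dissection of a frame with the second coordinate pointing downwards; tiles
-- are half-open, so that they partition the frame.
record Dissection (n : ℕ) : Set where
  field
    l r t b     : Fin n → ℚ
    fl fr ft fb : ℚ
    l<r   : ∀ i → l i < r i
    t<b   : ∀ i → t i < b i
    fl≤l  : ∀ i → fl ≤ l i
    r≤fr  : ∀ i → r i ≤ fr
    ft≤t  : ∀ i → ft ≤ t i
    b≤fb  : ∀ i → b i ≤ fb
    cover : ∀ {x y} → fl ≤ x → x < fr → ft ≤ y → y < fb → ∃[ i ] Covers l r t b x y i
    same  : ∀ {x y i j} → Covers l r t b x y i → Covers l r t b x y j → i ≡ j

Dissection-transpose : ∀ {n} → Dissection n → Dissection n
Dissection-transpose G = record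
  { l = t ; r = b ; t = l ; b = r ; fl = ft ; fr = fb ; ft = fl ; fb = fr
  ; l<r = t<b ; t<b = l<r ; fl≤l = ft≤t ; r≤fr = b≤fb ; ft≤t = fl≤l ; b≤fb = r≤fr
  ; cover = λ p q r s → let i , covers p′ q′ r′ s′ = cover r s p q in i , covers r′ s′ p′ q′
  ; same = λ { (covers p q r s) (covers p′ q′ r′ s′) → same (covers r s p q) (covers r′ s′ p′ q′) }
  }
  where open Dissection G

-- Equal coordinates do not imply equal labels, since different walls may be collinear. For the left
-- and top edges of the frame they do, by `L-frame` and `T-frame`; this lets the induction identify
-- the tiles along them.
record Labelled {n} (G : Dissection n) : Set where
  open Dissection G
  field
    num      : Permutation′ n
    L R T B  : Fin n → Fin (suc n)
    diagonal : Diagonal L R T B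
    xs ys      : Fin (suc n) → ℚ
    l≡       : ∀ i → l (num ⟨$⟩ʳ i) ≡ xs (L i)
    r≡       : ∀ i → r (num ⟨$⟩ʳ i) ≡ xs (R i)
    t≡       : ∀ i → t (num ⟨$⟩ʳ i) ≡ ys (T i)
    b≡       : ∀ i → b (num ⟨$⟩ʳ i) ≡ ys (B i)
    fl≡      : fl ≡ xs zero
    fr≡      : fr ≡ xs (fromℕ n)
    ft≡      : ft ≡ ys zero
    fb≡      : fb ≡ ys (fromℕ n)
    L-frame  : ∀ i → l (num ⟨$⟩ʳ i) ≡ fl → L i ≡ zero
    T-frame  : ∀ i → t (num ⟨$⟩ʳ i) ≡ ft → T i ≡ zero

Labelled-transpose : ∀ {n} {G : Dissection n} → Labelled (Dissection-transpose G) → Labelled G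
Labelled-transpose S = record
  { num = num ; L = T ; R = B ; T = L ; B = R ; diagonal = Diagonal-transpose diagonal ; xs = ys ; ys = xs
  ; l≡ = t≡ ; r≡ = b≡ ; t≡ = l≡ ; b≡ = r≡ ; fl≡ = ft≡ ; fr≡ = fb≡ ; ft≡ = fl≡ ; fb≡ = fr≡
  ; L-frame = T-frame ; T-frame = L-frame }
  where open Labelled S

-- Yields the common point of two overlapping half-open intervals: the larger of their lower ends.
larger : ∀ p q → ∃[ z ] p ≤ z × q ≤ z × (∀ {c} → p < c → q < c → z < c)
larger p q with ℚ.≤-total p q
... | inj₁ p≤q = q , p≤q , ℚ.≤-refl , λ _ q<c → q<c
... | inj₂ q≤p = p , ℚ.≤-refl , q≤p , λ p<c _ → p<c

-- Replaces a limit from below: an interval that contains `y` and ends in one of the values `w i`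
-- ends at `z` or later.
largest-below : ∀ {n} (w : Fin n → ℚ) {a z} → a < z → ∃[ y ] a ≤ y × y < z × (∀ i → w i < z → w i ≤ y)
largest-below {zero}  w {a} a<z = a , ℚ.≤-refl , a<z , λ ()
largest-below {suc n} w {z = z} a<z with y , a≤y , y<z , max ← largest-below (w ∘ suc) a<z | w zero <? z
... | no w₀≮z = y , a≤y , y<z , λ { zero w₀<z → ⊥-elim (w₀≮z w₀<z) ; (suc i) → max i }
... | yes w₀<z with m , y≤m , w₀≤m , least ← larger y (w zero) =
  m , ℚ.≤-trans a≤y y≤m , least y<z w₀<z , λ { zero _ → w₀≤m ; (suc i) wᵢ<z → ℚ.≤-trans (max i wᵢ<z) y≤m }

-- The tile u in the top left corner is removed, its right edge being a complete
-- wall, and the tiles to its right are extended to the left edge of the frame.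
module Removal {m} (G : Dissection (suc (suc m))) (u v : Fin (suc (suc m)))
  (u-left : Dissection.l G u ≡ Dissection.fl G) (u-top : Dissection.t G u ≡ Dissection.ft G)
  (v-left : Dissection.l G v ≡ Dissection.r G u) (v-bottom : Dissection.b G v ≡ Dissection.b G u)
  where

  open Dissection G

  private
    n = suc m

  Extended : Fin (suc n) → Set
  Extended j = l j ≡ r u × b j ≤ b u

  extended? : ∀ j → Dec (Extended j)
  extended? j = (l j ℚ.≟ r u) ×-dec (b j ≤? b u)

  l′ : Fin (suc n) → ℚ
  l′ j = if does (extended? j) then fl else l j

  l′-extended : ∀ {j} → Extended j → l′ j ≡ fl
  l′-extended {j} ext = cong (λ z → if z then fl else l j) (dec-true (extended? j) ext)

  l′-kept : ∀ {j} → ¬ Extended j → l′ j ≡ l j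
  l′-kept {j} ¬ext = cong (λ z → if z then fl else l j) (dec-false (extended? j) ¬ext)

  l′≤l : ∀ j → l′ j ≤ l j
  l′≤l j with does (extended? j)
  ... | true  = fl≤l j
  ... | false = ℚ.≤-refl

  fl≤l′ : ∀ j → fl ≤ l′ j
  fl≤l′ j with does (extended? j)
  ... | true  = ℚ.≤-refl
  ... | false = fl≤l j

  u-covers : ∀ {x y} → fl ≤ x → x < r u → ft ≤ y → y < b u → Covers l r t b x y u
  u-covers {x} {y} p q s t = covers (subst (_≤ x) (sym u-left) p) q (subst (_≤ y) (sym u-top) s) t

  ru<fr : r u < fr
  ru<fr = subst (_< fr) v-left (ℚ.<-≤-trans (l<r v) (r≤fr v))

  -- Starting left of `r u`, the tile would share the point (`l j`, `y`) with `u`.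
  starts-at-v : ∀ {j y} → Covers l r t b (r u) y j → y < b u → l j ≡ r u
  starts-at-v {j} {y} (covers lj≤ <rj tj≤ <bj) y<bu with l j <? r u
  ... | no lj≮ = ℚ.≤-antisym lj≤ (ℚ.≮⇒≥ lj≮)
  ... | yes lj<ru = ⊥-elim (ℚ.<-irrefl refl (subst (λ z → r u < r z)
    (sym (same (u-covers (fl≤l j) lj<ru (ℚ.≤-trans (ft≤t j) tj≤) y<bu)
               (covers ℚ.≤-refl (l<r j) tj≤ <bj))) <rj))

  v-above : ∀ {j} → l j ≡ r u → t j < b u → b u ≤ b j → j ≡ v
  v-above {j} lj≡ tj<bu bu≤bj with z , tj≤z , tv≤z , least ← larger (t j) (t v) =
    same (covers (ℚ.≤-reflexive lj≡) (subst (_< r j) lj≡ (l<r j)) tj≤z (ℚ.<-≤-trans z<bu bu≤bj))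
         (covers (ℚ.≤-reflexive v-left) (subst (_< r v) v-left (l<r v)) tv≤z (subst (z <_) (sym v-bottom) z<bu))
    where
    z<bu : z < b u
    z<bu = least tj<bu (subst (t v <_) v-bottom (t<b v))

  right-extended : ∀ {j y} → Covers l r t b (r u) y j → y < b u → Extended j
  right-extended {j} {y} cov@(covers _ _ tj≤ _) y<bu = lj≡ , ℚ.≮⇒≥ λ bu<bj →
    ℚ.<-irrefl (trans (sym v-bottom) (cong b (sym (v-above lj≡ (ℚ.≤-<-trans tj≤ y<bu) (ℚ.<⇒≤ bu<bj))))) bu<bj
    where
    lj≡ : l j ≡ r u
    lj≡ = starts-at-v cov y<bu

  Covers′ : ℚ → ℚ → Fin (suc n) → Set
  Covers′ x y j = l′ j ≤ x × x < r j × t j ≤ y × y < b j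

  extended≢u : ∀ {j} → Extended j → u ≢ j
  extended≢u (lj≡ , _) refl = ℚ.<-irrefl lj≡ (l<r u)

  -- A point of `u` is now covered by the tile that lies right of `u` at the same height, which is
  -- extended.
  cover′ : ∀ {x y} → fl ≤ x → x < fr → ft ≤ y → y < fb → ∃[ j ] u ≢ j × Covers′ x y j
  cover′ {x} {y} fl≤x x<fr ft≤y y<fb
    with i , covers li≤ <ri ti≤ <bi ← cover fl≤x x<fr ft≤y y<fb with u Fin.≟ i
  ... | no u≢i = i , u≢i , ℚ.≤-trans (l′≤l i) li≤ , <ri , ti≤ , <bi
  ... | yes refl
    with j , cov@(covers _ <rj tj≤ <bj) ← cover (subst (_≤ r u) u-left (ℚ.<⇒≤ (l<r u))) ru<fr ft≤y y<fb =
    j , extended≢u ext , subst (_≤ x) (sym (l′-extended ext)) fl≤x , ℚ.<-trans <ri <rj , tj≤ , <bj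
    where
    ext : Extended j
    ext = right-extended cov <bi

  -- An extended tile gains only points of `u`, which no other remaining tile contained; two
  -- extended tiles are compared after moving the point right to `r u`.
  same′ : ∀ {x y i j} → u ≢ i → u ≢ j → Covers′ x y i → Covers′ x y j → i ≡ j
  same′ {x} {y} {i} {j} u≢i u≢j (pᵢ , qᵢ , rᵢ , sᵢ) (pⱼ , qⱼ , rⱼ , sⱼ) = cases (extended? i) (extended? j)
    where
    kept : ∀ {k} → ¬ Extended k → l′ k ≤ x → l k ≤ x
    kept ¬ext = subst (_≤ x) (l′-kept ¬ext)
    one-extended : ∀ {k h} → u ≢ h → Extended k → l′ k ≤ x → x < r k → t k ≤ y → y < b k →
                   Covers l r t b x y h → k ≡ h
    one-extended {k} u≢h ext@(lk≡ , bk≤) p q r s cov with x <? _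
    ... | no  x≮ru = same (covers (subst (_≤ x) (sym lk≡) (ℚ.≮⇒≥ x≮ru)) q r s) cov
    ... | yes x<ru = ⊥-elim (u≢h (same
      (u-covers (subst (_≤ x) (l′-extended ext) p) x<ru (ℚ.≤-trans (ft≤t k) r) (ℚ.<-≤-trans s bk≤)) cov))
    cases : Dec (Extended i) → Dec (Extended j) → i ≡ j
    cases (no ¬i) (no ¬j) = same (covers (kept ¬i pᵢ) qᵢ rᵢ sᵢ) (covers (kept ¬j pⱼ) qⱼ rⱼ sⱼ)
    cases (yes i⁺) (no ¬j) = one-extended u≢j i⁺ pᵢ qᵢ rᵢ sᵢ (covers (kept ¬j pⱼ) qⱼ rⱼ sⱼ)
    cases (no ¬i) (yes j⁺) = sym (one-extended u≢i j⁺ pⱼ qⱼ rⱼ sⱼ (covers (kept ¬i pᵢ) qᵢ rᵢ sᵢ))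
    cases (yes (li≡ , _)) (yes (lj≡ , _)) with z , x≤z , ru≤z , least ← larger x (r u) =
      same (covers (subst (_≤ z) (sym li≡) ru≤z) (least qᵢ (subst (_< r i) li≡ (l<r i))) rᵢ sᵢ)
           (covers (subst (_≤ z) (sym lj≡) ru≤z) (least qⱼ (subst (_< r j) lj≡ (l<r j))) rⱼ sⱼ)

  reduced : Dissection n
  reduced = record
    { l = l′ ∘ punchIn u ; r = r ∘ punchIn u ; t = t ∘ punchIn u ; b = b ∘ punchIn u
    ; fl = fl ; fr = fr ; ft = ft ; fb = fb
    ; l<r = λ j → ℚ.≤-<-trans (l′≤l _) (l<r _)
    ; t<b = λ j → t<b _
    ; fl≤l = λ j → fl≤l′ _ ; r≤fr = λ j → r≤fr _ ; ft≤t = λ j → ft≤t _ ; b≤fb = λ j → b≤fb _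
    ; cover = λ {x} {y} p q s t →
        let j , u≢j , cov = cover′ p q s t
            p′ , q′ , s′ , t′ = subst (Covers′ x y) (sym (Fin.punchIn-punchOut u≢j)) cov
        in punchOut u≢j , covers p′ q′ s′ t′
    ; same = λ { {i = i} {j} (covers p q s t) (covers p′ q′ s′ t′) → Fin.punchIn-injective u i j
        (same′ (Fin.punchInᵢ≢i u i ∘ sym) (Fin.punchInᵢ≢i u j ∘ sym) (p , q , s , t) (p′ , q′ , s′ , t′)) }
    }

  module Relabel (S : Labelled reduced) where
    private
      module S = Labelled S
      module D = Diagonal S.diagonal

    old : Fin n → Fin (suc n)
    old j = punchIn u (S.num ⟨$⟩ʳ j)

    num : Permutation′ (suc n)
    num = insert zero u S.num

    -- Label 1 is vacated for the wall right of the removed tile, which itself gets the number 0.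
    shift : ∀ {n} → Fin (suc n) → Fin (suc (suc n))
    shift zero    = zero
    shift (suc k) = suc (suc k)

    toℕ-shift≤ : ∀ {k : Fin (suc n)} {j : Fin n} → toℕ k ℕ.≤ toℕ j → toℕ (shift k) ℕ.≤ suc (toℕ j)
    toℕ-shift≤ {zero}  _   = z≤n
    toℕ-shift≤ {suc k} k≤j = s≤s k≤j

    <toℕ-shift : ∀ {k : Fin (suc n)} {j : Fin n} → toℕ j ℕ.< toℕ k → suc (toℕ j) ℕ.< toℕ (shift k)
    <toℕ-shift {suc k} j<k = s≤s j<k

    u≢v : u ≢ v
    u≢v refl = ℚ.<-irrefl v-left (l<r u)

    v′ : Fin n
    v′ = S.num ⟨$⟩ˡ punchOut u≢v

    old-v′ : old v′ ≡ v
    old-v′ = trans (cong (punchIn u) (Perm.inverseʳ S.num)) (Fin.punchIn-punchOut u≢v)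

    ext : Fin n → Bool
    ext j = does (extended? (old j))

    ext⇒L≡0 : ∀ j → Extended (old j) → S.L j ≡ zero
    ext⇒L≡0 j e = S.L-frame j (l′-extended e)

    L R T B : Fin (suc n) → Fin (suc (suc n))
    L zero    = zero
    L (suc j) = if ext j then suc zero else shift (S.L j)
    R zero    = suc zero
    R (suc j) = shift (S.R j)
    T zero    = zero
    T (suc j) = shift (S.T j)
    -- The bottom edges of `u` and `v` are level and are assigned to one wall.
    B zero    = shift (S.B v′)
    B (suc j) = shift (S.B j)

    xs ys : Fin (suc (suc n)) → ℚ
    xs zero          = fl
    xs (suc zero)    = r u
    xs (suc (suc k)) = S.xs (suc k)
    ys zero          = ft
    -- A default: label 1 names a vertical wall.
    ys (suc zero)    = ft
    ys (suc (suc k)) = S.ys (suc k)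

    xs-shift : ∀ k → xs (shift k) ≡ S.xs k
    xs-shift zero    = S.fl≡
    xs-shift (suc k) = refl

    ys-shift : ∀ k → ys (shift k) ≡ S.ys k
    ys-shift zero    = S.ft≡
    ys-shift (suc k) = refl

    module _ (F : Fin (suc (suc n)) → Fin (suc (suc n)) → ℤ) where

      private
        F↑ : Fin (suc n) → Fin (suc n) → ℤ
        F↑ k w = F (shift k) (shift w)

        -- `g` measures the effect of moving a left side from label 0 to label 1.
        g g⁺ : Fin (suc n) → ℤ
        g w  = F (suc zero) (shift w) ℤ.- F zero (shift w)
        -- Truncated below the bottom of u, so that only extended tiles contribute.
        g⁺ w = if does (S.ys w <? b u) then g w else g (S.B v′)

        g⁺-above : ∀ {w} → S.ys w < b u → g⁺ w ≡ g w
        g⁺-above {w} p = cong (λ z → if z then g w else g (S.B v′)) (dec-true (S.ys w <? b u) p)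

        g⁺-below : ∀ {w} → b u ≤ S.ys w → g⁺ w ≡ g (S.B v′)
        g⁺-below {w} p = cong (λ z → if z then g w else g (S.B v′))
          (dec-false (S.ys w <? b u) (λ q → ℚ.<-irrefl refl (ℚ.<-≤-trans q p)))

        term : Fin n → ℤ
        term j = [ ext j ] ℤ.* (g (S.T j) ℤ.- g (S.B j))

        F₀ : Fin (suc n) → Fin (suc n) → ℤ
        F₀ k w = [ does (k Fin.≟ zero) ] ℤ.* g⁺ w

        R≢0 : ∀ j → S.R j ≢ zero
        R≢0 j eq with () ← subst (λ z → toℕ j ℕ.< toℕ z) eq (D.<R j)

        extended-term : ∀ j → Extended (old j) → g⁺ (S.T j) ℤ.- g⁺ (S.B j) ≡ g (S.T j) ℤ.- g (S.B j)
        extended-term j (lj≡ , bj≤) = cong₂ ℤ._-_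
          (g⁺-above (subst (_< b u) (S.t≡ j) tj<bu))
          bottom
          where
          tj<bu : t (old j) < b u
          tj<bu = ℚ.<-≤-trans (t<b (old j)) bj≤
          bottom : g⁺ (S.B j) ≡ g (S.B j)
          bottom with b (old j) <? b u
          ... | yes bj<bu = g⁺-above (subst (_< b u) (S.b≡ j) bj<bu)
          -- Among the extended tiles only `v` reaches the bottom of `u`, so here `j` is `v′`.
          ... | no  bj≮bu = trans (g⁺-below (subst (b u ≤_) (S.b≡ j) (ℚ.≮⇒≥ bj≮bu)))
            (cong (g ∘ S.B) (sym (trans (sym (Perm.inverseˡ S.num)) (cong (S.num ⟨$⟩ˡ_) (Fin.punchIn-injective u _ _
              (trans (v-above lj≡ tj<bu (ℚ.≮⇒≥ bj≮bu)) (sym (Fin.punchIn-punchOut u≢v))))))))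

        -- A tile at the left edge of the frame that is not extended lies entirely below `u`, where
        -- `g⁺` is constant.
        kept-term : ∀ j → S.L j ≡ zero → ¬ Extended (old j) → g⁺ (S.T j) ≡ g⁺ (S.B j)
        kept-term j Lj≡0 ¬ext = trans (g⁺-below (subst (b u ≤_) (S.t≡ j) bu≤tj))
          (sym (g⁺-below (subst (b u ≤_) (S.b≡ j) (ℚ.≤-trans bu≤tj (ℚ.<⇒≤ (t<b (old j)))))))
          where
          lj≡fl : l (old j) ≡ fl
          lj≡fl = trans (sym (l′-kept ¬ext)) (trans (S.l≡ j) (trans (cong S.xs Lj≡0) (sym S.fl≡)))
          bu≤tj : b u ≤ t (old j)
          bu≤tj = ℚ.≮⇒≥ λ tj<bu → Fin.punchInᵢ≢i u (S.num ⟨$⟩ʳ j) (sym (same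
            (u-covers (ℚ.≤-reflexive (sym lj≡fl)) (subst (_< r u) (trans u-left (sym lj≡fl)) (l<r u)) (ft≤t (old j)) tj<bu)
            (covers ℚ.≤-refl (l<r (old j)) ℚ.≤-refl (t<b (old j)))))

        truncated : ∀ j → □ F₀ (S.L j) (S.R j) (S.T j) (S.B j) ≡ term j
        truncated j with S.R j Fin.≟ zero | S.L j Fin.≟ zero
        ... | yes R≡0 | _ = ⊥-elim (R≢0 j R≡0)
        ... | no _ | no L≢0 = trans (lemma (g⁺ (S.T j)) (g⁺ (S.B j)))
            (sym (cong (λ z → [ z ] ℤ.* (g (S.T j) ℤ.- g (S.B j)))
              (dec-false (extended? (old j)) (L≢0 ∘ ext⇒L≡0 j))))
          where
          lemma : ∀ x y → (0ℤ ℤ.* x ℤ.+ 0ℤ ℤ.* y) ℤ.- (0ℤ ℤ.* y ℤ.+ 0ℤ ℤ.* x) ≡ 0ℤ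
          lemma = solve-∀
        ... | no _ | yes L≡0 = trans (lemma (g⁺ (S.T j)) (g⁺ (S.B j))) (cases (extended? (old j)))
          where
          lemma : ∀ x y → (1ℤ ℤ.* x ℤ.+ 0ℤ ℤ.* y) ℤ.- (1ℤ ℤ.* y ℤ.+ 0ℤ ℤ.* x) ≡ x ℤ.- y
          lemma = solve-∀
          cases : ∀ (e : Dec (Extended (old j))) → g⁺ (S.T j) ℤ.- g⁺ (S.B j) ≡ [ does e ] ℤ.* (g (S.T j) ℤ.- g (S.B j))
          cases (yes e) = trans (extended-term j e) (sym (ℤ.*-identityˡ _))
          cases (no ¬e) = trans (cong (ℤ._- g⁺ (S.B j)) (kept-term j L≡0 ¬e)) (ℤ.+-inverseʳ (g⁺ (S.B j)))

        -- The extended tiles fill the left edge of the reduced frame from its top down to the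
        -- bottom of `u`. This is balance for the indicator of label 0 times `g⁺`.
        term-sum : sum term ≡ g zero ℤ.- g (S.B v′)
        term-sum = trans (sum-cong-≗ (sym ∘ truncated)) (trans (balance D.balanced F₀)
          (trans (lemma (g⁺ zero) (g⁺ (fromℕ n)))
            (cong₂ ℤ._-_
              (g⁺-above (subst (_< b u) (trans u-top S.ft≡) (t<b u)))
              (g⁺-below (subst (b u ≤_) S.fb≡ (b≤fb u))))))
          where
          lemma : ∀ x y → (1ℤ ℤ.* x ℤ.+ 0ℤ ℤ.* y) ℤ.- (1ℤ ℤ.* y ℤ.+ 0ℤ ℤ.* x) ≡ x ℤ.- y
          lemma = solve-∀

        relabelled : ∀ j → □ F (L (suc j)) (R (suc j)) (T (suc j)) (B (suc j))
                         ≡ □ F↑ (S.L j) (S.R j) (S.T j) (S.B j) ℤ.+ term j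
        relabelled j = cases (extended? (old j))
          where
          kept : ∀ x d → x ≡ x ℤ.+ 0ℤ ℤ.* d
          kept = solve-∀
          moved : ∀ p q s t x y → (p ℤ.+ x) ℤ.- (q ℤ.+ y) ≡
            ((s ℤ.+ x) ℤ.- (t ℤ.+ y)) ℤ.+ 1ℤ ℤ.* ((p ℤ.- s) ℤ.- (q ℤ.- t))
          moved = solve-∀
          cases : ∀ (e : Dec (Extended (old j))) →
            □ F (if does e then suc zero else shift (S.L j)) (R (suc j)) (T (suc j)) (B (suc j))
            ≡ □ F↑ (S.L j) (S.R j) (S.T j) (S.B j) ℤ.+ [ does e ] ℤ.* (g (S.T j) ℤ.- g (S.B j))
          cases (no _)  = kept (□ F↑ (S.L j) (S.R j) (S.T j) (S.B j)) (g (S.T j) ℤ.- g (S.B j))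
          cases (yes e) = trans
            (moved (F (suc zero) (T (suc j))) (F (suc zero) (B (suc j))) (F zero (T (suc j))) (F zero (B (suc j)))
                   (F (R (suc j)) (B (suc j))) (F (R (suc j)) (T (suc j))))
            (cong (λ k → □ F↑ k (S.R j) (S.T j) (S.B j) ℤ.+ 1ℤ ℤ.* (g (S.T j) ℤ.- g (S.B j))) (sym (ext⇒L≡0 j e)))

      -- The corner sum of `u` itself is `g (S.B v′) - g zero`; it cancels `term-sum`, the change
      -- caused by relabelling the extended tiles.
      relabelled-balance : sum (λ i → □ F (L i) (R i) (T i) (B i)) ≡ □ F zero (fromℕ (suc n)) zero (fromℕ (suc n))
      relabelled-balance = trans
        (cong (λ z → □ F zero (suc zero) zero (shift (S.B v′)) ℤ.+ z)
          (trans (sum-cong-≗ relabelled)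
            (trans (∑-distrib-+ (λ j → □ F↑ (S.L j) (S.R j) (S.T j) (S.B j)) term)
              (cong₂ ℤ._+_ (balance D.balanced F↑) term-sum))))
        (cancel (F zero zero) (F (suc zero) (shift (S.B v′))) (F zero (shift (S.B v′))) (F (suc zero) zero)
          (□ F zero (fromℕ (suc n)) zero (fromℕ (suc n))))
        where
        cancel : ∀ p q s t x → ((p ℤ.+ q) ℤ.- (s ℤ.+ t)) ℤ.+ (x ℤ.+ ((t ℤ.- p) ℤ.- (q ℤ.- s))) ≡ x
        cancel = solve-∀

    labelled : Labelled G
    labelled = record
      { num = num ; L = L ; R = R ; T = T ; B = B
      ; diagonal = record
        { L≤ = λ { zero → z≤n ; (suc j) → L≤ j }
        ; <R = λ { zero → s≤s z≤n ; (suc j) → <toℕ-shift {S.R j} (D.<R j) }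
        ; T≤ = λ { zero → z≤n ; (suc j) → toℕ-shift≤ {S.T j} (D.T≤ j) }
        ; <B = λ { zero → ℕ.≤-trans (s≤s z≤n) (<toℕ-shift {S.B v′} (D.<B v′)) ; (suc j) → <toℕ-shift {S.B j} (D.<B j) }
        ; balanced = record { balance = relabelled-balance } }
      ; xs = xs ; ys = ys
      ; l≡ = λ { zero → u-left ; (suc j) → l≡ j }
      ; r≡ = λ { zero → refl ; (suc j) → trans (S.r≡ j) (sym (xs-shift (S.R j))) }
      ; t≡ = λ { zero → u-top ; (suc j) → trans (S.t≡ j) (sym (ys-shift (S.T j))) }
      ; b≡ = λ { zero → trans (sym v-bottom) (trans (cong b (sym old-v′)) (trans (S.b≡ v′) (sym (ys-shift (S.B v′)))))
               ; (suc j) → trans (S.b≡ j) (sym (ys-shift (S.B j))) }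
      ; fl≡ = refl ; fr≡ = S.fr≡ ; ft≡ = refl ; fb≡ = S.fb≡
      ; L-frame = λ { zero _ → refl ; (suc j) → L-frame j }
      ; T-frame = λ { zero _ → refl ; (suc j) eq → cong shift (S.T-frame j eq) }
      }
      where
      L≤ : ∀ j → toℕ (L (suc j)) ℕ.≤ suc (toℕ j)
      L≤ j with ext j
      ... | true  = s≤s z≤n
      ... | false = toℕ-shift≤ {S.L j} (D.L≤ j)

      l≡ : ∀ j → l (old j) ≡ xs (L (suc j))
      l≡ j = cases (extended? (old j)) (S.l≡ j)
        where
        cases : (e : Dec (Extended (old j))) → (if does e then fl else l (old j)) ≡ S.xs (S.L j) →
                l (old j) ≡ xs (if does e then suc zero else shift (S.L j))
        cases (yes (lj≡ , _)) _  = lj≡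
        cases (no _)          eq = trans eq (sym (xs-shift (S.L j)))

      L-frame : ∀ j → l (old j) ≡ fl → L (suc j) ≡ zero
      L-frame j lj≡fl = trans
        (cong (λ z → if z then suc zero else shift (S.L j)) (dec-false (extended? (old j)) ¬ext))
        (cong shift (S.L-frame j (trans (l′-kept ¬ext) lj≡fl)))
        where
        ¬ext : ¬ Extended (old j)
        ¬ext (lj≡ , _) = ℚ.<-irrefl (trans u-left (trans (sym lj≡fl) lj≡)) (l<r u)

module _ {n} (G : Dissection n) where
  open Dissection G

  -- Right of `u` a height `y` is chosen with no bottom edge strictly between `y` and `b u`; hence
  -- the tile found there reaches down to `b u` at least.
  neighbour : ∀ {u} → l u ≡ fl → t u ≡ ft → r u < fr → ∃[ v ] l v ≡ r u × t v < b u × b u ≤ b v × r u < r v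
  neighbour {u} u-left u-top ru<fr
    with y , tu≤y , y<bu , max ← largest-below b (t<b u)
    with v , covers lv≤ <rv tv≤ <bv ← cover (ℚ.≤-trans (fl≤l u) (ℚ.<⇒≤ (l<r u))) ru<fr
           (ℚ.≤-trans (ft≤t u) tu≤y) (ℚ.<-≤-trans y<bu (b≤fb u))
    with l v <? r u
  ... | yes lv<ru = ⊥-elim (ℚ.<-irrefl (cong r (same
          (covers (subst (_≤ l v) (sym u-left) (fl≤l v)) lv<ru tu≤y y<bu)
          (covers ℚ.≤-refl (l<r v) tv≤ <bv))) <rv)
  ... | no lv≮ru = v , ℚ.≤-antisym lv≤ (ℚ.≮⇒≥ lv≮ru) , ℚ.≤-<-trans tv≤ y<bu
      , ℚ.≮⇒≥ (λ bv<bu → ℚ.<-irrefl refl (ℚ.<-≤-trans <bv (max v bv<bu))) , <rv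

  top-left : Fin n → ∃[ u ] l u ≡ fl × t u ≡ ft
  top-left i
    with u , covers lu≤ _ tu≤ _ ← cover ℚ.≤-refl (ℚ.≤-<-trans (fl≤l i) (ℚ.<-≤-trans (l<r i) (r≤fr i)))
                                        ℚ.≤-refl (ℚ.≤-<-trans (ft≤t i) (ℚ.<-≤-trans (t<b i) (b≤fb i)))
    = u , ℚ.≤-antisym lu≤ (fl≤l u) , ℚ.≤-antisym tu≤ (ft≤t u)

label : ∀ {n} (G : Dissection (suc n)) → Labelled G
label {zero} G = record
  { num = Perm.id ; L = λ _ → zero ; R = λ _ → suc zero ; T = λ _ → zero ; B = λ _ → suc zero
  ; diagonal = record
    { L≤ = λ _ → z≤n ; <R = λ { zero → s≤s z≤n } ; T≤ = λ _ → z≤n ; <B = λ { zero → s≤s z≤n }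
    ; balanced = record { balance = λ F → ℤ.+-identityʳ _ } }
  ; xs = λ { zero → fl ; (suc zero) → fr } ; ys = λ { zero → ft ; (suc zero) → fb }
  ; l≡ = λ { zero → left } ; r≡ = λ { zero → right } ; t≡ = λ { zero → top } ; b≡ = λ { zero → bottom }
  ; fl≡ = refl ; fr≡ = refl ; ft≡ = refl ; fb≡ = refl
  ; L-frame = λ _ _ → refl ; T-frame = λ _ _ → refl }
  where
  open Dissection G
  left : l zero ≡ fl
  left with zero , eq , _ ← top-left G zero = eq
  top : t zero ≡ ft
  top with zero , _ , eq ← top-left G zero = eq
  right : r zero ≡ fr
  right with r zero <? fr
  ... | no  r≮fr = ℚ.≤-antisym (r≤fr zero) (ℚ.≮⇒≥ r≮fr)
  ... | yes r<fr with zero , _ , _ , _ , r<r ← neighbour G left top r<fr = ⊥-elim (ℚ.<-irrefl refl r<r)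
  bottom : b zero ≡ fb
  bottom with b zero <? fb
  ... | no  b≮fb = ℚ.≤-antisym (b≤fb zero) (ℚ.≮⇒≥ b≮fb)
  ... | yes b<fb with zero , _ , _ , _ , b<b ← neighbour (Dissection-transpose G) top left b<fb = ⊥-elim (ℚ.<-irrefl refl b<b)
label {suc n} G = dispatch (top-left G zero)
  where
  open Dissection G

  vertical : ∀ u v → l u ≡ fl → t u ≡ ft → l v ≡ r u → b v ≡ b u → Labelled G
  vertical u v p q p′ q′ = Removal.Relabel.labelled G u v p q p′ q′ (label (Removal.reduced G u v p q p′ q′))

  horizontal : ∀ u v → l u ≡ fl → t u ≡ ft → t v ≡ b u → r v ≡ r u → Labelled G
  horizontal u v p q p′ q′ = Labelled-transpose
    (Removal.Relabel.labelled Gᵀ u v q p p′ q′ (label (Removal.reduced Gᵀ u v q p p′ q′)))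
    where Gᵀ = Dissection-transpose G

  -- Unless `u` fills the frame, one of its inner edges is a complete wall: otherwise the right and
  -- the lower neighbour would both cover the lower right corner of `u`.
  dispatch : ∃[ u ] l u ≡ fl × t u ≡ ft → Labelled G
  dispatch (u , p , q) with r u <? fr | b u <? fb
  ... | no r≮ | no b≮ = ⊥-elim (Fin.punchInᵢ≢i u zero (sym (same
      (covers (subst (_≤ l j) (sym p) (fl≤l j)) (ℚ.<-≤-trans (l<r j) (ℚ.≤-trans (r≤fr j) (ℚ.≮⇒≥ r≮)))
              (subst (_≤ t j) (sym q) (ft≤t j)) (ℚ.<-≤-trans (t<b j) (ℚ.≤-trans (b≤fb j) (ℚ.≮⇒≥ b≮))))
      (covers ℚ.≤-refl (l<r j) ℚ.≤-refl (t<b j)))))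
    where
    j : Fin (suc (suc n))
    j = punchIn u zero
  ... | yes r< | no b≮ with v , lv≡ , _ , bu≤bv , _ ← neighbour G p q r< =
    vertical u v p q lv≡ (ℚ.≤-antisym (ℚ.≤-trans (b≤fb v) (ℚ.≮⇒≥ b≮)) bu≤bv)
  ... | no r≮ | yes b< with v , tv≡ , _ , ru≤rv , _ ← neighbour (Dissection-transpose G) q p b< =
    horizontal u v p q tv≡ (ℚ.≤-antisym (ℚ.≤-trans (r≤fr v) (ℚ.≮⇒≥ r≮)) ru≤rv)
  ... | yes r< | yes b<
    with v , lv≡ , tv< , bu≤bv , <rv ← neighbour G p q r<
    with w , tw≡ , lw< , ru≤rw , <bw ← neighbour (Dissection-transpose G) q p b<
    with b u <? b v | r u <? r w
  ... | no ≮bv | _ = vertical u v p q lv≡ (ℚ.≤-antisym (ℚ.≮⇒≥ ≮bv) bu≤bv)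
  ... | yes _ | no ≮rw = horizontal u w p q tw≡ (ℚ.≤-antisym (ℚ.≮⇒≥ ≮rw) ru≤rw)
  ... | yes <bv | yes <rw = ⊥-elim (ℚ.<-irrefl (trans (cong l (same
          (covers (ℚ.<⇒≤ lw<) <rw (ℚ.≤-reflexive tw≡) <bw)
          (covers (ℚ.≤-reflexive lv≡) <rv (ℚ.<⇒≤ tv<) <bv))) lv≡) lw<)

-- Half-open tiles

-- Moving from `x` to `y` meets no value `w i`, so a closed tile containing the moved point contains
-- the original one in the half-open sense.
just-above : ∀ {n} (w : Fin n → ℚ) {x z} → x < z → ∃[ y ] x < y × y < z × (∀ i → x < w i → y < w i)
just-above {zero}  w x<z with y , x<y , y<z ← ℚ.<-dense x<z = y , x<y , y<z , λ ()
just-above {suc n} w {x} x<z with y , x<y , y<z , min ← just-above (w ∘ suc) x<z | x <? w zero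
... | no x≮w₀ = y , x<y , y<z , λ { zero x<w₀ → ⊥-elim (x≮w₀ x<w₀) ; (suc i) → min i }
... | yes x<w₀ with ℚ.<-cmp y (w zero)
...   | tri< y<w₀ _ _ = y , x<y , y<z , λ { zero _ → y<w₀ ; (suc i) → min i }
...   | tri≈ _ refl _ with y′ , x<y′ , y′<y ← ℚ.<-dense x<y =
  y′ , x<y′ , ℚ.<-trans y′<y y<z , λ { zero _ → y′<y ; (suc i) q → ℚ.<-trans y′<y (min i q) }
...   | tri> _ _ w₀<y with y′ , x<y′ , y′<w₀ ← ℚ.<-dense x<w₀ =
  y′ , x<y′ , ℚ.<-trans y′<w₀ (ℚ.<-trans w₀<y y<z)
  , λ { zero _ → y′<w₀ ; (suc i) q → ℚ.<-trans (ℚ.<-trans y′<w₀ w₀<y) (min i q) }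

just-above₂ : ∀ {n} (v w : Fin n → ℚ) {x z} → x < z →
  ∃[ y ] x < y × y < z × (∀ i → x < v i → y < v i) × (∀ i → x < w i → y < w i)
just-above₂ v w x<z
  with y , x<y , y<z , below-v ← just-above v x<z
  with y′ , x<y′ , y′<y , below-w ← just-above w x<y =
  y′ , x<y′ , ℚ.<-trans y′<y y<z , (λ i q → ℚ.<-trans y′<y (below-v i q)) , below-w

neg-involutive : ∀ p → ℚ.- (ℚ.- p) ≡ p
neg-involutive = ⁻¹-involutive
  where open import Algebra.Properties.Group ℚ.+-0-group using (⁻¹-involutive)

neg-≤ : ∀ {p q} → p ≤ ℚ.- q → q ≤ ℚ.- p
neg-≤ {p} {q} p≤-q = subst (_≤ ℚ.- p) (neg-involutive q) (ℚ.neg-antimono-≤ p≤-q)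

neg-≤′ : ∀ {p q} → ℚ.- p ≤ q → ℚ.- q ≤ p
neg-≤′ {p} {q} -p≤q = subst (ℚ.- q ≤_) (neg-involutive p) (ℚ.neg-antimono-≤ -p≤q)

neg-< : ∀ {p q} → p < ℚ.- q → q < ℚ.- p
neg-< {p} {q} p<-q = subst (_< ℚ.- p) (neg-involutive q) (ℚ.neg-antimono-< p<-q)

neg-<′ : ∀ {p q} → ℚ.- p < q → ℚ.- q < p
neg-<′ {p} {q} -p<q = subst (ℚ.- q <_) (neg-involutive p) (ℚ.neg-antimono-< -p<q)

module HalfOpen {n} (R : Layout n) (tiling : IsTiling R) where
  open IsTiling tiling

  private
    low-inside : ∀ i c → lo (frame R) c ≤ lo (tile R i) c
    low-inside i c = proj₁ (inside i (lo (tile R i)) (λ c → ℚ.≤-refl , ℚ.<⇒≤ (nondegenerate i c)) c)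

    high-inside : ∀ i c → hi (tile R i) c ≤ hi (frame R) c
    high-inside i c = proj₂ (inside i (hi (tile R i)) (λ c → ℚ.<⇒≤ (nondegenerate i c) , ℚ.≤-refl) c)

    l r t b : Fin n → ℚ
    l i = lo (tile R i) X
    r i = hi (tile R i) X
    t i = ℚ.- hi (tile R i) Y
    b i = ℚ.- lo (tile R i) Y

    fl fr ft fb : ℚ
    fl = lo (frame R) X
    fr = hi (frame R) X
    ft = ℚ.- hi (frame R) Y
    fb = ℚ.- lo (frame R) Y

    point : ℚ → ℚ → Point
    point x y X = x
    point x y Y = ℚ.- y

    cover : ∀ {x y} → fl ≤ x → x < fr → ft ≤ y → y < fb → ∃[ i ] Covers l r t b x y i
    cover {x} {y} fl≤x x<fr ft≤y y<fb
      with x′ , x<x′ , x′<fr , x-l , x-r ← just-above₂ l r x<fr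
      with y′ , y<y′ , y′<fb , y-t , y-b ← just-above₂ t b y<fb
      with i , inᵢ ← covering (point x′ y′) (λ
             { X → ℚ.≤-trans fl≤x (ℚ.<⇒≤ x<x′) , ℚ.<⇒≤ x′<fr
             ; Y → neg-≤ (ℚ.<⇒≤ y′<fb) , neg-≤′ (ℚ.≤-trans ft≤y (ℚ.<⇒≤ y<y′)) }) =
      i , covers (ℚ.≮⇒≥ λ x<l → ℚ.<-irrefl refl (ℚ.<-≤-trans (x-l i x<l) (proj₁ (inᵢ X))))
                 (ℚ.<-≤-trans x<x′ (proj₂ (inᵢ X)))
                 (ℚ.≮⇒≥ λ y<t → ℚ.<-irrefl refl (ℚ.<-≤-trans (y-t i y<t) (neg-≤′ (proj₂ (inᵢ Y)))))
                 (ℚ.<-≤-trans y<y′ (neg-≤ (proj₁ (inᵢ Y))))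

    same : ∀ {x y i j} → Covers l r t b x y i → Covers l r t b x y j → i ≡ j
    same {x} {y} {i} {j} (covers l≤x x<r t≤y y<b) (covers l≤x′ x<r′ t≤y′ y<b′)
      with x′ , x<x′ , _ , _ , x-r ← just-above₂ l r x<r
      with y′ , y<y′ , _ , _ , y-b ← just-above₂ t b y<b =
      disjoint i j (point x′ y′)
        (λ { X → ℚ.≤-<-trans l≤x x<x′ , x-r i x<r ; Y → neg-< (y-b i y<b) , neg-<′ (ℚ.≤-<-trans t≤y y<y′) })
        (λ { X → ℚ.≤-<-trans l≤x′ x<x′ , x-r j x<r′ ; Y → neg-< (y-b j y<b′) , neg-<′ (ℚ.≤-<-trans t≤y′ y<y′) })

  dissection : Dissection n
  dissection = record
    { l = l ; r = r ; t = t ; b = b ; fl = fl ; fr = fr ; ft = ft ; fb = fb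
    ; l<r = λ i → nondegenerate i X
    ; t<b = λ i → ℚ.neg-antimono-< (nondegenerate i Y)
    ; fl≤l = λ i → low-inside i X ; r≤fr = λ i → high-inside i X
    ; ft≤t = λ i → ℚ.neg-antimono-≤ (high-inside i Y) ; b≤fb = λ i → ℚ.neg-antimono-≤ (low-inside i Y)
    ; cover = cover ; same = same }

open HalfOpen public using (dissection)

-- Tilings with prescribed coordinates of the walls

-- A relation, because `other (other c)` does not reduce for a variable `c`; here both orders of the
-- axes are on an equal footing by `Opp-sym`.
data Opp : Axis → Axis → Set where
  XY : Opp X Y
  YX : Opp Y X

opp : ∀ c → Opp c (other c)
opp X = XY
opp Y = YX

Opp-sym : ∀ {c d} → Opp c d → Opp d c
Opp-sym XY = YX
Opp-sym YX = XY

other≡ : ∀ {c d} → Opp c d → other c ≡ d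
other≡ XY = refl
other≡ YX = refl

both : ∀ {c d} → Opp c d → (P : Axis → Set) → P c → P d → ∀ e → P e
both XY P p q X = p
both XY P p q Y = q
both YX P p q X = q
both YX P p q Y = p

point : Axis → ℚ → ℚ → Point
point X a b X = a
point X a b Y = b
point Y a b X = b
point Y a b Y = a

point-on : ∀ c a b → point c a b c ≡ a
point-on X _ _ = refl
point-on Y _ _ = refl

point-off : ∀ {c d} → Opp c d → ∀ a b → point c a b d ≡ b
point-off XY _ _ = refl
point-off YX _ _ = refl

∈ˢ-point : ∀ s {a} → start s ≤ a → a ≤ stop s → point (normal s) (pos s) a ∈ˢ s
∈ˢ-point s {a} p q = point-on (normal s) (pos s) a
  , subst (start s ≤_) (sym (point-off (opp (normal s)) (pos s) a)) p
  , subst (_≤ stop s) (sym (point-off (opp (normal s)) (pos s) a)) q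

record _⊑_ (s s′ : Segment) : Set where
  constructor ⊑-intro
  field
    normal≡ : normal s ≡ normal s′
    pos≡    : pos s ≡ pos s′
    start≥  : start s′ ≤ start s
    stop≤   : stop s ≤ stop s′

open _⊑_ public

⊑⇒⊆ : ∀ {s s′} → s ⊑ s′ → s ⊆ˢ s′
⊑⇒⊆ (⊑-intro refl refl p q) _ (on , below , above) = on , ℚ.≤-trans p below , ℚ.≤-trans above q

-- Properness fixes the direction: in a perpendicular segment both ends of `s` would have the same
-- coordinate along `s`.
⊆⇒⊑ : ∀ {s s′} → start s < stop s → s ⊆ˢ s′ → s ⊑ s′
⊆⇒⊑ {s} {s′} st<sp s⊆s′ = go (normal s) (normal s′) refl refl
  where
  P Q : Point
  P = point (normal s) (pos s) (start s)
  Q = point (normal s) (pos s) (stop s)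
  first : P ∈ˢ s′
  first = s⊆s′ P (∈ˢ-point s ℚ.≤-refl (ℚ.<⇒≤ st<sp))
  last : Q ∈ˢ s′
  last = s⊆s′ Q (∈ˢ-point s (ℚ.<⇒≤ st<sp) ℚ.≤-refl)
  parallel : normal s ≡ normal s′ → s ⊑ s′
  parallel refl = ⊑-intro refl (trans (sym (point-on (normal s) (pos s) (start s))) (proj₁ first))
    (subst (start s′ ≤_) (point-off (opp (normal s)) (pos s) (start s)) (proj₁ (proj₂ first)))
    (subst (_≤ stop s′) (point-off (opp (normal s)) (pos s) (stop s)) (proj₂ (proj₂ last)))
  crossing : Opp (normal s) (normal s′) → s ⊑ s′
  crossing o = ⊥-elim (ℚ.<-irrefl
    (trans (sym (point-off o (pos s) (start s))) (trans (proj₁ first) (trans (sym (proj₁ last)) (point-off o (pos s) (stop s))))) st<sp)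
  go : ∀ c c′ → c ≡ normal s → c′ ≡ normal s′ → s ⊑ s′
  go X X p q = parallel (trans (sym p) q)
  go Y Y p q = parallel (trans (sym p) q)
  go X Y p q = crossing (subst₂ Opp p q XY)
  go Y X p q = crossing (subst₂ Opp p q YX)

-- A pair of sides selects a quadrant at a point: `At low-side y` holds for intervals that continue
-- above `y`, `At high-side y` for those that continue below it. The interval of a tile contains its
-- own end of the given side.
data Side : Set where
  low-side high-side : Side

pick : ∀ {A : Set} → Side → A → A → A
pick low-side  x y = x
pick high-side x y = y

-- Half-open intervals, named after the end that belongs to them.
At : Side → ℚ → ℚ → ℚ → Set
At low-side  y a b = a ≤ y × y < b
At high-side y a b = a < y × y ≤ b

At-weaken : ∀ s {y a b} → At s y a b → a ≤ y × y ≤ b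
At-weaken low-side  (p , q) = p , ℚ.<⇒≤ q
At-weaken high-side (p , q) = ℚ.<⇒≤ p , q

At-nonempty : ∀ s {y a b} → At s y a b → a < b
At-nonempty low-side  (p , q) = ℚ.≤-<-trans p q
At-nonempty high-side (p , q) = ℚ.<-≤-trans p q

At-inside : ∀ s {y a b} → a < y → y < b → At s y a b
At-inside low-side  p q = ℚ.<⇒≤ p , q
At-inside high-side p q = p , ℚ.<⇒≤ q

At-closed : ∀ {y a b} → a < b → a ≤ y → y ≤ b → ∃[ s ] At s y a b
At-closed {y} {a} {b} a<b a≤y y≤b with y <? b
... | yes y<b = low-side , a≤y , y<b
... | no  y≮b = high-side , ℚ.<-≤-trans a<b (ℚ.≮⇒≥ y≮b) , y≤b

-- Labelled tilings and their realizations

-- A tiling up to wall slides: tiles are given by the labels of their walls, and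
-- st and sp give the labels of the walls in which a wall starts and stops.
record Mosaic (n : ℕ) : Set where
  field
    low high : Axis → Fin n → Fin (suc n)
    fl fh    : Axis → Fin (suc n)
    st sp    : Axis → Fin (suc n) → Fin (suc n)

  side : Side → Axis → Fin n → Fin (suc n)
  side s = pick s low high

  on : Side → Axis → Fin (suc n) → Fin n → Bool
  on s c k i = does (side s c i Fin.≟ k)

  Wall : Axis → Fin (suc n) → Set
  Wall c k = k ≢ fl c × k ≢ fh c × ∃[ s ] ∃[ i ] side s c i ≡ k

  field
    low≢fh   : ∀ c i → low c i ≢ fh c
    high≢fl  : ∀ c i → high c i ≢ fl c
    balanced : ∀ {c d} → Opp c d → Balanced (low c) (high c) (low d) (high d) (fl c) (fh c) (fl d) (fh d)
    chain    : ∀ {c d} → Opp c d → ∀ s {k} → Wall c k → Chain (on s c k) (low d) (high d) (st c k) (sp c k)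
    -- At a crossing of two walls the tiles in opposite quadrants would have these labels.
    nocross  : ∀ {c d} → Opp c d → ∀ {i j} → low c i ≡ high c j → low d i ≡ high d j → ⊥

record Coordinates {n} (M : Mosaic n) : Set where
  open Mosaic M
  field
    co       : Axis → Fin (suc n) → ℚ
    co-tile  : ∀ c i → co c (low c i) < co c (high c i)
    co-frame : ∀ c → co c (fl c) < co c (fh c)

module Realization {n} (M : Mosaic n) (C : Coordinates M) where
  open Mosaic M
  open Coordinates C public

  Lo Hi : Axis → Fin n → ℚ
  Lo c i = co c (low c i)
  Hi c i = co c (high c i)

  cut : Axis → Side → ℚ → Fin (suc n) → Bool
  cut c low-side  y k = does (co c k ≤? y)
  cut c high-side y k = does (co c k <? y)

  cut-monotone : ∀ c s {y k k′} → co c k < co c k′ → Monotone (cut c s y) k k′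
  cut-monotone c low-side  {y} {k} {k′} k<k′ = monotone λ eq →
    dec-true (co c k ≤? y) (ℚ.≤-trans (ℚ.<⇒≤ k<k′) (true⇒ (co c k′ ≤? y) eq))
  cut-monotone c high-side {y} {k} {k′} k<k′ = monotone λ eq →
    dec-true (co c k <? y) (ℚ.<-trans k<k′ (true⇒ (co c k′ <? y) eq))

  to-cut : ∀ c s {y k k′} → At s y (co c k) (co c k′) → Inside (cut c s y) k k′
  to-cut c low-side  {y} {k} {k′} (p , q) =
    cut-at (dec-true (co c k ≤? y) p) (dec-false (co c k′ ≤? y) (λ r → ℚ.<-irrefl refl (ℚ.<-≤-trans q r)))
  to-cut c high-side {y} {k} {k′} (p , q) =
    cut-at (dec-true (co c k <? y) p) (dec-false (co c k′ <? y) (λ r → ℚ.<-irrefl refl (ℚ.<-≤-trans r q)))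

  from-cut : ∀ c s {y k k′} → Inside (cut c s y) k k′ → At s y (co c k) (co c k′)
  from-cut c low-side  {y} {k} {k′} (cut-at p q) = true⇒ (co c k ≤? y) p , ℚ.≰⇒> (false⇒ (co c k′ ≤? y) q)
  from-cut c high-side {y} {k} {k′} (cut-at p q) = true⇒ (co c k <? y) p , ℚ.≮⇒≥ (false⇒ (co c k′ <? y) q)

  module _ {c d} (o : Opp c d) (s s′ : Side) {x y : ℚ} where
    private
      module Cov = Covering (balanced o) (cut c s x) (cut d s′ y)
        (λ i → cut-monotone c s (co-tile c i)) (λ i → cut-monotone d s′ (co-tile d i))
        (cut-monotone c s (co-frame c)) (cut-monotone d s′ (co-frame d))

    tile-at : At s x (co c (fl c)) (co c (fh c)) → At s′ y (co d (fl d)) (co d (fh d)) →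
              ∃[ i ] At s x (Lo c i) (Hi c i) × At s′ y (Lo d i) (Hi d i)
    tile-at p q = let i , p′ , q′ = Cov.covered (to-cut c s p) (to-cut d s′ q) in i , from-cut c s p′ , from-cut d s′ q′

    tile-unique : ∀ {i j} → At s x (Lo c i) (Hi c i) → At s′ y (Lo d i) (Hi d i) →
                  At s x (Lo c j) (Hi c j) → At s′ y (Lo d j) (Hi d j) → i ≡ j
    tile-unique p q p′ q′ = Cov.covered-once (to-cut c s p) (to-cut d s′ q) (to-cut c s p′) (to-cut d s′ q′)

    tile-in-frame : ∀ {i} → At s x (Lo c i) (Hi c i) → At s′ y (Lo d i) (Hi d i) →
                    At s x (co c (fl c)) (co c (fh c)) × At s′ y (co d (fl d)) (co d (fh d))
    tile-in-frame p q = let p′ , q′ = Cov.covered-inside (to-cut c s p) (to-cut d s′ q) in from-cut c s p′ , from-cut d s′ q′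

  at-low : ∀ c i → At low-side (Lo c i) (Lo c i) (Hi c i)
  at-low c i = ℚ.≤-refl , co-tile c i

  at-high : ∀ c i → At high-side (Hi c i) (Lo c i) (Hi c i)
  at-high c i = co-tile c i , ℚ.≤-refl

  at-side : ∀ s c {i k} → side s c i ≡ k → At s (co c k) (Lo c i) (Hi c i)
  at-side low-side  c refl = at-low c _
  at-side high-side c refl = at-high c _

  -- A point outside the frame is covered by no tile, and a tile covers its own low corner.
  frame≤Lo : ∀ {c d} → Opp c d → ∀ i → co c (fl c) ≤ Lo c i
  frame≤Lo {c} {d} o i = proj₁ (proj₁ (tile-in-frame o low-side low-side (at-low c i) (at-low d i)))

  Hi≤frame : ∀ {c d} → Opp c d → ∀ i → Hi c i ≤ co c (fh c)
  Hi≤frame {c} {d} o i = proj₂ (proj₁ (tile-in-frame o high-side high-side (at-high c i) (at-high d i)))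

  module _ {c d} (o : Opp c d) {k : Fin (suc n)} (w : Wall c k) (s s′ : Side) {y : ℚ} where
    private
      module Ch = Chaining (chain o s w) (cut d s′ y) (λ i → cut-monotone d s′ (co-tile d i))

    beside : At s′ y (co d (st c k)) (co d (sp c k)) → ∃[ i ] side s c i ≡ k × At s′ y (Lo d i) (Hi d i)
    beside p = let i , onᵢ , q = Ch.chain-covered (to-cut d s′ p) in i , true⇒ (side s c i Fin.≟ k) onᵢ , from-cut d s′ q

    along : ∀ {i} → side s c i ≡ k → At s′ y (Lo d i) (Hi d i) → At s′ y (co d (st c k)) (co d (sp c k))
    along {i} eq p = from-cut d s′ (Ch.chain-inside (dec-true (side s c i Fin.≟ k) eq) (to-cut d s′ p))

  module _ {c d} (o : Opp c d) {k : Fin (suc n)} (w : Wall c k) where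

    st≤Lo : ∀ s {i} → side s c i ≡ k → co d (st c k) ≤ Lo d i
    st≤Lo s {i} eq = proj₁ (along o w s low-side eq (at-low d i))

    Hi≤sp : ∀ s {i} → side s c i ≡ k → Hi d i ≤ co d (sp c k)
    Hi≤sp s {i} eq = proj₂ (along o w s high-side eq (at-high d i))

    st<sp : co d (st c k) < co d (sp c k)
    st<sp = let _ , _ , s , i , eq = w in At-nonempty low-side (along o w s low-side eq (at-low d i))

  -- The tile beside `k` at the height of `m` and the tile beside `m` at the place of `k` cover the
  -- same quadrant of the common point, hence coincide.
  corner : ∀ {c d} → Opp c d → ∀ s s′ {k m} → Wall c k → Wall d m →
           At s′ (co d m) (co d (st c k)) (co d (sp c k)) → At s (co c k) (co c (st d m)) (co c (sp d m)) →
           ∃[ i ] side s c i ≡ k × side s′ d i ≡ m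
  corner {c} {d} o s s′ {k} {m} wk wm p q =
    let i , iₖ , at-m = beside o wk s s′ p
        j , jₘ , at-k = beside (Opp-sym o) wm s′ s q
        i≡j = tile-unique o s s′ (at-side s c iₖ) at-m at-k (at-side s′ d jₘ)
    in i , iₖ , trans (cong (side s′ d) i≡j) jₘ

  -- `corner` in two opposite quadrants yields exactly the labels excluded by `nocross`.
  no-crossing : ∀ {c d} → Opp c d → ∀ {k m} → Wall c k → Wall d m →
    (∀ s → At s (co d m) (co d (st c k)) (co d (sp c k))) → (∀ s → At s (co c k) (co c (st d m)) (co c (sp d m))) → ⊥
  no-crossing o wk wm p q =
    let i , iₖ , iₘ = corner o low-side  low-side  wk wm (p low-side)  (q low-side)
        j , jₖ , jₘ = corner o high-side high-side wk wm (p high-side) (q high-side)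
    in nocross o (trans iₖ (sym jₖ)) (trans iₘ (sym jₘ))

smaller : ∀ {a p q} → a < p → a < q → ∃[ z ] a < z × z ≤ p × z ≤ q
smaller {p = p} {q} a<p a<q with ℚ.≤-total p q
... | inj₁ p≤q = p , a<p , ℚ.≤-refl , p≤q
... | inj₂ q≤p = q , a<q , q≤p , ℚ.≤-refl

injective⇒hits : ∀ {n} (f : Fin n → Fin n) → Injective _≡_ _≡_ f → ∀ y → ∃[ x ] f x ≡ y
injective⇒hits {suc n} f inj y with Fin.any? (λ x → f x Fin.≟ y)
... | yes hit = hit
... | no miss with i , j , i<j , eq ← Fin.pigeonhole (ℕ.n<1+n n) (λ x → punchOut (λ eq → miss (x , sym eq))) =
  ⊥-elim (Fin.<-irrefl (inj (Fin.punchOut-injective (λ e → miss (i , sym e)) (λ e → miss (j , sym e)) eq)) i<j)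

encode : Side → Side → Fin 4
encode low-side  low-side  = zero
encode low-side  high-side = suc zero
encode high-side low-side  = suc (suc zero)
encode high-side high-side = suc (suc (suc zero))

decode : Fin 4 → Side × Side
decode zero                   = low-side , low-side
decode (suc zero)             = low-side , high-side
decode (suc (suc zero))       = high-side , low-side
decode (suc (suc (suc zero))) = high-side , high-side

decode-encode : ∀ s t → decode (encode s t) ≡ (s , t)
decode-encode low-side  low-side  = refl
decode-encode low-side  high-side = refl
decode-encode high-side low-side  = refl
decode-encode high-side high-side = refl

encode-decode : ∀ k → encode (proj₁ (decode k)) (proj₂ (decode k)) ≡ k
encode-decode zero                   = refl
encode-decode (suc zero)             = refl
encode-decode (suc (suc zero))       = refl
encode-decode (suc (suc (suc zero))) = refl

encode-injective : ∀ s t s′ t′ → encode s t ≡ encode s′ t′ → s ≡ s′ × t ≡ t′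
encode-injective s t s′ t′ eq =
  let eq′ = trans (sym (decode-encode s t)) (trans (cong decode eq) (decode-encode s′ t′))
  in cong proj₁ eq′ , cong proj₂ eq′

-- Genericity and walls of a realization

module Rectangulation {n} (M : Mosaic n) (C : Coordinates M)
  (co-injective : ∀ c {k m} → Coordinates.co C c k ≡ Coordinates.co C c m → k ≡ m)
  (box : Rect)
  (lo-box : ∀ c → lo box c ≡ Coordinates.co C c (Mosaic.fl M c))
  (hi-box : ∀ c → hi box c ≡ Coordinates.co C c (Mosaic.fh M c))
  where

  open Mosaic M
  open Realization M C public

  layout : Layout n
  layout = record { frame = box ; tile = λ i → record { lo = λ c → Lo c i ; hi = λ c → Hi c i } }

  isTiling : IsTiling layout
  isTiling = record
    { nondegenerate = λ i c → co-tile c i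
    ; inside = λ i p p∈ c → subst (_≤ p c) (sym (lo-box c)) (ℚ.≤-trans (frame≤Lo (opp c) i) (proj₁ (p∈ c)))
                          , subst (p c ≤_) (sym (hi-box c)) (ℚ.≤-trans (proj₂ (p∈ c)) (Hi≤frame (opp c) i))
    ; disjoint = λ i j p p∈i p∈j → let at k p∈k c = At-inside low-side (proj₁ (p∈k c)) (proj₂ (p∈k c)) in
        tile-unique XY low-side low-side (at i p∈i X) (at i p∈i Y) (at j p∈j X) (at j p∈j Y)
    ; covering = λ p p∈ →
        let at : ∀ c → ∃[ s ] At s (p c) (co c (fl c)) (co c (fh c))
            at c = At-closed (co-frame c) (subst (_≤ p c) (lo-box c) (proj₁ (p∈ c))) (subst (p c ≤_) (hi-box c) (proj₂ (p∈ c)))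
            i , inX , inY = tile-at XY (proj₁ (at X)) (proj₁ (at Y)) (proj₂ (at X)) (proj₂ (at Y))
        in i , both XY (λ c → Lo c i ≤ p c × p c ≤ Hi c i) (At-weaken (proj₁ (at X)) inX) (At-weaken (proj₁ (at Y)) inY)
    }

  -- Four distinct tiles with corner `p` occupy the four quadrants, one each. As coordinates
  -- determine labels, those in two opposite quadrants contradict `nocross`.
  isGenericTiling : IsGenericTiling layout
  isGenericTiling = record { isTiling = isTiling ; generic = generic }
    where
    module _ (p : Point) (f : Fin 4 → Fin n) (f-injective : Injective _≡_ _≡_ f)
             (corners : ∀ k → p IsCornerOf tile layout (f k)) where

      side-at : Axis → Fin 4 → Side
      side-at c k with corners k c
      ... | inj₁ _ = low-side
      ... | inj₂ _ = high-side

      on-side : ∀ c k → p c ≡ co c (side (side-at c k) c (f k))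
      on-side c k with corners k c
      ... | inj₁ eq = eq
      ... | inj₂ eq = eq

      at : ∀ c k {s} → side-at c k ≡ s → At s (p c) (Lo c (f k)) (Hi c (f k))
      at c k refl = subst (λ z → At (side-at c k) z _ _) (sym (on-side c k)) (at-side (side-at c k) c refl)

      quadrant : Fin 4 → Fin 4
      quadrant k = encode (side-at X k) (side-at Y k)

      quadrant-injective : Injective _≡_ _≡_ quadrant
      quadrant-injective {k} {k′} eq with p , q ← encode-injective _ _ _ _ eq =
        f-injective (tile-unique XY _ _ (at X k refl) (at Y k refl) (at X k′ (sym p)) (at Y k′ (sym q)))

      same-label : ∀ c k k′ {s s′} → side-at c k ≡ s → side-at c k′ ≡ s′ → side s c (f k) ≡ side s′ c (f k′)
      same-label c k k′ refl refl = co-injective c (trans (sym (on-side c k)) (on-side c k′))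

      generic : ⊥
      generic with k , eq ← injective⇒hits quadrant quadrant-injective (encode low-side low-side)
              with k′ , eq′ ← injective⇒hits quadrant quadrant-injective (encode high-side high-side)
              with kX , kY ← encode-injective (side-at X k) (side-at Y k) low-side low-side eq
              with k′X , k′Y ← encode-injective (side-at X k′) (side-at Y k′) high-side high-side eq′ =
        nocross XY (same-label X k k′ kX k′X) (same-label Y k k′ kY k′Y)

  segment : Axis → Fin (suc n) → Segment
  segment c k = record { normal = c ; pos = co c k ; start = co (other c) (st c k) ; stop = co (other c) (sp c k) }

  edge-on : ∀ {c k i} s → Wall c k → side s c i ≡ k → pick s lowEdge highEdge c (tile layout i) ⊆ˢ segment c k
  edge-on {c} low-side  W eq = ⊑⇒⊆ (⊑-intro refl (cong (co c) eq) (st≤Lo (opp c) W low-side eq) (Hi≤sp (opp c) W low-side eq))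
  edge-on {c} high-side W eq = ⊑⇒⊆ (⊑-intro refl (cong (co c) eq) (st≤Lo (opp c) W high-side eq) (Hi≤sp (opp c) W high-side eq))

  co-strict : ∀ c {k m} → co c k ≤ co c m → k ≢ m → co c k < co c m
  co-strict c k≤m k≢m = ℚ.≰⇒> λ m≤k → k≢m (co-injective c (ℚ.≤-antisym k≤m m≤k))

  wall-in-frame : ∀ {c d} → Opp c d → ∀ {k} → Wall c k → co c (fl c) < co c k × co c k < co c (fh c)
  wall-in-frame {c} o (k≢fl , k≢fh , low-side  , i , refl) =
    co-strict c (frame≤Lo o i) (≢-sym k≢fl) , ℚ.<-≤-trans (co-tile c i) (Hi≤frame o i)
  wall-in-frame {c} o (k≢fl , k≢fh , high-side , i , refl) =
    ℚ.≤-<-trans (frame≤Lo o i) (co-tile c i) , co-strict c (Hi≤frame o i) k≢fh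

  -- Just before the start of wall `k` the tile on the high side cannot have its edge in `k`, whose
  -- tiles all begin at `st` or later. So the line of the wall runs into its interior.
  across-start : ∀ {c d} → Opp c d → ∀ {k} → Wall c k → co d (fl d) < co d (st c k) →
    ∃[ j ] Lo c j < co c k × co c k < Hi c j × Lo d j < co d (st c k) × co d (st c k) ≤ Hi d j
  across-start {c} {d} o {k} w fl<st =
    let fl<k , k<fh = wall-in-frame o w
        _ , _ , s , _ = w
        i , _ , st-at = beside o w s high-side (st<sp o w , ℚ.≤-refl)
        st≤fh = ℚ.≤-trans (ℚ.<⇒≤ (st<sp o w)) (ℚ.≤-trans (proj₂ st-at) (Hi≤frame (Opp-sym o) i))
        j , (lo≤ , <hi) , at = tile-at o low-side high-side (ℚ.<⇒≤ fl<k , k<fh) (fl<st , st≤fh)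
    in j , co-strict c lo≤ (λ eq → ℚ.<-irrefl refl (proj₁ (along o w low-side high-side eq at))) , <hi , at

  across-stop : ∀ {c d} → Opp c d → ∀ {k} → Wall c k → co d (sp c k) < co d (fh d) →
    ∃[ j ] Lo c j < co c k × co c k < Hi c j × Lo d j ≤ co d (sp c k) × co d (sp c k) < Hi d j
  across-stop {c} {d} o {k} w sp<fh =
    let fl<k , k<fh = wall-in-frame o w
        _ , _ , s , _ = w
        i , _ , sp-at = beside o w s low-side (ℚ.≤-refl , st<sp o w)
        fl≤sp = ℚ.≤-trans (frame≤Lo (Opp-sym o) i) (ℚ.≤-trans (proj₁ sp-at) (ℚ.<⇒≤ (st<sp o w)))
        j , (lo≤ , <hi) , at = tile-at o low-side low-side (ℚ.<⇒≤ fl<k , k<fh) (fl≤sp , sp<fh)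
    in j , co-strict c lo≤ (λ eq → ℚ.<-irrefl refl (proj₂ (along o w low-side low-side eq at))) , <hi , at

  segment-avoiding : ∀ {c k} → Wall c k → IsAvoidingSegment layout (segment c k)
  segment-avoiding {c} {k} w = record
    { proper = st<sp o w
    ; inFrame = λ p (on , st≤ , ≤sp) → both o (λ e → lo box e ≤ p e × p e ≤ hi box e)
        ( subst₂ _≤_ (sym (lo-box c)) (sym on) (ℚ.<⇒≤ (proj₁ (wall-in-frame o w)))
        , subst₂ _≤_ (sym on) (sym (hi-box c)) (ℚ.<⇒≤ (proj₂ (wall-in-frame o w))))
        (let _ , _ , s , _ = w
             i , _ , start-at = beside o w s low-side (ℚ.≤-refl , st<sp o w)
             j , _ , stop-at = beside o w s high-side (st<sp o w , ℚ.≤-refl)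
         in ℚ.≤-trans (subst (_≤ Lo d i) (sym (lo-box d)) (frame≤Lo (Opp-sym o) i)) (ℚ.≤-trans (proj₁ start-at) st≤)
          , ℚ.≤-trans ≤sp (ℚ.≤-trans (proj₂ stop-at) (subst (Hi d j ≤_) (sym (hi-box d)) (Hi≤frame (Opp-sym o) j))))
    ; avoiding = λ i p (on , st≤ , ≤sp) interior →
        let s , at = At-closed (st<sp o w) st≤ ≤sp
            j , lowⱼ , atⱼ = beside o w low-side s at
            i≡j = tile-unique o low-side s
                    (At-inside low-side (proj₁ (interior c)) (proj₂ (interior c)))
                    (At-inside s (proj₁ (interior d)) (proj₂ (interior d)))
                    (subst (λ z → At low-side z (Lo c j) (Hi c j)) (sym on) (at-side low-side c lowⱼ)) atⱼ
        in ℚ.<-irrefl (trans (cong (co c) (trans (cong (low c) i≡j) lowⱼ)) (sym on)) (proj₁ (interior c))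
    }
    where
    d = other c
    o = opp c

  segment-isWall : ∀ {c k} → Wall c k → IsWall layout (segment c k)
  segment-isWall {c} {k} w@(k≢fl , k≢fh , _) = record
    { isAvoiding = segment-avoiding w
    ; notInEdge = λ e → (λ ⊆e → not-in (lowEdge e box) (λ { refl → lo-box e }) k≢fl (⊆⇒⊑ (st<sp o w) ⊆e))
                      , (λ ⊆e → not-in (highEdge e box) (λ { refl → hi-box e }) k≢fh (⊆⇒⊑ (st<sp o w) ⊆e))
    ; maximal = maximal }
    where
    o = opp c
    d = other c

    not-in : ∀ {m} e → (c ≡ normal e → pos e ≡ co c m) → k ≢ m → segment c k ⊑ e → ⊥
    not-in e eq k≢m (⊑-intro n≡ p≡ _ _) = k≢m (co-injective c (trans p≡ (eq n≡)))

    -- A longer segment would enter the interior of the tile supplied by `across-start` or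
    -- `across-stop`.
    maximal : ∀ s → IsAvoidingSegment layout s → segment c k ⊆ˢ s → s ⊆ˢ segment c k
    maximal s av w⊆s with ⊑-intro refl refl start≤ ≤stop ← ⊆⇒⊑ {segment c k} {s} (st<sp o w) w⊆s =
      ⊑⇒⊆ (⊑-intro refl refl (ℚ.≮⇒≥ starts-later) (ℚ.≮⇒≥ stops-earlier))
      where
      open IsAvoidingSegment av
      in-interior : ∀ j {y} → Lo c j < co c k → co c k < Hi c j → Lo d j < y → y < Hi d j →
                    start s ≤ y → y ≤ stop s → ⊥
      in-interior j {y} p q p′ q′ ≥start ≤stop = avoiding j (point c (co c k) y) (∈ˢ-point s ≥start ≤stop)
        (both o (λ e → Lo e j < point c (co c k) y e × point c (co c k) y e < Hi e j)
          (subst (λ z → Lo c j < z × z < Hi c j) (sym (point-on c (co c k) y)) (p , q))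
          (subst (λ z → Lo d j < z × z < Hi d j) (sym (point-off o (co c k) y)) (p′ , q′)))

      ends-in-frame : ∀ {y} → start s ≤ y → y ≤ stop s → co d (fl d) ≤ y × y ≤ co d (fh d)
      ends-in-frame {y} ≥start ≤stop with p , q ← inFrame (point c (co c k) y) (∈ˢ-point s ≥start ≤stop) d =
        subst₂ _≤_ (lo-box d) (point-off o (co c k) y) p , subst₂ _≤_ (point-off o (co c k) y) (hi-box d) q

      starts-later : start s < co d (st c k) → ⊥
      starts-later start<st =
        let j , p , q , lo<st , st≤hi = across-start o w
              (ℚ.≤-<-trans (proj₁ (ends-in-frame ℚ.≤-refl (ℚ.<⇒≤ proper))) start<st)
            z , start≤z , lo≤z , least = larger (start s) (Lo d j)
            y , z<y , y<st = ℚ.<-dense (least start<st lo<st)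
        in in-interior j p q (ℚ.≤-<-trans lo≤z z<y) (ℚ.<-≤-trans y<st st≤hi) (ℚ.<⇒≤ (ℚ.≤-<-trans start≤z z<y))
             (ℚ.<⇒≤ (ℚ.<-≤-trans y<st (ℚ.≤-trans (ℚ.<⇒≤ (st<sp o w)) ≤stop)))

      stops-earlier : co d (sp c k) < stop s → ⊥
      stops-earlier sp<stop =
        let j , p , q , lo≤sp , sp<hi = across-stop o w
              (ℚ.<-≤-trans sp<stop (proj₂ (ends-in-frame (ℚ.<⇒≤ proper) ℚ.≤-refl)))
            z , sp<z , z≤stop , z≤hi = smaller sp<stop sp<hi
            y , sp<y , y<z = ℚ.<-dense sp<z
        in in-interior j p q (ℚ.≤-<-trans lo≤sp sp<y) (ℚ.<-≤-trans y<z z≤hi)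
             (ℚ.<⇒≤ (ℚ.≤-<-trans (ℚ.≤-trans start≤ (ℚ.<⇒≤ (st<sp o w))) sp<y)) (ℚ.<⇒≤ (ℚ.<-≤-trans y<z z≤stop))

  -- A wall contains a point of a labelled wall, and both are maximal.
  wall-is-segment : ∀ w → IsWall layout w → ∃[ k ] Wall (normal w) k × w ≡ segment (normal w) k
  wall-is-segment w isW = k , wall , segment-cong (sym lo≡pos) start≡ stop≡
    where
    open IsWall isW
    open IsAvoidingSegment isAvoiding
    c = normal w
    d = other c
    o = opp c

    in-box : ∀ {y} → start w ≤ y → y ≤ stop w → (lo box c ≤ pos w × pos w ≤ hi box c) × (lo box d ≤ y × y ≤ hi box d)
    in-box {y} p q =
      let in-p = inFrame (point c (pos w) y) (∈ˢ-point w p q)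
      in subst (λ z → lo box c ≤ z × z ≤ hi box c) (point-on c (pos w) y) (in-p c)
       , subst (λ z → lo box d ≤ z × z ≤ hi box d) (point-off o (pos w) y) (in-p d)

    at-start = in-box ℚ.≤-refl (ℚ.<⇒≤ proper)
    at-stop  = in-box (ℚ.<⇒≤ proper) ℚ.≤-refl

    frame<pos : co c (fl c) < pos w
    frame<pos = ℚ.≰⇒> λ pos≤ → proj₁ (notInEdge c) (⊑⇒⊆ (⊑-intro refl
      (ℚ.≤-antisym (subst (pos w ≤_) (sym (lo-box c)) pos≤) (proj₁ (proj₁ at-start)))
      (proj₁ (proj₂ at-start)) (proj₂ (proj₂ at-stop))))

    pos<frame : pos w < co c (fh c)
    pos<frame = ℚ.≰⇒> λ pos≥ → proj₂ (notInEdge c) (⊑⇒⊆ (⊑-intro refl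
      (ℚ.≤-antisym (proj₂ (proj₁ at-start)) (subst (_≤ pos w) (sym (hi-box c)) pos≥))
      (proj₁ (proj₂ at-start)) (proj₂ (proj₂ at-stop))))

    found = tile-at o low-side low-side (ℚ.<⇒≤ frame<pos , pos<frame)
      (subst (_≤ start w) (lo-box d) (proj₁ (proj₂ at-start)) , ℚ.<-≤-trans proper (subst (stop w ≤_) (hi-box d) (proj₂ (proj₂ at-stop))))
    j = proj₁ found
    k = low c j

    lo≡pos : co c k ≡ pos w
    lo≡pos = ℚ.≤-antisym (proj₁ (proj₁ (proj₂ found))) (ℚ.≮⇒≥ λ lo<pos →
      let z , start<z , z≤stop , z≤hi = smaller proper (proj₂ (proj₂ (proj₂ found)))
          y , start<y , y<z = ℚ.<-dense start<z
      in avoiding j (point c (pos w) y) (∈ˢ-point w (ℚ.<⇒≤ start<y) (ℚ.<⇒≤ (ℚ.<-≤-trans y<z z≤stop)))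
           (both o (λ e → Lo e j < point c (pos w) y e × point c (pos w) y e < Hi e j)
             (subst (λ z → Lo c j < z × z < Hi c j) (sym (point-on c (pos w) y)) (lo<pos , proj₂ (proj₁ (proj₂ found))))
             (subst (λ z → Lo d j < z × z < Hi d j) (sym (point-off o (pos w) y))
               (ℚ.≤-<-trans (proj₁ (proj₂ (proj₂ found))) start<y , ℚ.<-≤-trans y<z z≤hi))))

    wall : Wall c k
    wall = (λ k≡fl → ℚ.<-irrefl (trans (cong (co c) (sym k≡fl)) lo≡pos) frame<pos)
         , (λ k≡fh → ℚ.<-irrefl (trans (sym lo≡pos) (cong (co c) k≡fh)) pos<frame)
         , low-side , j , refl

    start-at : At low-side (start w) (co d (st c k)) (co d (sp c k))
    start-at = along o wall low-side low-side refl (proj₂ (proj₂ found))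

    upper = larger (stop w) (co d (sp c k))
    union : Segment
    union = record { normal = c ; pos = pos w ; start = co d (st c k) ; stop = proj₁ upper }

    on-wall : ∀ p → p ∈ˢ union → p ∈ˢ w ⊎ p ∈ˢ segment c k
    on-wall p (on , st≤ , ≤upper) = cases (p d ≤? co d (sp c k))
      where
      cases : Dec (p d ≤ co d (sp c k)) → p ∈ˢ w ⊎ p ∈ˢ segment c k
      cases (yes ≤sp) = inj₂ (trans on (sym lo≡pos) , st≤ , ≤sp)
      cases (no  ≰sp) = inj₁ (on , ℚ.<⇒≤ (ℚ.<-trans (proj₂ start-at) (ℚ.≰⇒> ≰sp)) , ℚ.≮⇒≥ λ stop<p →
        ℚ.<-irrefl refl (ℚ.<-≤-trans (proj₂ (proj₂ (proj₂ upper)) stop<p (ℚ.≰⇒> ≰sp)) ≤upper))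

    union-avoiding : IsAvoidingSegment layout union
    union-avoiding = record
      { proper = ℚ.<-≤-trans (st<sp o wall) (proj₁ (proj₂ (proj₂ upper)))
      ; inFrame = λ p p∈ → [ inFrame p , Seg.inFrame p ]′ (on-wall p p∈)
      ; avoiding = λ i p p∈ → [ avoiding i p , Seg.avoiding i p ]′ (on-wall p p∈) }
      where module Seg = IsAvoidingSegment (segment-avoiding wall)

    union⊑w : union ⊑ w
    union⊑w = ⊆⇒⊑ (IsAvoidingSegment.proper union-avoiding) (maximal union union-avoiding
      (⊑⇒⊆ (⊑-intro refl refl (proj₁ start-at) (proj₁ (proj₂ upper)))))

    union⊑segment : union ⊑ segment c k
    union⊑segment = ⊆⇒⊑ (IsAvoidingSegment.proper union-avoiding)
      (IsWall.maximal (segment-isWall wall) union union-avoiding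
        (⊑⇒⊆ (⊑-intro refl lo≡pos ℚ.≤-refl (proj₁ (proj₂ (proj₂ upper))))))

    start≡ : start w ≡ co d (st c k)
    start≡ = ℚ.≤-antisym (start≥ union⊑w) (proj₁ start-at)

    stop≡ : stop w ≡ co d (sp c k)
    stop≡ = ℚ.≤-antisym (ℚ.≤-trans (proj₁ (proj₂ upper)) (stop≤ union⊑segment))
                        (ℚ.≤-trans (proj₁ (proj₂ (proj₂ upper))) (stop≤ union⊑w))

    segment-cong : pos w ≡ co c k → start w ≡ co d (st c k) → stop w ≡ co d (sp c k) → w ≡ segment c k
    segment-cong p q r = trans
      (cong (λ z → record { normal = c ; pos = z ; start = start w ; stop = stop w }) p)
      (cong₂ (λ y z → record { normal = c ; pos = co c k ; start = y ; stop = z }) q r)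

-- Exchanging two walls

module Touching {n} (M : Mosaic n) (C : Coordinates M) where
  open Mosaic M
  open Realization M C

  Touch : Axis → Axis → Fin n → Fin n → Set
  Touch c d i j = high c i ≡ low c j × Lo d i ≤ Hi d j × Lo d j ≤ Hi d i

  module Injective (co-injective : ∀ c {k m} → co c k ≡ co c m → k ≡ m) where

    -- The tile on this side of `w` that covers the end of `i` begins there, or it would overlap
    -- `i`.
    next : ∀ {c d} → Opp c d → ∀ s {w i} → Wall d w → side s d i ≡ w → Hi c i < co c (sp d w) →
           ∃[ j ] side s d j ≡ w × low c j ≡ high c i
    next {c} {d} o s {w} {i} W onᵢ hi<sp =
      let j , onⱼ , (lo≤ , <hi) = beside (Opp-sym o) W s low-side
            (ℚ.≤-trans (st≤Lo (Opp-sym o) W s onᵢ) (ℚ.<⇒≤ (co-tile c i)) , hi<sp)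
      in j , onⱼ , co-injective c (ℚ.≤-antisym lo≤ (ℚ.≮⇒≥ λ lo< → ℚ.<-irrefl
           (cong (Hi c) (tile-unique (Opp-sym o) s high-side (at-side s d onᵢ) (at-high c i) (at-side s d onⱼ) (lo< , ℚ.<⇒≤ <hi)))
           <hi))

    previous : ∀ {c d} → Opp c d → ∀ s {w i} → Wall d w → side s d i ≡ w → co c (st d w) < Lo c i →
               ∃[ j ] side s d j ≡ w × high c j ≡ low c i
    previous {c} {d} o s {w} {i} W onᵢ st<lo =
      let j , onⱼ , (lo< , ≤hi) = beside (Opp-sym o) W s high-side
            (st<lo , ℚ.≤-trans (ℚ.<⇒≤ (co-tile c i)) (Hi≤sp (Opp-sym o) W s onᵢ))
      in j , onⱼ , co-injective c (ℚ.≤-antisym (ℚ.≮⇒≥ λ <hi → ℚ.<-irrefl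
           (cong (Lo c) (tile-unique (Opp-sym o) s low-side (at-side s d onⱼ) (ℚ.<⇒≤ lo< , <hi) (at-side s d onᵢ) (at-low c i)))
           lo<) ≤hi)

module _ {n} (M : Mosaic n) (C : Coordinates M)
  (co-injective : ∀ c {k m} → Coordinates.co C c k ≡ Coordinates.co C c m → k ≡ m)
  (box : Rect)
  (lo-box : ∀ c → lo box c ≡ Coordinates.co C c (Mosaic.fl M c))
  (hi-box : ∀ c → hi box c ≡ Coordinates.co C c (Mosaic.fh M c))
  where
  open Rectangulation M C co-injective box lo-box hi-box
  open Touching M C
  open Mosaic M

  private
    precedes⇒ : ∀ c {i j} → Precedes c layout i j → Touch c (other c) i j
    precedes⇒ c (p , (on , lo≤ , ≤hi) , (on′ , lo≤′ , ≤hi′)) =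
      co-injective c (trans (sym on) on′) , ℚ.≤-trans lo≤ ≤hi′ , ℚ.≤-trans lo≤′ ≤hi

    ⇒precedes : ∀ c {i j} → Touch c (other c) i j → Precedes c layout i j
    ⇒precedes c {i} {j} (eq , lo≤hi , lo≤hi′) =
      let d = other c
          z = Lo d i ℚ.⊔ Lo d j
          on = point-on c (Hi c i) z
          off = point-off (opp c) (Hi c i) z
      in point c (Hi c i) z
       , (on , subst (Lo d i ≤_) (sym off) (ℚ.p≤p⊔q (Lo d i) (Lo d j))
             , subst (_≤ Hi d i) (sym off) (ℚ.⊔-lub (ℚ.<⇒≤ (co-tile d i)) lo≤hi′))
       , (trans on (cong (co c) eq) , subst (Lo d j ≤_) (sym off) (ℚ.p≤q⊔p (Lo d i) (Lo d j))
             , subst (_≤ Hi d j) (sym off) (ℚ.⊔-lub lo≤hi (ℚ.<⇒≤ (co-tile d j))))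

  precedes⇔ : ∀ {c d} → Opp c d → ∀ {i j} → Precedes c layout i j ⇔ Touch c d i j
  precedes⇔ XY = mk⇔ (precedes⇒ X) (⇒precedes X)
  precedes⇔ YX = mk⇔ (precedes⇒ Y) (⇒precedes Y)

-- The order of the labels changes only for the pair `k`, `m`. That they are neighbours in the order
-- is a consequence, see `<m⇒<k`.
record Exchange {n} {M : Mosaic n} (C C′ : Coordinates M) {c d} (o : Opp c d) (k m : Fin (suc n)) : Set where
  private
    co  = Coordinates.co C
    co′ = Coordinates.co C′
  field
    same-d  : ∀ a b → co d a < co d b → co′ d a < co′ d b
    same-d′ : ∀ a b → co′ d a < co′ d b → co d a < co d b
    same-c  : ∀ a b → ¬ (a ≡ k × b ≡ m) → co c a < co c b → co′ c a < co′ c b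
    same-c′ : ∀ a b → ¬ (a ≡ m × b ≡ k) → co′ c a < co′ c b → co c a < co c b
    k<m     : co c k < co c m
    m<k     : co′ c m < co′ c k

Exchange-sym : ∀ {n} {M : Mosaic n} {C C′ : Coordinates M} {c d} {o : Opp c d} {k m} →
               Exchange C C′ o k m → Exchange C′ C o m k
Exchange-sym ex = record
  { same-d = same-d′ ; same-d′ = same-d ; same-c = same-c′ ; same-c′ = same-c ; k<m = m<k ; m<k = k<m }
  where open Exchange ex

module Meeting {n} {M : Mosaic n} {C C′ : Coordinates M}
  (co-injective : ∀ c {k m} → Coordinates.co C c k ≡ Coordinates.co C c m → k ≡ m)
  {c d} {o : Opp c d} {k m : Fin (suc n)} (ex : Exchange C C′ o k m) where
  open Mosaic M
  open Exchange ex
  open Realization M C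
  open Touching M C
  open Injective co-injective
  private
    co′ = Coordinates.co C′
    o′ = Opp-sym o

  -- Walls k and m end at the same wall, coming from its low and its high side.
  Meet : Fin n → Fin n → Set
  Meet i j = high d i ≡ low d j × low c i ≡ k × high c j ≡ m

  meet? : ∀ i j → Dec (Meet i j)
  meet? i j = (high d i Fin.≟ low d j) ×-dec ((low c i Fin.≟ k) ×-dec (high c j Fin.≟ m))

  k≢m : k ≢ m
  k≢m k≡m = ℚ.<-irrefl (cong (co c) k≡m) k<m

  -- After the exchange such a tile would have negative size.
  none-between : ∀ {i} → low c i ≡ k → high c i ≡ m → ⊥
  none-between {i} lowᵢ highᵢ = ℚ.<-irrefl refl (ℚ.<-trans m<k
    (subst₂ (λ a b → co′ c a < co′ c b) lowᵢ highᵢ (Coordinates.co-tile C′ c i)))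

  -- In the new coordinates `a` comes before `m`, and `m` before `k`; the comparison of `a` with `k`
  -- then carries back to the old ones.
  <m⇒<k : ∀ {a} → a ≢ k → co c a < co c m → co c a < co c k
  <m⇒<k {a} a≢k a<m = same-c′ a k (λ { (refl , _) → ℚ.<-irrefl refl a<m })
    (ℚ.<-trans (same-c a m (λ (a≡k , _) → a≢k a≡k) a<m) m<k)

  k<⇒m< : ∀ {a} → a ≢ m → co c k < co c a → co c m < co c a
  k<⇒m< {a} a≢m k<a = same-c′ m a (λ { (_ , refl) → ℚ.<-irrefl refl k<a })
    (ℚ.<-trans m<k (same-c k a (λ (_ , a≡m) → a≢m a≡m) k<a))

  -- Walls k and m pointing in from opposite sides may also be seen from the other
  -- two tiles at their ends.
  from-outside : ∀ {i j} → high d i ≡ low d j → high c i ≡ k → low c j ≡ m → ∃[ i′ ] ∃[ j′ ] Meet i′ j′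
  from-outside {i} {j} eq highᵢ lowⱼ =
    let i′ , onᵢ , lowᵢ = next o high-side {i = i} W refl
          (subst (λ z → co c z < co c (sp d w)) (sym highᵢ) (ℚ.<-≤-trans (ℚ.<-trans k<m m<hi) hi≤sp))
        j′ , onⱼ , highⱼ = previous o low-side {i = j} W (sym eq)
          (subst (λ z → co c (st d w) < co c z) (sym lowⱼ) (ℚ.≤-<-trans st≤lo (ℚ.<-trans lo<k k<m)))
    in i′ , j′ , trans onᵢ (sym onⱼ) , trans lowᵢ highᵢ , trans highⱼ lowⱼ
    where
    w = high d i
    W : Wall d w
    W = high≢fl d i , (λ w≡fh → low≢fh d j (trans (sym eq) w≡fh)) , high-side , i , refl
    m<hi : co c m < Hi c j
    m<hi = subst (λ z → co c z < Hi c j) lowⱼ (co-tile c j)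
    lo<k : Lo c i < co c k
    lo<k = subst (λ z → Lo c i < co c z) highᵢ (co-tile c i)
    hi≤sp : Hi c j ≤ co c (sp d w)
    hi≤sp = Hi≤sp o′ W low-side (sym eq)
    st≤lo : co c (st d w) ≤ Lo c i
    st≤lo = st≤Lo o′ W high-side refl

  module At-wall {i j} (meet : Meet i j) where
    private
      eq    = proj₁ meet
      lowᵢ  = proj₁ (proj₂ meet)
      highⱼ = proj₂ (proj₂ meet)

    w : Fin (suc n)
    w = high d i

    lo<k : Lo c j < co c k
    lo<k = <m⇒<k (λ lowⱼ → none-between lowⱼ highⱼ) (subst (λ z → Lo c j < co c z) highⱼ (co-tile c j))

    m<hi : co c m < Hi c i
    m<hi = k<⇒m< (λ highᵢ → none-between lowᵢ highᵢ) (subst (λ z → co c z < Hi c i) lowᵢ (co-tile c i))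

    wall-w : Wall d w
    wall-w = high≢fl d i , (λ w≡fh → low≢fh d j (trans (sym eq) w≡fh)) , high-side , i , refl

    wall-k : Wall c k
    wall-k = (λ k≡fl → ℚ.<-irrefl refl (ℚ.<-≤-trans (subst (λ z → Lo c j < co c z) k≡fl lo<k) (frame≤Lo o j)))
           , (λ k≡fh → low≢fh c i (trans lowᵢ k≡fh)) , low-side , i , lowᵢ

    wall-m : Wall c m
    wall-m = (λ m≡fl → high≢fl c j (trans highⱼ m≡fl))
           , (λ m≡fh → ℚ.<-irrefl refl (ℚ.<-≤-trans (subst (λ z → co c z < Hi c i) m≡fh m<hi) (Hi≤frame o i)))
           , high-side , j , highⱼ

    st<k : co c (st d w) < co c k
    st<k = ℚ.≤-<-trans (st≤Lo o′ wall-w low-side (sym eq)) lo<k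

    m<sp : co c m < co c (sp d w)
    m<sp = ℚ.<-≤-trans m<hi (Hi≤sp o′ wall-w high-side refl)

    -- If wall `k` continued beyond `w`, the tile on its high side there would be `j`, contrary to
    -- `none-between`.
    stop-k : co d (sp c k) ≡ co d w
    stop-k = ℚ.≤-antisym
      (ℚ.≮⇒≥ λ w<sp →
        let f , lowf , at = beside o wall-k low-side low-side
              (ℚ.≤-trans (st≤Lo o wall-k low-side lowᵢ) (ℚ.<⇒≤ (co-tile d i)) , w<sp)
            f≡j = tile-unique o low-side low-side (at-side low-side c lowf) at
                    (ℚ.<⇒≤ lo<k , subst (λ z → co c k < co c z) (sym highⱼ) k<m) (at-side low-side d (sym eq))
        in none-between (trans (cong (low c) (sym f≡j)) lowf) highⱼ)
      (Hi≤sp o wall-k low-side lowᵢ)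

    -- If wall `m` began before `w`, the tile on its high side there would be `i`, which starts at
    -- `k`.
    start-m : co d (st c m) ≡ co d w
    start-m = ℚ.≤-antisym
      (subst (λ z → co d (st c m) ≤ co d z) (sym eq) (st≤Lo o wall-m high-side highⱼ))
      (ℚ.≮⇒≥ λ st<w →
        let f , lowf , at = beside o wall-m low-side high-side
              (st<w , ℚ.≤-trans (ℚ.≤-trans (ℚ.≤-reflexive (cong (co d) eq)) (ℚ.<⇒≤ (co-tile d j))) (Hi≤sp o wall-m high-side highⱼ))
            f≡i = tile-unique o low-side high-side (at-side low-side c lowf) at
                    (subst (λ z → co c z ≤ co c m) (sym lowᵢ) (ℚ.<⇒≤ k<m) , m<hi) (at-high d i)
        in k≢m (trans (sym lowᵢ) (trans (cong (low c) (sym f≡i)) lowf)))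

    before-k : ∃[ i′ ] high d i′ ≡ w × high c i′ ≡ k
    before-k =
      let i′ , on , eq′ = previous o high-side {i = i} wall-w refl (subst (λ z → co c (st d w) < co c z) (sym lowᵢ) st<k)
      in i′ , on , trans eq′ lowᵢ

    after-m : ∃[ j′ ] low d j′ ≡ w × low c j′ ≡ m
    after-m =
      let j′ , on , eq′ = next o low-side {i = j} wall-w (sym eq) (subst (λ z → co c z < co c (sp d w)) (sym highⱼ) m<sp)
      in j′ , on , trans eq′ highⱼ

    below-w : ∀ s {f} → side s c f ≡ k → Hi d f ≤ co d w
    below-w s {f} eq = subst (Hi d f ≤_) stop-k (Hi≤sp o wall-k s eq)

    above-w : ∀ s {f} → side s c f ≡ m → co d w ≤ Lo d f
    above-w s {f} eq = subst (_≤ Lo d f) start-m (st≤Lo o wall-m s eq)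

    not-reversed : ∀ s s′ {f g} → side s c f ≡ m → side s′ c g ≡ k → high d f ≢ low d g
    not-reversed s s′ {f} {g} onf ong eq = ℚ.<-irrefl refl (ℚ.<-≤-trans
      (ℚ.≤-<-trans (above-w s onf) (ℚ.<-trans (co-tile d f) (subst (λ z → co d z < Hi d g) (sym eq) (co-tile d g))))
      (below-w s′ ong))

    at-w : ∀ s s′ {f g} → side s c f ≡ k → side s′ c g ≡ m → high d f ≡ low d g → high d f ≡ w
    at-w s s′ {f} {g} onf ong eq = co-injective d (ℚ.≤-antisym (below-w s onf)
      (subst (λ z → co d w ≤ co d z) (sym eq) (above-w s′ ong)))

  -- Wall `k` stops and wall `m` starts at `w`, so a second meeting is at `w` too, with tiles in the
  -- same quadrants.
  meet-unique : ∀ {i j i₂ j₂} → Meet i j → Meet i₂ j₂ → i₂ ≡ i × j₂ ≡ j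
  meet-unique {i} {j} {i₂} {j₂} meet@(eq , lowᵢ , highⱼ) meet₂@(eq₂ , lowᵢ₂ , highⱼ₂) =
    let w₂≡w = At-wall.at-w meet low-side high-side lowᵢ₂ highⱼ₂ eq₂
    in tile-unique o low-side high-side (at-side low-side c lowᵢ₂) (at-side high-side d w₂≡w)
         (at-side low-side c lowᵢ) (at-high d i)
     , tile-unique o high-side low-side (at-side high-side c highⱼ₂) (at-side low-side d (trans (sym eq₂) w₂≡w))
         (at-side high-side c highⱼ) (at-side low-side d (sym eq))

record Drawing {n} (M : Mosaic n) : Set where
  field
    coordinates  : Coordinates M
  open Coordinates coordinates public
  field
    co-injective : ∀ c {k m} → co c k ≡ co c m → k ≡ m
    box          : Rect
    lo-box       : ∀ c → lo box c ≡ co c (Mosaic.fl M c)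
    hi-box       : ∀ c → hi box c ≡ co c (Mosaic.fh M c)

module Drawn-as {n} {M : Mosaic n} (D : Drawing M) where
  private module D = Drawing D
  open Rectangulation M D.coordinates D.co-injective D.box D.lo-box D.hi-box public
  open Touching M D.coordinates public
  open Injective D.co-injective public

  Precedes⇔Touch : ∀ {c d} → Opp c d → ∀ {i j} → Precedes c layout i j ⇔ Touch c d i j
  Precedes⇔Touch = precedes⇔ M D.coordinates D.co-injective D.box D.lo-box D.hi-box

module Sliding {n} {M : Mosaic n} (D D′ : Drawing M) {c d} {o : Opp c d} {k m : Fin (suc n)}
  (ex : Exchange (Drawing.coordinates D) (Drawing.coordinates D′) o k m) where
  open Mosaic M
  open Exchange ex
  private
    module D  = Drawn-as D
    module D′ = Drawn-as D′
    module A  = Meeting (Drawing.co-injective D) ex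
    co  = D.co
    co′ = D′.co
    o′ = Opp-sym o
    open Equivalence

  touch-along : ∀ {i j} → D.Touch c d i j → D′.Touch c d i j
  touch-along (eq , p , q) = eq , weak p , weak q
    where
    weak : ∀ {a b} → co d a ≤ co d b → co′ d a ≤ co′ d b
    weak {a} {b} a≤b = ℚ.≮⇒≥ λ b<a → ℚ.<-irrefl refl (ℚ.<-≤-trans (same-d′ b a b<a) a≤b)

  -- Contact compares lower with upper ends, and the exchange affects only the comparison of `k`
  -- with `m`.
  touch-across : ∀ {i j} → ¬ (low c i ≡ k × high c j ≡ m) → ¬ (low c j ≡ k × high c i ≡ m) →
                 D.Touch d c i j → D′.Touch d c i j
  touch-across α γ (eq , p , q) = eq , weak α p , weak γ q
    where
    weak : ∀ {a b} → ¬ (a ≡ k × b ≡ m) → co c a ≤ co c b → co′ c a ≤ co′ c b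
    weak {a} {b} ≢km a≤b = ℚ.≮⇒≥ λ b<a → ℚ.<-irrefl refl (ℚ.<-≤-trans
      (same-c′ b a (λ (b≡m , a≡k) → ≢km (a≡k , b≡m)) b<a) a≤b)

  slide : (∀ {i j} → D′.Touch c d i j → D.Touch c d i j) →
          (∀ {i j} → ¬ (low c i ≡ m × high c j ≡ k) → ¬ (low c j ≡ m × high c i ≡ k) →
            D′.Touch d c i j → D.Touch d c i j) →
          ∀ {i j} → A.Meet i j → WallSlide D.layout D′.layout
  slide touch-along⁻ touch-across⁻ {i} {j} meet@(eq , lowᵢ , highⱼ) = record
    { w = D.segment d w ; v₁ = D.segment c k ; v₂ = D.segment c m
    ; isWall-w = D.segment-isWall wall-w ; isWall-v₁ = D.segment-isWall wall-k ; isWall-v₂ = D.segment-isWall wall-m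
    ; ends₁ = sym (other≡ o′) , trans (cong (λ e → co e (sp c k)) (other≡ o)) stop-k
            , on-c (λ e → co e (st d w) ≤ co c k) (ℚ.<⇒≤ st<k)
            , on-c (λ e → co c k ≤ co e (sp d w)) (ℚ.<⇒≤ (ℚ.<-trans k<m m<sp))
    ; ends₂ = sym (other≡ o′) , trans (cong (λ e → co e (st c m)) (other≡ o)) start-m
            , on-c (λ e → co e (st d w) ≤ co c m) (ℚ.<⇒≤ (ℚ.<-trans st<k k<m))
            , on-c (λ e → co c m ≤ co e (sp d w)) (ℚ.<⇒≤ m<sp)
    ; v₁-first = k<m
    ; a⁻ = i′ ; a⁺ = i ; b⁻ = j ; b⁺ = j′
    ; a⁻-at-w = D.edge-on high-side wall-w i′-at-w
    ; a⁻-at-v₁ = on-c (λ e → highEdge e (tile D.layout i′) ⊆ˢ D.segment c k) (D.edge-on high-side wall-k i′-at-k)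
    ; a⁺-at-w = D.edge-on high-side wall-w refl
    ; a⁺-at-v₁ = on-c (λ e → lowEdge e (tile D.layout i) ⊆ˢ D.segment c k) (D.edge-on low-side wall-k lowᵢ)
    ; b⁻-at-w = D.edge-on low-side wall-w (sym eq)
    ; b⁻-at-v₂ = on-c (λ e → highEdge e (tile D.layout j) ⊆ˢ D.segment c m) (D.edge-on high-side wall-m highⱼ)
    ; b⁺-at-w = D.edge-on low-side wall-w j′-at-w
    ; b⁺-at-v₂ = on-c (λ e → lowEdge e (tile D.layout j′) ⊆ˢ D.segment c m) (D.edge-on low-side wall-m j′-at-m)
    ; lost = from (D.Precedes⇔Touch o′)
               ( eq
               , subst₂ (λ a b → co c a ≤ co c b) (sym lowᵢ) (sym highⱼ) (ℚ.<⇒≤ k<m)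
               , ℚ.<⇒≤ (ℚ.<-trans lo<k (ℚ.<-trans k<m m<hi)))
           , λ touches → ℚ.<-irrefl refl (ℚ.<-≤-trans m<k
               (subst₂ (λ a b → co′ c a ≤ co′ c b) lowᵢ highⱼ (proj₁ (proj₂ (to (D′.Precedes⇔Touch o′) touches)))))
    ; gained = (λ touches → ℚ.<-irrefl refl (ℚ.<-≤-trans k<m
               (subst₂ (λ a b → co c a ≤ co c b) j′-at-m i′-at-k (proj₂ (proj₂ (to (D.Precedes⇔Touch o′) touches))))))
             , from (D′.Precedes⇔Touch o′)
               ( trans i′-at-w (sym j′-at-w)
               , ℚ.<⇒≤ (same-c _ _ (λ (lowᵢ′ , _) → ℚ.<-irrefl (cong (co c) lowᵢ′) lo′<k)
                   (ℚ.<-trans lo′<k (ℚ.<-trans k<m m<hi′)))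
               , subst₂ (λ a b → co′ c a ≤ co′ c b) (sym j′-at-m) (sym i′-at-k) (ℚ.<⇒≤ m<k))
    ; same-along = λ f g → on-c (λ e → Precedes e D.layout f g ⇔ Precedes e D′.layout f g)
        (mk⇔ (from (D′.Precedes⇔Touch o) ∘ touch-along ∘ to (D.Precedes⇔Touch o))
             (from (D.Precedes⇔Touch o) ∘ touch-along⁻ ∘ to (D′.Precedes⇔Touch o)))
    ; same-across = λ f g ≢lost ≢gained → mk⇔
        (λ touches → let t = to (D.Precedes⇔Touch o′) touches in from (D′.Precedes⇔Touch o′)
          (touch-across (not-lost f g ≢lost (proj₁ t))
                        (λ (lowg , highf) → not-reversed high-side low-side highf lowg (proj₁ t)) t))
        (λ touches → let t = to (D′.Precedes⇔Touch o′) touches in from (D.Precedes⇔Touch o′)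
          (touch-across⁻ (λ (lowf , highg) → not-reversed low-side high-side lowf highg (proj₁ t))
                         (not-gained f g ≢gained (proj₁ t)) t))
    }
    where
    open A.At-wall meet
    i′ = proj₁ before-k
    i′-at-w = proj₁ (proj₂ before-k)
    i′-at-k = proj₂ (proj₂ before-k)
    j′ = proj₁ after-m
    j′-at-w = proj₁ (proj₂ after-m)
    j′-at-m = proj₂ (proj₂ after-m)

    on-c : (P : Axis → Set) → P c → P (other d)
    on-c P = subst P (sym (other≡ o′))

    lo′<k : D.Lo c i′ < co c k
    lo′<k = subst (λ z → D.Lo c i′ < co c z) i′-at-k (D.co-tile c i′)

    m<hi′ : co c m < D.Hi c j′
    m<hi′ = subst (λ z → co c z < D.Hi c j′) j′-at-m (D.co-tile c j′)

    not-lost : ∀ f g → (f , g) ≢ (i , j) → high d f ≡ low d g → ¬ (low c f ≡ k × high c g ≡ m)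
    not-lost f g ≢lost eq′ (lowf , highg) =
      let f≡i , g≡j = A.meet-unique meet (eq′ , lowf , highg) in ≢lost (cong₂ _,_ f≡i g≡j)

    not-gained : ∀ f g → (f , g) ≢ (i′ , j′) → high d f ≡ low d g → ¬ (low c g ≡ m × high c f ≡ k)
    not-gained f g ≢gained eq′ (lowg , highf) =
      let f≡w = at-w high-side low-side highf lowg eq′
          f≡i′ = D.tile-unique o high-side high-side (D.at-side high-side c highf) (D.at-side high-side d f≡w)
                   (D.at-side high-side c i′-at-k) (D.at-side high-side d i′-at-w)
          g≡j′ = D.tile-unique o low-side low-side (D.at-side low-side c lowg) (D.at-side low-side d (trans (sym eq′) f≡w))
                   (D.at-side low-side c j′-at-m) (D.at-side low-side d j′-at-w)
      in ≢gained (cong₂ _,_ f≡i′ g≡j′)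

-- A `WallSlide` moves the wall coming from the low side past the other one in increasing direction.
-- If instead `m` comes from the low side, the slide leads from `D′` to `D`. Without a meeting no
-- contact depends on the order of `k` and `m`.
exchange⇒equivalent : ∀ {n} {M : Mosaic n} (D D′ : Drawing M) {c d} {o : Opp c d} {k m} →
  Exchange (Drawing.coordinates D) (Drawing.coordinates D′) o k m →
  MosaicEquivalent (Drawn-as.layout D) (Drawn-as.layout D′)
exchange⇒equivalent {M = M} D D′ {c} {d} {o} {k} {m} ex
  with Fin.any? (λ i → Fin.any? (Meeting.meet? (Drawing.co-injective D) ex i))
     | Fin.any? (λ i → Fin.any? (Meeting.meet? (Drawing.co-injective D′) (Exchange-sym ex) i))
... | yes (i , j , meet) | _ =
  fwd (Drawn-as.isGenericTiling D , Drawn-as.isGenericTiling D′ , inj₂ (slide S′.touch-along S′.touch-across meet)) ◅ ε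
  where
  open Sliding D D′ ex
  module S′ = Sliding D′ D (Exchange-sym ex)
... | no _ | yes (i , j , meet) =
  bwd (Drawn-as.isGenericTiling D′ , Drawn-as.isGenericTiling D , inj₂ (S′.slide touch-along touch-across meet)) ◅ ε
  where
  open Sliding D D′ ex
  module S′ = Sliding D′ D (Exchange-sym ex)
... | no ¬meet | no ¬meet′ =
  fwd (Drawn-as.isGenericTiling D , Drawn-as.isGenericTiling D′ , inj₁ (λ e i j →
    both o (λ e → ∀ i j → Precedes e (Drawn-as.layout D) i j ⇔ Precedes e (Drawn-as.layout D′) i j) along across e i j)) ◅ ε
  where
  module S = Sliding D D′ ex
  module S′ = Sliding D′ D (Exchange-sym ex)
  module A = Meeting (Drawing.co-injective D) ex
  module A′ = Meeting (Drawing.co-injective D′) (Exchange-sym ex)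
  open Equivalence
  open Mosaic M
  o′ = Opp-sym o

  along : ∀ i j → Precedes c (Drawn-as.layout D) i j ⇔ Precedes c (Drawn-as.layout D′) i j
  along i j = mk⇔ (from (Drawn-as.Precedes⇔Touch D′ o) ∘ S.touch-along ∘ to (Drawn-as.Precedes⇔Touch D o))
                  (from (Drawn-as.Precedes⇔Touch D o) ∘ S′.touch-along ∘ to (Drawn-as.Precedes⇔Touch D′ o))

  ¬inside : ∀ i j → high d i ≡ low d j → ¬ (low c i ≡ k × high c j ≡ m)
  ¬inside i j eq (p , q) = ¬meet (i , j , eq , p , q)

  ¬inside′ : ∀ i j → high d i ≡ low d j → ¬ (low c i ≡ m × high c j ≡ k)
  ¬inside′ i j eq (p , q) = ¬meet′ (i , j , eq , p , q)

  across : ∀ i j → Precedes d (Drawn-as.layout D) i j ⇔ Precedes d (Drawn-as.layout D′) i j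
  across i j = mk⇔
    (λ touches → let t = to (Drawn-as.Precedes⇔Touch D o′) touches in from (Drawn-as.Precedes⇔Touch D′ o′)
      (S.touch-across (¬inside i j (proj₁ t)) (λ (p , q) → ¬meet′ (A′.from-outside {i} {j} (proj₁ t) q p)) t))
    (λ touches → let t = to (Drawn-as.Precedes⇔Touch D′ o′) touches in from (Drawn-as.Precedes⇔Touch D o′)
      (S′.touch-across (¬inside′ i j (proj₁ t)) (λ (p , q) → ¬meet (A.from-outside {i} {j} (proj₁ t) q p)) t))

-- Sorting the coordinates

abstract
  ι : ℕ → ℚ
  ι k = + k ℚ./ 1

  ι-def : ∀ k → ι k ≡ + k ℚ./ 1
  ι-def k = refl

  ι-mono-< : ∀ {a b} → a ℕ.< b → ι a < ι b
  ι-mono-< {a} {b} a<b = subst₂ _<_ (sym (canonical a)) (sym (canonical b))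
    (*<* (subst₂ ℤ._<_ (sym (ℤ.*-identityʳ (+ a))) (sym (ℤ.*-identityʳ (+ b))) (ℤ.+<+ a<b)))
    where
    canonical : ∀ k → ι k ≡ mkℚ (+ k) 0 (Coprime.sym (Coprime.1-coprimeTo k))
    canonical k = ℚ.↥p/↧p≡p (mkℚ (+ k) 0 (Coprime.sym (Coprime.1-coprimeTo k)))

ι-mono-≤ : ∀ {a b} → a ℕ.≤ b → ι a ≤ ι b
ι-mono-≤ a≤b with ℕ.m≤n⇒m<n∨m≡n a≤b
... | inj₁ a<b  = ℚ.<⇒≤ (ι-mono-< a<b)
... | inj₂ refl = ℚ.≤-refl

ι-cancel-< : ∀ {a b} → ι a < ι b → a ℕ.< b
ι-cancel-< {a} {b} ιa<ιb = ℕ.≰⇒> λ b≤a → ℚ.<-irrefl refl (ℚ.<-≤-trans ιa<ιb (ι-mono-≤ b≤a))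

ι-cancel-≤ : ∀ {a b} → ι a ≤ ι b → a ℕ.≤ b
ι-cancel-≤ {a} {b} ιa≤ιb = ℕ.≮⇒≥ λ b<a → ℚ.<-irrefl refl (ℚ.<-≤-trans (ι-mono-< b<a) ιa≤ιb)

ι-injective : ∀ {a b} → ι a ≡ ι b → a ≡ b
ι-injective eq = ℕ.≤-antisym (ι-cancel-≤ (ℚ.≤-reflexive eq)) (ι-cancel-≤ (ℚ.≤-reflexive (sym eq)))

-- Adjacent transpositions and inversions

module _ {n} (k m : Fin n) where

  swap : Fin n → Fin n
  swap a = if does (a Fin.≟ k) then m else if does (a Fin.≟ m) then k else a

  data Swap (a : Fin n) : Set where
    first  : a ≡ k → swap a ≡ m → Swap a
    second : a ≡ m → swap a ≡ k → Swap a
    fixed  : a ≢ k → a ≢ m → swap a ≡ a → Swap a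

  swap-view : k ≢ m → ∀ a → Swap a
  swap-view k≢m a with a Fin.≟ k | a Fin.≟ m
  ... | yes a≡k | _       = first a≡k (cong (λ b → if b then m else if does (a Fin.≟ m) then k else a) (dec-true (a Fin.≟ k) a≡k))
  ... | no  a≢k | yes a≡m = second a≡m (trans
    (cong (λ b → if b then m else if does (a Fin.≟ m) then k else a) (dec-false (a Fin.≟ k) a≢k))
    (cong (λ b → if b then k else a) (dec-true (a Fin.≟ m) a≡m)))
  ... | no  a≢k | no  a≢m = fixed a≢k a≢m (trans
    (cong (λ b → if b then m else if does (a Fin.≟ m) then k else a) (dec-false (a Fin.≟ k) a≢k))
    (cong (λ b → if b then k else a) (dec-false (a Fin.≟ m) a≢m)))

module Swapping {n} (f : Fin n → ℕ) (f-injective : ∀ {a b} → f a ≡ f b → a ≡ b)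
  {k m} (k<m : f k ℕ.< f m) (adjacent : ∀ a → f k ℕ.< f a → f a ℕ.< f m → ⊥) where

  f′ : Fin n → ℕ
  f′ = f ∘ swap k m

  private
    k≢m : k ≢ m
    k≢m refl = ℕ.<-irrefl refl k<m

    past-m : ∀ {b} → b ≢ m → f k ℕ.< f b → f m ℕ.< f b
    past-m {b} b≢m k<b = ℕ.≤∧≢⇒< (ℕ.≮⇒≥ (adjacent b k<b)) (λ eq → b≢m (sym (f-injective eq)))

    before-k : ∀ {a} → a ≢ k → f a ℕ.< f m → f a ℕ.< f k
    before-k {a} a≢k a<m = ℕ.≤∧≢⇒< (ℕ.≮⇒≥ (λ k<a → adjacent a k<a a<m)) (λ eq → a≢k (f-injective eq))

  at-k : f′ k ≡ f m
  at-k with swap-view k m k≢m k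
  ... | first _ eq     = cong f eq
  ... | second k≡m _   = ⊥-elim (k≢m k≡m)
  ... | fixed k≢k _ _  = ⊥-elim (k≢k refl)

  at-m : f′ m ≡ f k
  at-m with swap-view k m k≢m m
  ... | first m≡k _    = ⊥-elim (k≢m (sym m≡k))
  ... | second _ eq    = cong f eq
  ... | fixed _ m≢m _  = ⊥-elim (m≢m refl)

  forward : ∀ a b → ¬ (a ≡ k × b ≡ m) → f a ℕ.< f b → f′ a ℕ.< f′ b
  forward a b ≢km a<b with swap-view k m k≢m a | swap-view k m k≢m b
  ... | first refl _    | first refl _    = ⊥-elim (ℕ.<-irrefl refl a<b)
  ... | first refl _    | second refl _   = ⊥-elim (≢km (refl , refl))
  ... | first refl eq   | fixed _ b≢m eq′ = subst₂ ℕ._<_ (cong f (sym eq)) (cong f (sym eq′)) (past-m b≢m a<b)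
  ... | second refl _   | first refl _    = ⊥-elim (ℕ.<-asym a<b k<m)
  ... | second refl _   | second refl _   = ⊥-elim (ℕ.<-irrefl refl a<b)
  ... | second refl eq  | fixed _ _ eq′   = subst₂ ℕ._<_ (cong f (sym eq)) (cong f (sym eq′)) (ℕ.<-trans k<m a<b)
  ... | fixed _ _ eq    | first refl eq′  = subst₂ ℕ._<_ (cong f (sym eq)) (cong f (sym eq′)) (ℕ.<-trans a<b k<m)
  ... | fixed a≢k _ eq  | second refl eq′ = subst₂ ℕ._<_ (cong f (sym eq)) (cong f (sym eq′)) (before-k a≢k a<b)
  ... | fixed _ _ eq    | fixed _ _ eq′   = subst₂ ℕ._<_ (cong f (sym eq)) (cong f (sym eq′)) a<b

  backward : ∀ a b → ¬ (a ≡ m × b ≡ k) → f′ a ℕ.< f′ b → f a ℕ.< f b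
  backward a b ≢mk a<b with ℕ.<-cmp (f a) (f b)
  ... | tri< fa<fb _ _ = fa<fb
  ... | tri≈ _ fa≡fb _ = ⊥-elim (ℕ.<-irrefl (cong f′ (f-injective fa≡fb)) a<b)
  ... | tri> _ _ fb<fa = ⊥-elim (ℕ.<-asym a<b (forward b a (λ (p , q) → ≢mk (q , p)) fb<fa))

  private
    distinct : ∀ {a b} → f a ℕ.< f b → f′ a ≢ f′ b
    distinct {a} {b} fa<fb eq with a Fin.≟ k ×-dec b Fin.≟ m
    ... | yes (refl , refl) = ℕ.<-irrefl (sym (trans (sym at-k) (trans eq at-m))) k<m
    ... | no ≢km = ℕ.<-irrefl eq (forward a b ≢km fa<fb)

  swap-injective : ∀ {a b} → f′ a ≡ f′ b → a ≡ b
  swap-injective {a} {b} eq with ℕ.<-cmp (f a) (f b)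
  ... | tri< fa<fb _ _ = ⊥-elim (distinct fa<fb eq)
  ... | tri≈ _ fa≡fb _ = f-injective fa≡fb
  ... | tri> _ _ fb<fa = ⊥-elim (distinct fb<fa (sym eq))

module Inversions {n} (T : Fin n → ℕ) (T-injective : ∀ {a b} → T a ≡ T b → a ≡ b) where

  Inverted : (Fin n → ℕ) → Fin n → Fin n → Set
  Inverted f a b = f a ℕ.< f b × T b ℕ.< T a

  inverted? : ∀ f a b → Dec (Inverted f a b)
  inverted? f a b = (f a ℕ.<? f b) ×-dec (T b ℕ.<? T a)

  inversions : (Fin n → ℕ) → ℕ
  inversions f = sumℕ (λ a → sumℕ (λ b → [ does (inverted? f a b) ]ℕ))

  -- For `c` strictly between `a` and `b`, one of the pairs `a`, `c` and `c`, `b` is inverted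
  -- because `T b < T a`, and it spans a shorter distance.
  adjacent-inversion : ∀ f {a b} → Acc ℕ._<_ (f b ℕ.∸ f a) → Inverted f a b →
    ∃[ k ] ∃[ m ] Inverted f k m × (∀ c → f k ℕ.< f c → f c ℕ.< f m → ⊥)
  adjacent-inversion f {a} {b} (acc rec) (fa<fb , Tb<Ta)
    with Fin.any? (λ c → (f a ℕ.<? f c) ×-dec (f c ℕ.<? f b))
  ... | no none = a , b , (fa<fb , Tb<Ta) , λ c p q → none (c , p , q)
  ... | yes (c , fa<fc , fc<fb) with T c ℕ.<? T a
  ...   | yes Tc<Ta = adjacent-inversion f (rec (ℕ.∸-monoˡ-< fc<fb (ℕ.<⇒≤ fa<fc))) (fa<fc , Tc<Ta)
  ...   | no  Tc≮Ta = adjacent-inversion f (rec (ℕ.∸-monoʳ-< fa<fc (ℕ.<⇒≤ fc<fb))) (fc<fb , ℕ.<-≤-trans Tb<Ta (ℕ.≮⇒≥ Tc≮Ta))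

  module _ (f : Fin n → ℕ) (f-injective : ∀ {a b} → f a ≡ f b → a ≡ b) {k m}
    (inv : Inverted f k m) (adjacent : ∀ a → f k ℕ.< f a → f a ℕ.< f m → ⊥) where
    open Swapping f f-injective (proj₁ inv) adjacent

    fewer-inversions : inversions f′ ℕ.< inversions f
    fewer-inversions = sumℕ-mono-< (λ a → sumℕ-mono-≤ (λ b → fewer a b)) k (sumℕ-mono-< (fewer k) m
      (indicator-< (inverted? f′ k m) (inverted? f k m)
        (λ (f′k<f′m , _) → ℕ.<-asym (proj₁ inv) (subst₂ ℕ._<_ at-k at-m f′k<f′m)) inv))
      where
      fewer : ∀ a b → [ does (inverted? f′ a b) ]ℕ ℕ.≤ [ does (inverted? f a b) ]ℕ
      fewer a b = indicator-mono (inverted? f′ a b) (inverted? f a b) λ (f′a<f′b , Tb<Ta) →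
        backward a b (λ { (refl , refl) → ℕ.<-asym Tb<Ta (proj₂ inv) }) f′a<f′b , Tb<Ta

record Ranks {n} (M : Mosaic n) : Set where
  open Mosaic M
  field
    rank           : Axis → Fin (suc n) → ℕ
    rank-tile      : ∀ c i → rank c (low c i) ℕ.< rank c (high c i)
    rank-frame     : ∀ c → rank c (fl c) ℕ.< rank c (fh c)
    rank-injective : ∀ c {k m} → rank c k ≡ rank c m → k ≡ m

open Ranks public

module _ {n} {M : Mosaic n} (N : Ranks M) where

  rank-coordinates : Coordinates M
  rank-coordinates = record
    { co = λ c k → ι (rank N c k)
    ; co-tile = λ c i → ι-mono-< (rank-tile N c i) ; co-frame = λ c → ι-mono-< (rank-frame N c) }

  drawing-in : (box : Rect) → (∀ c → lo box c ≡ ι (rank N c (Mosaic.fl M c))) →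
               (∀ c → hi box c ≡ ι (rank N c (Mosaic.fh M c))) → Drawing M
  drawing-in box lo-box hi-box = record
    { coordinates = rank-coordinates ; co-injective = λ c eq → rank-injective N c (ι-injective eq)
    ; box = box ; lo-box = lo-box ; hi-box = hi-box }

  drawing : Drawing M
  drawing = drawing-in (record { lo = λ c → ι (rank N c (Mosaic.fl M c)) ; hi = λ c → ι (rank N c (Mosaic.fh M c)) })
    (λ _ → refl) (λ _ → refl)

  rank-layout : Layout n
  rank-layout = Drawn-as.layout drawing

update : ∀ {A : Set} {c d} → Opp c d → A → (Axis → A) → Axis → A
update XY x f X = x
update XY x f Y = f Y
update YX x f X = f X
update YX x f Y = x

update-at : ∀ {A : Set} {c d} (o : Opp c d) (x : A) f → update o x f c ≡ x
update-at XY x f = refl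
update-at YX x f = refl

update-off : ∀ {A : Set} {c d} (o : Opp c d) (x : A) f → update o x f d ≡ f d
update-off XY x f = refl
update-off YX x f = refl

module Sorting {n} {M : Mosaic n} {c d} (o : Opp c d) (T : Fin (suc n) → ℕ)
  (T-tile : ∀ i → T (Mosaic.low M c i) ℕ.< T (Mosaic.high M c i))
  (T-frame : T (Mosaic.fl M c) ℕ.< T (Mosaic.fh M c))
  (T-injective : ∀ {a b} → T a ≡ T b → a ≡ b) where
  open Mosaic M
  open Inversions T T-injective

  module Step (N : Ranks M) {k m} (inv : Inverted (rank N c) k m)
    (adjacent : ∀ a → rank N c k ℕ.< rank N c a → rank N c a ℕ.< rank N c m → ⊥) where
    open Swapping (rank N c) (rank-injective N c) (proj₁ inv) adjacent

    -- The sides of a tile have the same order in `rank N c` and in the target `T`, so they are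
    -- never the exchanged pair, and every intermediate ranking still gives each tile a positive
    -- size.
    kept : ∀ {a b} → T a ℕ.< T b → rank N c a ℕ.< rank N c b → f′ a ℕ.< f′ b
    kept Ta<Tb = forward _ _ λ { (refl , refl) → ℕ.<-asym Ta<Tb (proj₂ inv) }

    rank′ : Axis → Fin (suc n) → ℕ
    rank′ = update o f′ (rank N)

    swapped : Ranks M
    swapped = record
      { rank = rank′
      ; rank-tile = both o (λ e → ∀ i → rank′ e (low e i) ℕ.< rank′ e (high e i))
          (λ i → subst (λ g → g (low c i) ℕ.< g (high c i)) (sym (update-at o f′ (rank N))) (kept (T-tile i) (rank-tile N c i)))
          (λ i → subst (λ g → g (low d i) ℕ.< g (high d i)) (sym (update-off o f′ (rank N))) (rank-tile N d i))
      ; rank-frame = both o (λ e → rank′ e (fl e) ℕ.< rank′ e (fh e))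
          (subst (λ g → g (fl c) ℕ.< g (fh c)) (sym (update-at o f′ (rank N))) (kept T-frame (rank-frame N c)))
          (subst (λ g → g (fl d) ℕ.< g (fh d)) (sym (update-off o f′ (rank N))) (rank-frame N d))
      ; rank-injective = both o (λ e → ∀ {a b} → rank′ e a ≡ rank′ e b → a ≡ b)
          (subst (λ g → ∀ {a b} → g a ≡ g b → a ≡ b) (sym (update-at o f′ (rank N))) swap-injective)
          (subst (λ g → ∀ {a b} → g a ≡ g b → a ≡ b) (sym (update-off o f′ (rank N))) (rank-injective N d))
      }

    exchange : Exchange (rank-coordinates N) (rank-coordinates swapped) o k m
    exchange = record
      { same-d = λ a b a<b → subst (λ g → ι (g a) < ι (g b)) (sym (update-off o f′ (rank N))) a<b
      ; same-d′ = λ a b a<b → subst (λ g → ι (g a) < ι (g b)) (update-off o f′ (rank N)) a<b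
      ; same-c = λ a b ≢km a<b → subst (λ g → ι (g a) < ι (g b)) (sym (update-at o f′ (rank N)))
          (ι-mono-< (forward a b ≢km (ι-cancel-< a<b)))
      ; same-c′ = λ a b ≢mk a<b → ι-mono-< (backward a b ≢mk
          (ι-cancel-< (subst (λ g → ι (g a) < ι (g b)) (update-at o f′ (rank N)) a<b)))
      ; k<m = ι-mono-< (proj₁ inv)
      ; m<k = subst (λ g → ι (g m) < ι (g k)) (sym (update-at o f′ (rank N)))
          (ι-mono-< (subst₂ ℕ._<_ (sym at-m) (sym at-k) (proj₁ inv)))
      }

  Sorted : Ranks M → Set
  Sorted N = ∃ λ (N′ : Ranks M) → (∀ a b → rank N′ c a ℕ.< rank N′ c b → T a ℕ.< T b)
                   × rank N′ d ≡ rank N d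
                   × MosaicEquivalent (rank-layout N) (rank-layout N′)

  sort-acc : ∀ N → Acc ℕ._<_ (inversions (rank N c)) → Sorted N
  sort-acc N (acc rec) with Fin.any? (λ a → Fin.any? (inverted? (rank N c) a))
  ... | no none = N , (λ a b a<b → ℕ.≤∧≢⇒< (ℕ.≮⇒≥ λ Tb<Ta → none (a , b , a<b , Tb<Ta))
                        (λ eq → ℕ.<-irrefl (cong (rank N c) (T-injective eq)) a<b)) , refl , ε
  ... | yes (a , b , inv₀) =
    let k , m , inv , adjacent = adjacent-inversion (rank N c) (<-wellFounded _) inv₀
        open Step N inv adjacent
        N′ , sorted , same , path = sort-acc swapped (rec (subst (λ g → inversions g ℕ.< inversions (rank N c))
          (sym (update-at o _ (rank N))) (fewer-inversions (rank N c) (rank-injective N c) inv adjacent)))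
    in N′ , sorted , trans same (update-off o _ (rank N))
     , exchange⇒equivalent (drawing N) (drawing swapped) exchange ◅◅ path

  sort : ∀ N → Sorted N
  sort N = sort-acc N (<-wellFounded _)

same-order⇒equivalent : ∀ {n} {M : Mosaic n} (D D′ : Drawing M) →
  (∀ c a b → Drawing.co D c a < Drawing.co D c b → Drawing.co D′ c a < Drawing.co D′ c b) →
  MosaicEquivalent (Drawn-as.layout D) (Drawn-as.layout D′)
same-order⇒equivalent D D′ order =
  fwd (A.isGenericTiling , A′.isGenericTiling , inj₁ (λ c i j → mk⇔
    (λ touches → let eq , p , q = to (A.Precedes⇔Touch (opp c)) touches
                 in from (A′.Precedes⇔Touch (opp c)) (eq , weak p , weak q))
    (λ touches → let eq , p , q = to (A′.Precedes⇔Touch (opp c)) touches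
                 in from (A.Precedes⇔Touch (opp c)) (eq , weak′ p , weak′ q)))) ◅ ε
  where
  module A  = Drawn-as D
  module A′ = Drawn-as D′
  open Equivalence
  weak : ∀ {c a b} → A.co c a ≤ A.co c b → A′.co c a ≤ A′.co c b
  weak {c} {a} {b} a≤b with a Fin.≟ b
  ... | yes refl = ℚ.≤-refl
  ... | no  a≢b  = ℚ.<⇒≤ (order c a b (A.co-strict c a≤b a≢b))
  weak′ : ∀ {c a b} → A′.co c a ≤ A′.co c b → A.co c a ≤ A.co c b
  weak′ {c} {a} {b} a≤b = ℚ.≮⇒≥ λ b<a → ℚ.<-irrefl refl (ℚ.<-≤-trans (order c b a b<a) a≤b)

module _ {n} {M : Mosaic n} (N T : Ranks M) where
  private
    module SX = Sorting {M = M} XY (rank T X) (rank-tile T X) (rank-frame T X) (rank-injective T X)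
    module SY = Sorting {M = M} YX (rank T Y) (rank-tile T Y) (rank-frame T Y) (rank-injective T Y)

  -- Exchanges on one axis leave the ranks of the other alone, so the axes are sorted in turn;
  -- afterwards the contacts are those of `D`, as they depend on the order only.
  ranks-equivalent : ∀ (D : Drawing M) → (∀ c a b → rank T c a ℕ.< rank T c b → Drawing.co D c a < Drawing.co D c b) →
                     MosaicEquivalent (rank-layout N) (Drawn-as.layout D)
  ranks-equivalent D order = after-X (SX.sort N)
    where
    after-Y : ∀ N₁ → (∀ a b → rank N₁ X a ℕ.< rank N₁ X b → rank T X a ℕ.< rank T X b) →
              SY.Sorted N₁ → MosaicEquivalent (rank-layout N₁) (Drawn-as.layout D)
    after-Y N₁ sorted-X (N₂ , sorted-Y , same , path) = path ◅◅ same-order⇒equivalent (drawing N₂) D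
      (λ c a b a<b → order c a b (sorted c a b (ι-cancel-< a<b)))
      where
      sorted : ∀ c a b → rank N₂ c a ℕ.< rank N₂ c b → rank T c a ℕ.< rank T c b
      sorted = both XY (λ c → ∀ a b → rank N₂ c a ℕ.< rank N₂ c b → rank T c a ℕ.< rank T c b)
        (λ a b a<b → sorted-X a b (subst (λ g → g a ℕ.< g b) same a<b)) sorted-Y
    after-X : SX.Sorted N → MosaicEquivalent (rank-layout N) (Drawn-as.layout D)
    after-X (N₁ , sorted-X , _ , path) = path ◅◅ after-Y N₁ sorted-X (SY.sort N₁)

-- Linear extensions of adjacency and shuffles

minimum-by : ∀ {n} {P : Fin n → Set} → (∀ i → Dec (P i)) → (m : Fin n → ℕ) → ∀ i → P i →
             ∃[ k ] P k × (∀ j → P j → m k ℕ.≤ m j)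
minimum-by {n} {P} P? m i Pᵢ = go i Pᵢ (<-wellFounded (m i))
  where
  go : ∀ i → P i → Acc ℕ._<_ (m i) → ∃[ k ] P k × (∀ j → P j → m k ℕ.≤ m j)
  go i Pᵢ (acc rec) with Fin.any? (λ j → P? j ×-dec (m j ℕ.<? m i))
  ... | yes (j , Pⱼ , mⱼ<mᵢ) = go j Pⱼ (rec mⱼ<mᵢ)
  ... | no none = i , Pᵢ , λ j Pⱼ → ℕ.≮⇒≥ λ mⱼ<mᵢ → none (j , Pⱼ , mⱼ<mᵢ)

Closed : ∀ {n} → (Fin n → Fin n → Set) → (Fin n → Bool) → Set
Closed _⟶_ done = ∀ {i j} → i ⟶ j → done j ≡ true → done i ≡ true

-- A minimal element is demanded only outside of closed sets: the elements already listed always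
-- form one, and the geometric argument relies on closedness.
Sortable : ∀ {n} → (Fin n → Fin n → Set) → Set
Sortable _⟶_ = ∀ done → Closed _⟶_ done → ∀ {i} → done i ≡ false →
  ∃[ k ] done k ≡ false × (∀ {j} → j ⟶ k → done j ≡ true)

topological-sort : ∀ {n} {_⟶_ : Fin n → Fin n → Set} → Sortable _⟶_ →
  ∃ λ (x : Permutation′ n) → ∀ a b → (x ⟨$⟩ʳ a) ⟶ (x ⟨$⟩ʳ b) → a Fin.< b
topological-sort {zero}              sortable = Perm.id , λ ()
topological-sort {suc n} {_⟶_} sortable =
  let u , _ , minimal = sortable (λ _ → false) (λ _ ()) {zero} refl
      x , sorted = topological-sort (rest u (λ i⟶u → contradiction (minimal i⟶u) λ ()))
  in insert zero u x , λ
    { zero    zero    u⟶u → contradiction (minimal u⟶u) λ ()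
    ; zero    (suc b) _   → s≤s z≤n
    ; (suc a) zero    i⟶u → contradiction (minimal i⟶u) λ ()
    ; (suc a) (suc b) i⟶j → s≤s (sorted a b i⟶j) }
  where
  rest : ∀ u → (∀ {i} → ¬ (i ⟶ u)) → Sortable (λ i j → punchIn u i ⟶ punchIn u j)
  rest u minimal done closed {i} undone =
    let k , ¬done , all = sortable extended extended-closed {punchIn u i} (trans (extended-in i) undone)
        u≢k = extended-false k ¬done
        k≡ = Fin.punchIn-punchOut u≢k
    in punchOut u≢k
     , trans (sym (extended-in _)) (trans (cong extended k≡) ¬done)
     , λ {j} j⟶k → trans (sym (extended-in j)) (all (subst (punchIn u j ⟶_) k≡ j⟶k))
    where
    extended : Fin (suc n) → Bool
    extended i with u Fin.≟ i
    ... | yes _   = true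
    ... | no  u≢i = done (punchOut u≢i)

    extended-in : ∀ j → extended (punchIn u j) ≡ done j
    extended-in j with u Fin.≟ punchIn u j
    ... | yes u≡ = ⊥-elim (Fin.punchInᵢ≢i u j (sym u≡))
    ... | no  u≢ = cong done (Fin.punchIn-injective u _ _ (Fin.punchIn-punchOut u≢))

    extended-false : ∀ k → extended k ≡ false → u ≢ k
    extended-false k eq u≡k with u Fin.≟ k
    ... | no u≢k = u≢k u≡k

    extended-closed : Closed _⟶_ extended
    extended-closed {i} {j} i⟶j doneⱼ with u Fin.≟ i | u Fin.≟ j
    ... | yes _  | _        = refl
    ... | no _   | yes refl = ⊥-elim (minimal i⟶j)
    ... | no u≢i | no u≢j   = closed (subst₂ _⟶_ (sym (Fin.punchIn-punchOut u≢i)) (sym (Fin.punchIn-punchOut u≢j)) i⟶j) doneⱼ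

module Order {n} {M : Mosaic n} (N : Ranks M) where
  open Mosaic M
  open Realization M (rank-coordinates N)

  Adjacent : Axis → Axis → Fin n → Fin n → Set
  Adjacent c d i j = high c i ≡ low c j × Lo d i < Hi d j × Lo d j < Hi d i

  -- Tiles on opposite sides of a wall: i on the high side ends before j on the
  -- low side starts.
  Shuffled : Axis → Axis → Fin n → Fin n → Set
  Shuffled c d i j = low c i ≡ high c j × Hi d i < Lo d j

  -- Two tiles on the same side of a wall, or one on the low side read before one on the high side,
  -- are ordered by adjacency already (`same-side`, `low-then-high`); `shuffled` supplies the
  -- remaining case.
  data _⟶_ (i j : Fin n) : Set where
    adjacent : ∀ {c d} → Opp c d → Adjacent c d i j → i ⟶ j
    shuffled : ∀ {c d} → Opp c d → Shuffled c d i j → i ⟶ j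

  adjacent? : ∀ c d i j → Dec (Adjacent c d i j)
  adjacent? c d i j = (high c i Fin.≟ low c j) ×-dec ((Lo d i <? Hi d j) ×-dec (Lo d j <? Hi d i))

  shuffled? : ∀ c d i j → Dec (Shuffled c d i j)
  shuffled? c d i j = (low c i Fin.≟ high c j) ×-dec (Hi d i <? Lo d j)

  low-wall : ∀ c {e i} → Lo c e < Lo c i → (∀ e → co c (fl c) ≤ Lo c e) → Wall c (low c i)
  low-wall c {e} {i} lo<lo fl≤ = (λ eq → ℚ.<-irrefl (cong (co c) (sym eq)) (ℚ.≤-<-trans (fl≤ e) lo<lo))
                                , low≢fh c i , low-side , i , refl

  -- A set closed under adjacency contains everything behind its tiles in each strip.
  module Sweep (done : Fin n → Bool) (closed : ∀ {c d} → Opp c d → Closed (Adjacent c d) done) where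

    sweep : ∀ {c d} (o : Opp c d) {g i y} → done g ≡ true → At low-side y (Lo d g) (Hi d g) →
            At low-side y (Lo d i) (Hi d i) → Lo c i < Hi c g → done i ≡ true
    sweep {c} {d} o {g} {i} {y} done-g at-g at-i lo<hi = go g done-g at-g lo<hi (<-wellFounded _)
      where
      go : ∀ g → done g ≡ true → At low-side y (Lo d g) (Hi d g) → Lo c i < Hi c g →
           Acc ℕ._<_ (rank N c (low c g)) → done i ≡ true
      go g done-g at-g lo<hi (acc rec) = cases (Lo c i <? Lo c g)
        where
        cases : Dec (Lo c i < Lo c g) → done i ≡ true
        cases (no  lo≮lo) = subst (λ z → done z ≡ true)
          (tile-unique o low-side low-side (ℚ.≮⇒≥ lo≮lo , lo<hi) at-g (at-low c i) at-i) done-g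
        cases (yes lo<lo) =
          -- Behind the wall at the low edge of `g` lies a tile `g′` of the same strip, adjacent to
          -- `g` and therefore done.
          let W = low-wall c lo<lo (frame≤Lo o)
              g′ , highg′ , at-g′ = beside o W high-side low-side (along o W low-side low-side refl at-g)
              hi≡lo = cong (co c) highg′
          in go g′ (closed o (highg′ , ℚ.≤-<-trans (proj₁ at-g′) (proj₂ at-g) , ℚ.≤-<-trans (proj₁ at-g) (proj₂ at-g′)) done-g)
               at-g′ (subst (Lo c i <_) (sym hi≡lo) lo<lo)
               (rec (subst (λ z → rank N c (low c g′) ℕ.< rank N c z) highg′ (rank-tile N c g′)))

  module Greedy (done : Fin n → Bool) (closed : Closed _⟶_ done) where
    open Sweep done (λ o adj → closed (adjacent o adj))

    BlockedLeft : Fin n → Set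
    BlockedLeft k = ∃[ e ] done e ≡ false × (Adjacent X Y e k ⊎ Shuffled Y X e k)

    blocked-left? : ∀ k → Dec (BlockedLeft k)
    blocked-left? k = Fin.any? λ e → (done e Bool.≟ false) ×-dec (adjacent? X Y e k ⊎-dec shuffled? Y X e k)

    Free : Fin n → Set
    Free k = done k ≡ false × ¬ BlockedLeft k

    free? : ∀ k → Dec (Free k)
    free? k = (done k Bool.≟ false) ×-dec ¬? (blocked-left? k)

    not-both : ∀ {e} → done e ≡ false → done e ≡ true → ⊥
    not-both p q with () ← trans (sym p) q

    must-be-done : ∀ {e} → ¬ (done e ≡ false) → done e ≡ true
    must-be-done {e} ¬undone with done e
    ... | true  = refl
    ... | false = ⊥-elim (¬undone refl)

    -- Whatever blocks a tile from the left begins further left, so the leftmost undone tile is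
    -- free.
    free-exists : ∀ {i} → done i ≡ false → ∃[ k ] Free k
    free-exists {i} undone =
      let k , ¬done , leftmost = minimum-by (λ i → done i Bool.≟ false) (λ i → rank N X (low X i)) i undone
      in k , ¬done , λ (e , ¬doneₑ , block) → ℚ.<-irrefl refl (ℚ.<-≤-trans
           ([ (λ (eq , _) → subst (λ z → Lo X e < co X z) eq (co-tile X e))
            , (λ (_ , hi<lo) → ℚ.<-trans (co-tile X e) hi<lo) ]′ block)
           (ι-mono-≤ (leftmost e ¬doneₑ)))

    -- A free tile of least height is not blocked from below either: otherwise the
    -- leftmost of the remaining tiles to the lower right of it would be free.
    module _ {c} (free-c : Free c) (lowest : ∀ k → Free k → Lo Y c ≤ Lo Y k) where

      -- The neighbour level with the bottom of `c` is done, since it precedes `c` by adjacency and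
      -- `c` is not blocked from the left.
      left-neighbour : ∀ {e} → Lo X e < Lo X c →
        ∃[ g ] Hi X g ≡ Lo X c × At low-side (Lo Y c) (Lo Y g) (Hi Y g) × done g ≡ true
      left-neighbour lo<lo =
        let W = low-wall X lo<lo (frame≤Lo XY)
            g , highg , at-g = beside XY W high-side low-side (along XY W low-side low-side refl (at-low Y c))
        in g , cong (co X) highg , at-g , must-be-done (λ ¬done → proj₂ free-c
             (g , ¬done , inj₁ (highg , ℚ.≤-<-trans (proj₁ at-g) (co-tile Y c) , proj₂ at-g)))

      -- Downward sweep from `left-neighbour`, in a column left of `c` that meets both tiles.
      below-neighbour : ∀ {e} → Lo X e < Lo X c → Lo X c ≤ Hi X e → Lo Y e < Lo Y c → done e ≡ true
      below-neighbour {e} lo<lo lo≤hi below =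
        let g , hi≡ , at-g , done-g = left-neighbour lo<lo
            z , e≤z , g≤z , least = larger (Lo X e) (Lo X g)
            g<c = subst (Lo X g <_) hi≡ (co-tile X g)
        in sweep YX done-g (g≤z , subst (z <_) (sym hi≡) (least lo<lo g<c))
             (e≤z , least (co-tile X e) (ℚ.<-≤-trans g<c lo≤hi)) (ℚ.<-trans below (proj₂ at-g))

      -- Both remaining ways to block `c`, by a tile below it or by a lower one on the far side of
      -- its right wall, give an undone `i` in this position.
      module _ {i} (¬doneᵢ : done i ≡ false) (c≤i : Lo X c ≤ Lo X i) (i≤c : Lo X i ≤ Hi X c) (belowᵢ : Hi Y i ≤ Lo Y c) where

        LowerRight : Fin n → Set
        LowerRight k = done k ≡ false × Lo Y k < Lo Y c × Lo X c ≤ Lo X k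

        lower-right? : ∀ k → Dec (LowerRight k)
        lower-right? k = (done k Bool.≟ false) ×-dec ((Lo Y k <? Lo Y c) ×-dec (Lo X c ≤? Lo X k))

        lower-right-i : LowerRight i
        lower-right-i = ¬doneᵢ , ℚ.<-≤-trans (co-tile Y i) belowᵢ , c≤i

        module _ {k₁ k} (leftmost : ∀ j → LowerRight j → Lo X k₁ ≤ Lo X j)
          (lr : LowerRight k) (k≤k₁ : Lo X k ≤ Lo X k₁)
          (bottommost : ∀ j → LowerRight j → Lo X j ≤ Lo X k₁ → Lo Y k ≤ Lo Y j) where

          leftmost-k : ∀ j → LowerRight j → Lo X k ≤ Lo X j
          leftmost-k j lrⱼ = ℚ.≤-trans k≤k₁ (leftmost j lrⱼ)

          k≤i : Lo X k ≤ Lo X i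
          k≤i = leftmost-k i lower-right-i

          -- If `k` rose above the bottom of `c`, it would overlap `c` or begin no further left than
          -- its right edge. In the latter case `k` and `i` begin at the same place, and by the
          -- bottommost choice both contain the lower left corner of `i`.
          k-below : Hi Y k ≤ Lo Y c
          k-below = ℚ.≮⇒≥ λ c<k →
            let c≤k = ℚ.≮⇒≥ λ k<c → ℚ.<-irrefl
                  (cong (Lo Y) (sym (tile-unique XY low-side low-side (proj₂ (proj₂ lr) , k<c) (at-low Y c)
                    (at-low X k) (ℚ.<⇒≤ (proj₁ (proj₂ lr)) , c<k)))) (proj₁ (proj₂ lr))
                i≤k = ℚ.≤-trans i≤c c≤k
                k≡i = tile-unique XY low-side low-side
                  (k≤i , ℚ.≤-<-trans i≤k (co-tile X k))
                  (bottommost i lower-right-i (ℚ.≤-trans i≤k k≤k₁) , ℚ.<-trans (ℚ.<-≤-trans (co-tile Y i) belowᵢ) c<k)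
                  (at-low X i) (at-low Y i)
            in ℚ.<-irrefl refl (ℚ.<-≤-trans c<k (subst (λ z → Hi Y z ≤ Lo Y c) (sym k≡i) belowᵢ))

          not-lower-right : ∀ {e} → done e ≡ false → Lo X e < Lo X k → Lo Y e < Lo Y c → Lo X e < Lo X c
          not-lower-right ¬doneₑ e<k below = ℚ.≰⇒> λ c≤e →
            ℚ.<-irrefl refl (ℚ.<-≤-trans e<k (leftmost-k _ (¬doneₑ , below , c≤e)))

          -- By the choice of `k` the tile `e` begins left of `c`; since it reaches `k`, it also
          -- reaches the left edge of `c`.
          unblocked-adjacent : ∀ {e} → done e ≡ false → Adjacent X Y e k → ⊥
          unblocked-adjacent {e} ¬doneₑ (eq , e<k , _) =
            let hi≡lo = cong (co X) eq
                left = subst (Lo X e <_) hi≡lo (co-tile X e)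
                below = ℚ.<-≤-trans e<k k-below
            in not-both ¬doneₑ (below-neighbour (not-lower-right ¬doneₑ left below)
                 (subst (Lo X c ≤_) (sym hi≡lo) (proj₂ (proj₂ lr))) below)

          -- Here e rests on the wall above k, at the height of c.
          unblocked-level : ∀ {e} → done e ≡ false → Hi X e < Lo X k → Lo Y e ≡ Lo Y c → ⊥
          unblocked-level {e} ¬doneₑ e<k level = cases (Lo X e <? Lo X c)
            where
            at-e : At low-side (Lo Y c) (Lo Y e) (Hi Y e)
            at-e = ℚ.≤-reflexive level , subst (_< Hi Y e) level (co-tile Y e)
            right-of-c : Hi X c < Lo X k → ⊥
            right-of-c c<k = ℚ.<-irrefl refl (ℚ.<-≤-trans c<k (ℚ.≤-trans k≤i i≤c))
            cases : Dec (Lo X e < Lo X c) → ⊥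
            cases (yes e<c) =
              let g , hi≡ , at-g , done-g = left-neighbour e<c
              in not-both ¬doneₑ (sweep XY done-g at-g at-e (subst (Lo X e <_) (sym hi≡) e<c))
            cases (no e≮c) = right-of-c (ℚ.≤-<-trans (ℚ.≮⇒≥ λ e<hi-c →
              right-of-c (subst (λ z → Hi X z < Lo X k)
                (tile-unique XY low-side low-side (at-low X e) at-e (ℚ.≮⇒≥ e≮c , e<hi-c) (at-low Y c)) e<k))
              (ℚ.<-trans (co-tile X e) e<k))

          -- If `e` ends before `c`, the wall under `e` runs on towards `k` through a column just
          -- left of `c`. The tile `f` on top of it there is done by a downward sweep, and a sweep
          -- to the left along the wall reaches `e`.
          unblocked-below : ∀ {e} → done e ≡ false → Shuffled Y X e k → Lo Y e < Lo Y c → ⊥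
          unblocked-below {e} ¬doneₑ (eq , e<k) below = cases (Lo X c ≤? Hi X e)
            where
            e<c : Lo X e < Lo X c
            e<c = not-lower-right ¬doneₑ (ℚ.<-trans (co-tile X e) e<k) below
            w = low Y e
            W : Wall Y w
            W = (λ w≡fl → high≢fl Y k (trans (sym eq) w≡fl)) , low≢fh Y e , low-side , e , refl
            cases : Dec (Lo X c ≤ Hi X e) → ⊥
            cases (yes c≤e) = not-both ¬doneₑ (below-neighbour e<c c≤e below)
            cases (no  c≰e) =
              let g , hi≡ , at-g , done-g = left-neighbour e<c
                  z , e≤z , g≤z , least = larger (Hi X e) (Lo X g)
                  z<c = least (ℚ.≰⇒> c≰e) (subst (Lo X g <_) hi≡ (co-tile X g))
                  f , lowf , at-f = beside YX W low-side low-side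
                    ( ℚ.≤-trans (st≤Lo YX W low-side refl) (ℚ.≤-trans (ℚ.<⇒≤ (co-tile X e)) e≤z)
                    , ℚ.<-≤-trans z<c (ℚ.≤-trans (proj₂ (proj₂ lr)) (ℚ.≤-trans (ℚ.<⇒≤ (co-tile X k)) (Hi≤sp YX W high-side (sym eq)))))
                  level = cong (co Y) lowf
                  done-f = sweep YX done-g (g≤z , subst (z <_) (sym hi≡) z<c) at-f
                    (ℚ.<-trans (subst (_< Lo Y c) (sym level) below) (proj₂ at-g))
              in not-both ¬doneₑ (sweep XY done-f (at-low Y f)
                   (subst (λ y → At low-side y (Lo Y e) (Hi Y e)) (sym level) (at-low Y e))
                   (ℚ.<-trans (co-tile X e) (ℚ.≤-<-trans e≤z (proj₂ at-f))))

          unblocked-shuffled : ∀ {e} → done e ≡ false → Shuffled Y X e k → ⊥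
          unblocked-shuffled {e} ¬doneₑ shuf@(eq , e<k) = cases (Lo Y e <? Lo Y c)
            where
            cases : Dec (Lo Y e < Lo Y c) → ⊥
            cases (yes below) = unblocked-below ¬doneₑ shuf below
            cases (no ≮) = unblocked-level ¬doneₑ e<k
              (ℚ.≤-antisym (subst (_≤ Lo Y c) (cong (co Y) (sym eq)) k-below) (ℚ.≮⇒≥ ≮))

          free-k : Free k
          free-k = proj₁ lr , λ (e , ¬doneₑ , block) →
            [ unblocked-adjacent ¬doneₑ , unblocked-shuffled ¬doneₑ ]′ block

        blocked-below-impossible : ⊥
        blocked-below-impossible =
          let k₁ , lr₁ , leftmost = minimum-by lower-right? (λ k → rank N X (low X k)) i lower-right-i
              k , (lr , k≤k₁) , bottommost = minimum-by (λ k → lower-right? k ×-dec (Lo X k ≤? Lo X k₁))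
                (λ k → rank N Y (low Y k)) k₁ (lr₁ , ℚ.≤-refl)
          in ℚ.<-irrefl refl (ℚ.<-≤-trans (proj₁ (proj₂ lr)) (lowest k
               (free-k (λ j lrⱼ → ι-mono-≤ (leftmost j lrⱼ)) lr k≤k₁ (λ j lrⱼ j≤k₁ → ι-mono-≤ (bottommost j (lrⱼ , j≤k₁))))))

      unblocked-above : ∀ {i} → done i ≡ false → Adjacent Y X i c → ⊥
      unblocked-above {i} ¬doneᵢ (eq , i<c , c<i) = blocked-below-impossible ¬doneᵢ
        (ℚ.≮⇒≥ λ i<lo → not-both ¬doneᵢ (below-neighbour i<lo (ℚ.<⇒≤ c<i) (subst (Lo Y i <_) (cong (co Y) eq) (co-tile Y i))))
        (ℚ.<⇒≤ i<c) (ℚ.≤-reflexive (cong (co Y) eq))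

      unblocked-right : ∀ {i} → done i ≡ false → Shuffled X Y i c → ⊥
      unblocked-right {i} ¬doneᵢ (eq , i<c) = blocked-below-impossible ¬doneᵢ
        (subst (Lo X c ≤_) (cong (co X) (sym eq)) (ℚ.<⇒≤ (co-tile X c))) (ℚ.≤-reflexive (cong (co X) eq)) (ℚ.<⇒≤ i<c)

      ready : ∀ {j} → j ⟶ c → done j ≡ true
      ready {j} j⟶c = must-be-done (λ ¬done → blocked ¬done j⟶c)
        where
        blocked : done j ≡ false → j ⟶ c → ⊥
        blocked ¬done (adjacent XY adj)  = proj₂ free-c (j , ¬done , inj₁ adj)
        blocked ¬done (adjacent YX adj)  = unblocked-above ¬done adj
        blocked ¬done (shuffled XY shuf) = unblocked-right ¬done shuf
        blocked ¬done (shuffled YX shuf) = proj₂ free-c (j , ¬done , inj₂ shuf)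

  sortable : Sortable _⟶_
  sortable done closed {i} undone =
    let k , free-k = free-exists undone
        c , free-c , lowest = minimum-by free? (λ k → rank N Y (low Y k)) k free-k
    in c , proj₁ free-c , ready free-c (λ k free → ι-mono-≤ (lowest k free))
    where open Greedy done closed

-- The diagonal rectangulation

-- Wall `k` passes between the tiles `k - 1` and `k`; `tile-before` at label 0 and `tile-after` at
-- the last label are defaults.
tile-before tile-after : ∀ {m} → Fin (suc (suc m)) → Fin (suc m)
tile-before zero    = zero
tile-before (suc k) = k
tile-after {zero}  _       = zero
tile-after {suc m} zero    = zero
tile-after {suc m} (suc k) = suc (tile-after k)

toℕ-tile-before : ∀ {m} (k : Fin (suc (suc m))) → k ≢ zero → toℕ k ≡ suc (toℕ (tile-before k))
toℕ-tile-before zero    k≢0 = ⊥-elim (k≢0 refl)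
toℕ-tile-before (suc k) _   = refl

toℕ-tile-after : ∀ {m} (k : Fin (suc (suc m))) → toℕ k ℕ.< suc m → toℕ (tile-after k) ≡ toℕ k
toℕ-tile-after {zero}  zero    _         = refl
toℕ-tile-after {zero}  (suc k) (s≤s ())
toℕ-tile-after {suc m} zero    _         = refl
toℕ-tile-after {suc m} (suc k) (s≤s k<m) = cong suc (toℕ-tile-after k k<m)

below-last : ∀ {n} (k : Fin (suc n)) → k ≢ fromℕ n → toℕ k ℕ.< n
below-last {n} k k≢n = ℕ.≤∧≢⇒< (ℕ.≤-pred (Fin.toℕ<n k))
  (λ eq → k≢n (Fin.toℕ-injective (trans eq (sym (Fin.toℕ-fromℕ n)))))

module FromDiagonal {m} {L R T B : Fin (suc m) → Fin (suc (suc m))} (D : Diagonal L R T B) where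
  open Diagonal D
  private
    n = suc m
    Dᵀ = Diagonal-transpose D
    module F  = DiagonalFacts D
    module Fᵀ = DiagonalFacts Dᵀ

    module Walls (k : Fin (suc n)) (k≢0 : k ≢ zero) (k≢n : k ≢ fromℕ n) where
      private
        k≡1+u = toℕ-tile-before k k≢0
        v≡k = toℕ-tile-after k (below-last k k≢n)
      module W  = F.Wall k (tile-before k) (tile-after k) k≡1+u v≡k
      module Wᵀ = Fᵀ.Wall k (tile-before k) (tile-after k) k≡1+u v≡k

  low high : Axis → Fin n → Fin (suc n)
  low X = L
  low Y = B
  high X = R
  high Y = T

  fl fh : Axis → Fin (suc n)
  fl X = zero
  fl Y = fromℕ n
  fh X = fromℕ n
  fh Y = zero

  -- Ends of the chains found in `Wall`: a vertical wall extends from the bottom of the tile before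
  -- it to the top of the tile after it. The second axis now points upwards, so the top is the high
  -- side.
  st sp : Axis → Fin (suc n) → Fin (suc n)
  st X k = B (tile-before k)
  st Y k = L (tile-after k)
  sp X k = T (tile-after k)
  sp Y k = R (tile-before k)

  near≢n : ∀ {k} {i : Fin n} → toℕ k ℕ.≤ toℕ i → k ≢ fromℕ n
  near≢n {k} {i} k≤i refl = ℕ.<-irrefl refl (ℕ.<-≤-trans (Fin.toℕ<n i) (subst (ℕ._≤ toℕ i) (Fin.toℕ-fromℕ n) k≤i))

  far≢0 : ∀ {k : Fin (suc n)} {i : Fin n} → toℕ i ℕ.< toℕ k → k ≢ zero
  far≢0 i<k refl with () ← i<k

  mosaic : Mosaic n
  mosaic = record
    { low = low ; high = high ; fl = fl ; fh = fh ; st = st ; sp = sp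
    ; low≢fh = λ { X i → near≢n (L≤ i) ; Y i → far≢0 (<B i) }
    ; high≢fl = λ { X i → far≢0 (<R i) ; Y i → near≢n (T≤ i) }
    ; balanced = λ { XY → Balanced-flip balanced ; YX → Balanced-transpose (Balanced-flip balanced) }
    ; chain = λ
      { XY low-side  (k≢0 , k≢n , s , i , eq) → Chain-flip (Walls.W.right-chain _ k≢0 k≢n (occupied s eq))
      ; XY high-side (k≢0 , k≢n , s , i , eq) → Chain-flip (Walls.W.left-chain _ k≢0 k≢n (occupied s eq))
      ; YX low-side  (k≢n , k≢0 , s , i , eq) → Walls.Wᵀ.left-chain _ k≢0 k≢n (occupiedᵀ s eq)
      ; YX high-side (k≢n , k≢0 , s , i , eq) → Walls.Wᵀ.right-chain _ k≢0 k≢n (occupiedᵀ s eq) }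
    -- Such corners would give `j < R j = L i ≤ i < B i = T j ≤ j`.
    ; nocross = λ
      { XY {i} {j} p q → impossible (L≤ i) (<B i) (T≤ j) (<R j) p q
      ; YX {i} {j} p q → impossible (L≤ i) (<B i) (T≤ j) (<R j) q p }
    }
    where
    occupied : ∀ s {k i} → pick s low high X i ≡ k → ∃[ i ] (L i ≡ k ⊎ R i ≡ k)
    occupied low-side  eq = _ , inj₁ eq
    occupied high-side eq = _ , inj₂ eq
    occupiedᵀ : ∀ s {k i} → pick s low high Y i ≡ k → ∃[ i ] (T i ≡ k ⊎ B i ≡ k)
    occupiedᵀ low-side  eq = _ , inj₂ eq
    occupiedᵀ high-side eq = _ , inj₁ eq
    impossible : ∀ {i j : Fin n} {l r t b : Fin (suc n)} → toℕ l ℕ.≤ toℕ i → toℕ i ℕ.< toℕ b →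
                 toℕ t ℕ.≤ toℕ j → toℕ j ℕ.< toℕ r → l ≡ r → b ≡ t → ⊥
    impossible l≤i i<b t≤j j<r refl refl =
      ℕ.<-irrefl refl (ℕ.<-trans (ℕ.<-≤-trans j<r l≤i) (ℕ.<-≤-trans i<b t≤j))

  -- The labels themselves are the coordinates, which puts wall `k` on a line through the diagonal
  -- point `k`.
  diagonal-ranks : Ranks mosaic
  diagonal-ranks = record
    { rank = rk
    ; rank-tile = λ
      { X i → ℕ.≤-<-trans (L≤ i) (<R i)
      ; Y i → ℕ.∸-monoʳ-< (ℕ.≤-<-trans (T≤ i) (<B i)) (ℕ.≤-pred (Fin.toℕ<n (B i))) }
    ; rank-frame = λ
      { X → subst (0 ℕ.<_) (sym (Fin.toℕ-fromℕ n)) (s≤s z≤n)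
      ; Y → subst (λ z → n ℕ.∸ z ℕ.< n) (sym (Fin.toℕ-fromℕ n)) (subst (ℕ._< n) (sym (ℕ.n∸n≡0 n)) (s≤s z≤n)) }
    ; rank-injective = λ
      { X eq → Fin.toℕ-injective eq
      ; Y {k} {k′} eq → Fin.toℕ-injective (ℕ.∸-cancelˡ-≡ (ℕ.≤-pred (Fin.toℕ<n k)) (ℕ.≤-pred (Fin.toℕ<n k′)) eq) }
    }
    where
    rk : Axis → Fin (suc n) → ℕ
    rk X k = toℕ k
    rk Y k = n ℕ.∸ toℕ k

  -- All tiles on one side of a wall lie past its diagonal point, and all on the other side before
  -- it, except for one tile on each side that is next to the diagonal. Two overlapping tiles
  -- include one of these, which sits at an end of the wall.
  split : ∀ {c d} → Opp c d → ∀ {i j} → high c i ≡ low c j →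
    low d i ≡ st c (low c j) ⊎ high d j ≡ sp c (low c j) ⊎
    rank diagonal-ranks d (high d j) ℕ.≤ rank diagonal-ranks d (low d i)
  split XY {i} {j} eq = cases (W.split-left {i} eq) (W.split-right {j} refl)
    where
    open Walls (L j) (λ z → far≢0 (<R i) (trans eq z)) (near≢n (L≤ j))
    cases : _ → _ → _
    cases (inj₁ i≡u) _          = inj₁ (cong B i≡u)
    cases (inj₂ _)   (inj₁ j≡v) = inj₂ (inj₁ (cong T j≡v))
    cases (inj₂ B<k) (inj₂ k<T) = inj₂ (inj₂ (ℕ.∸-monoʳ-≤ n (ℕ.<⇒≤ (ℕ.<-trans B<k k<T))))
  split YX {i} {j} eq = cases (Wᵀ.split-right {i} eq) (Wᵀ.split-left {j} refl)
    where
    open Walls (B j) (far≢0 (<B j)) (λ z → near≢n (T≤ i) (trans eq z))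
    cases : _ → _ → _
    cases (inj₁ i≡v) _          = inj₁ (cong L i≡v)
    cases (inj₂ _)   (inj₁ j≡u) = inj₂ (inj₁ (cong R j≡u))
    cases (inj₂ k<L) (inj₂ R<k) = inj₂ (inj₂ (ℕ.<⇒≤ (ℕ.<-trans R<k k<L)))

  -- Otherwise tile `i` would also cover the diagonal cell of the tile before it.
  top-left-corner : ∀ i → toℕ (L i) ≡ toℕ i ⊎ toℕ (T i) ≡ toℕ i
  top-left-corner zero = inj₁ (ℕ.n≤0⇒n≡0 (L≤ zero))
  top-left-corner (suc i) with ℕ.m≤n⇒m<n∨m≡n (L≤ (suc i)) | ℕ.m≤n⇒m<n∨m≡n (T≤ (suc i))
  ... | inj₂ L≡ | _       = inj₁ L≡
  ... | inj₁ _  | inj₂ T≡ = inj₂ T≡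
  ... | inj₁ L< | inj₁ T< = ⊥-elim (ℕ.<-irrefl (trans (sym (Fin.toℕ-inject₁ i)) (cong toℕ (sym
    (F.same-cell {suc i} {Fin.inject₁ i} (below L<) (above (<R (suc i))) (below T<) (above (<B (suc i))))))) (ℕ.n<1+n (toℕ i)))
    where
    below : ∀ {k} → k ℕ.< suc (toℕ i) → k ℕ.≤ toℕ (Fin.inject₁ i)
    below {k} k< = subst (k ℕ.≤_) (sym (Fin.toℕ-inject₁ i)) (ℕ.≤-pred k<)
    above : ∀ {k} → suc (toℕ i) ℕ.< k → toℕ (Fin.inject₁ i) ℕ.< k
    above {k} <k = subst (ℕ._< k) (sym (Fin.toℕ-inject₁ i)) (ℕ.<-trans (ℕ.n<1+n (toℕ i)) <k)

  -- Otherwise tile `i` would also cover the diagonal cell of the tile after it.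
  bottom-right-corner : ∀ i → toℕ (B i) ≡ suc (toℕ i) ⊎ toℕ (R i) ≡ suc (toℕ i)
  bottom-right-corner i with ℕ.m≤n⇒m<n∨m≡n (<B i) | ℕ.m≤n⇒m<n∨m≡n (<R i)
  ... | inj₂ B≡ | _       = inj₁ (sym B≡)
  ... | inj₁ _  | inj₂ R≡ = inj₂ (sym R≡)
  ... | inj₁ <Bᵢ | inj₁ <Rᵢ = ⊥-elim (ℕ.<-irrefl
    (trans (cong toℕ (F.same-cell {i} {j} (below (L≤ i)) (above <Rᵢ) (below (T≤ i)) (above <Bᵢ))) toℕ-j) (ℕ.n<1+n (toℕ i)))
    where
    1+i<n : suc (toℕ i) ℕ.< n
    1+i<n = ℕ.<-≤-trans <Rᵢ (ℕ.≤-pred (Fin.toℕ<n (R i)))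
    j : Fin n
    j = Fin.fromℕ< 1+i<n
    toℕ-j : toℕ j ≡ suc (toℕ i)
    toℕ-j = Fin.toℕ-fromℕ< 1+i<n
    below : ∀ {k} → k ℕ.≤ toℕ i → k ℕ.≤ toℕ j
    below {k} k≤ = subst (k ℕ.≤_) (sym toℕ-j) (ℕ.m≤n⇒m≤1+n k≤)
    above : ∀ {k} → suc (toℕ i) ℕ.< k → toℕ j ℕ.< k
    above {k} <k = subst (ℕ._< k) (sym toℕ-j) <k

  top-left-end : ∀ i → toℕ (L i) ≡ toℕ i →
    (L i ≡ zero × T i ≡ zero) ⊎ (Mosaic.Wall mosaic X (L i) × sp X (L i) ≡ T i)
  top-left-end i eq with L i Fin.≟ zero
  ... | yes L≡0 = inj₁ (L≡0 , Fin.toℕ-injective (ℕ.n≤0⇒n≡0 (subst (toℕ (T i) ℕ.≤_) (trans (sym eq) (cong toℕ L≡0)) (T≤ i))))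
  ... | no  L≢0 = inj₂ ((L≢0 , near≢n (L≤ i) , low-side , i , refl)
    , cong T (Fin.toℕ-injective (trans (toℕ-tile-after (L i) (below-last (L i) (near≢n (L≤ i)))) eq)))

  bottom-right-end : ∀ i → toℕ (B i) ≡ suc (toℕ i) →
    (B i ≡ fromℕ n × R i ≡ fromℕ n) ⊎ (Mosaic.Wall mosaic Y (B i) × sp Y (B i) ≡ R i)
  bottom-right-end i eq with B i Fin.≟ fromℕ n
  ... | yes B≡n = inj₁ (B≡n , Fin.toℕ-injective (ℕ.≤-antisym
        (ℕ.≤-trans (ℕ.≤-pred (Fin.toℕ<n (R i))) (ℕ.≤-reflexive (sym (Fin.toℕ-fromℕ n))))
        (subst (ℕ._≤ toℕ (R i)) (trans (sym eq) (cong toℕ B≡n)) (<R i))))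
  ... | no  B≢n = inj₂ ((B≢n , far≢0 (<B i) , low-side , i , refl)
    , cong R (Fin.toℕ-injective (ℕ.suc-injective (trans (sym (toℕ-tile-before (B i) (far≢0 (<B i)))) eq))))

-- The linear extension and the drawing procedure

module Linear {n} {M : Mosaic n} (N : Ranks M) (x : Permutation′ n)
  (sorted : ∀ a b → Order._⟶_ N (x ⟨$⟩ʳ a) (x ⟨$⟩ʳ b) → a Fin.< b) where
  open Mosaic M
  open Realization M (rank-coordinates N)
  open Order N

  position : Fin n → ℕ
  position i = toℕ (x ⟨$⟩ˡ i)

  ⟶-position : ∀ {i j} → i ⟶ j → position i ℕ.< position j
  ⟶-position i⟶j = sorted _ _ (subst₂ _⟶_ (sym (Perm.inverseʳ x)) (sym (Perm.inverseʳ x)) i⟶j)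

  -- The tiles placed no later than `g` form a set closed under adjacency, to which the sweep
  -- applies.
  behind : ∀ {c d} → Opp c d → ∀ {i g y} → At low-side y (Lo d i) (Hi d i) → At low-side y (Lo d g) (Hi d g) →
           Lo c i < Hi c g → position i ℕ.≤ position g
  behind {c} {d} o {i} {g} at-i at-g lo<hi = true⇒ (position i ℕ.≤? position g) (sweep o (dec-true (position g ℕ.≤? position g) ℕ.≤-refl) at-g at-i lo<hi)
    where
    open Sweep (λ i → does (position i ℕ.≤? position g)) (λ o {i} {j} adj eq → dec-true (position i ℕ.≤? position g)
      (ℕ.≤-trans (ℕ.<⇒≤ (⟶-position (adjacent o adj))) (true⇒ (position j ℕ.≤? position g) eq)))

  same-side : ∀ {c d} → Opp c d → ∀ s {i g} → side s c i ≡ side s c g → Lo d i < Hi d g → position i ℕ.≤ position g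
  same-side {c} o low-side {i} {g} eq lo<hi = behind (Opp-sym o) (at-low c i)
    (subst (λ z → At low-side (co c z) (Lo c g) (Hi c g)) (sym eq) (at-low c g)) lo<hi
  same-side {c} o high-side {i} {g} eq lo<hi =
    let z , i≤z , g≤z , least = larger (Lo c i) (Lo c g)
        z<hi = least (co-tile c i) (subst (λ w → Lo c g < co c w) (sym eq) (co-tile c g))
    in behind (Opp-sym o) (i≤z , z<hi) (g≤z , subst (λ w → z < co c w) eq z<hi) lo<hi

  -- If the tiles do not face each other, the tile `f` on the low side that faces the start of `j`
  -- comes no earlier than `i` and is adjacent to `j`.
  low-then-high : ∀ {c d} → Opp c d → ∀ {i j} → high c i ≡ low c j → Lo d i < Hi d j → position i ℕ.< position j
  low-then-high {c} {d} o {i} {j} eq lo<hi = cases (Lo d j <? Hi d i)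
    where
    W : Wall c (low c j)
    W = (λ z → high≢fl c i (trans eq z)) , low≢fh c j , low-side , j , refl
    cases : Dec (Lo d j < Hi d i) → position i ℕ.< position j
    cases (yes j<i) = ⟶-position (adjacent o (eq , lo<hi , j<i))
    cases (no  j≮i) =
      let f , highf , at-f = beside o W high-side low-side (along o W low-side low-side refl (at-low d j))
      in ℕ.≤-<-trans
           (same-side o high-side (trans eq (sym highf))
             (ℚ.<-trans (co-tile d i) (ℚ.≤-<-trans (ℚ.≮⇒≥ j≮i) (proj₂ at-f))))
           (⟶-position (adjacent o (highf , ℚ.≤-<-trans (proj₁ at-f) (co-tile d j) , proj₂ at-f)))

-- The drawing step for one corner of the tile k: p is the diagonal point at the
-- corner, c the axis along which the corner is reached when p is not yet covered.
module Corner {n} {M : Mosaic n} (N : Ranks M) (box : Rect)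
  (lo-box : ∀ c → lo box c ≡ ι (rank N c (Mosaic.fl M c))) (hi-box : ∀ c → hi box c ≡ ι (rank N c (Mosaic.fh M c)))
  (done : Fin n → Bool) (closed : ∀ {c d} → Opp c d → Closed (Order.Adjacent N c d) done)
  (k : Fin n) (k-next : ∀ {c d} → Opp c d → ∀ {j} → Order.Adjacent N c d j k → done j ≡ true)
  (k-undone : ¬ (done k ≡ true))
  (T : Point → Set)
  where
  open Mosaic M
  open Drawn-as (drawing-in N box lo-box hi-box)
  open Order N using (Adjacent; module Sweep)
  open Sweep done closed

  Covered : Axis → Axis → Point → Set
  Covered c d s = (s c ≡ lo box c × lo box d ≤ s d × s d ≤ hi box d)
                ⊎ s d ≡ lo box d
                ⊎ ∃[ j ] done j ≡ true × s ∈ᴿ tile layout j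

  module _ {c d} (o : Opp c d)
    (T⇒ : ∀ s → T s → Covered c d s)
    (edge⇒T : ∀ s → s c ≡ lo box c → lo box d ≤ s d → s d ≤ hi box d → T s)
    (tile⇒T : ∀ s j → done j ≡ true → s ∈ᴿ tile layout j → T s)
    (p q : Point)
    (p-at : At low-side (p c) (Lo c k) (Hi c k)) (p-at′ : At high-side (p d) (Lo d k) (Hi d k))
    (on-wall : Lo c k ≡ p c ⊎ Hi d k ≡ p d)
    (end : Lo c k ≡ p c → (low c k ≡ fl c × high d k ≡ fh d) ⊎ (Wall c (low c k) × sp c (low c k) ≡ high d k))
    (q≡ : q c ≡ Lo c k) (q≡′ : q d ≡ Hi d k)
    where

    private
      box≤ : ∀ {c d} → Opp c d → ∀ i → lo box c ≤ Lo c i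
      box≤ {c} o i = subst (_≤ Lo c i) (sym (lo-box c)) (frame≤Lo o i)

      ≤box : ∀ {c d} → Opp c d → ∀ i → Hi c i ≤ hi box c
      ≤box {c} o i = subst (Hi c i ≤_) (sym (hi-box c)) (Hi≤frame o i)

      o′ = Opp-sym o

    -- The edge lies in the frame or is covered by neighbours on its low side, all of them drawn
    -- before `k`.
    low-edge-drawn : ∀ s → s c ≡ Lo c k → At high-side (s d) (Lo d k) (Hi d k) → T s
    low-edge-drawn s eq at-s = cases (low c k Fin.≟ fl c)
      where
      cases : Dec (low c k ≡ fl c) → T s
      cases (yes low≡) = edge⇒T s (trans eq (trans (cong (co c) low≡) (sym (lo-box c))))
        (ℚ.≤-trans (box≤ o′ k) (ℚ.<⇒≤ (proj₁ at-s))) (ℚ.≤-trans (proj₂ at-s) (≤box o′ k))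
      cases (no low≢) =
        let W = low≢ , low≢fh c k , low-side , k , refl
            g , highg , at-g = beside o W high-side high-side (along o W low-side high-side refl at-s)
            on-g = trans eq (cong (co c) (sym highg))
            done-g = k-next o (highg , ℚ.<-≤-trans (proj₁ at-g) (proj₂ at-s) , ℚ.<-≤-trans (proj₁ at-s) (proj₂ at-g))
        in tile⇒T s g done-g (both o (λ e → Lo e g ≤ s e × s e ≤ Hi e g)
             (subst (Lo c g ≤_) (sym on-g) (ℚ.<⇒≤ (co-tile c g)) , ℚ.≤-reflexive on-g)
             (At-weaken high-side at-g))

    -- Everything behind a drawn tile along axis `d` is drawn, and `k` is not.
    nothing-beyond : ∀ {j} → done j ≡ true → Lo c j < Hi c k → Lo c k < Hi c j → Lo d k < Hi d j → ⊥
    nothing-beyond {j} done-j j<k k<j below =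
      let z , j≤z , k≤z , least = larger (Lo c j) (Lo c k)
      in k-undone (sweep o′ done-j (j≤z , least (co-tile c j) k<j) (k≤z , least j<k (co-tile c k)) below)

    q-drawn : T q
    q-drawn = low-edge-drawn q q≡ (subst (Lo d k <_) (sym q≡′) (co-tile d k) , ℚ.≤-reflexive q≡′)

    -- As the low edge of `k` is drawn, `p` is not on it and by `on-wall` lies level with the high
    -- edge; anything drawn between `q` and `p` would be a tile beyond `k`.
    uncovered : ¬ T p → Furthest c (λ s → T s × s d ≡ p d × s c < p c) q
    uncovered ¬Tp = (q-drawn , trans q≡′ hi≡p , subst (_< p c) (sym q≡) lo<p) , furthest
      where
      lo≢p : ¬ (Lo c k ≡ p c)
      lo≢p eq = ¬Tp (low-edge-drawn p (sym eq) p-at′)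
      hi≡p : Hi d k ≡ p d
      hi≡p = [ (λ eq → ⊥-elim (lo≢p eq)) , (λ eq → eq) ]′ on-wall
      lo<p : Lo c k < p c
      lo<p = ℚ.≰⇒> λ p≤ → lo≢p (ℚ.≤-antisym (proj₁ p-at) p≤)
      furthest : ∀ s → T s × s d ≡ p d × s c < p c → s c ≤ q c
      furthest s (Ts , level , s<p) = subst (s c ≤_) (sym q≡) (ℚ.≮⇒≥ λ lo<s → absurd lo<s (T⇒ s Ts))
        where
        absurd : Lo c k < s c → Covered c d s → ⊥
        absurd lo<s (inj₁ (on , _)) = ℚ.<-irrefl refl (ℚ.<-≤-trans lo<s (subst (_≤ Lo c k) (sym on) (box≤ o k)))
        absurd lo<s (inj₂ (inj₁ on)) = ℚ.<-irrefl refl (ℚ.<-≤-trans (proj₁ p-at′) (subst (_≤ Lo d k) (trans (sym on) level) (box≤ o′ k)))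
        absurd lo<s (inj₂ (inj₂ (j , done-j , s∈j))) = nothing-beyond done-j
          (ℚ.≤-<-trans (proj₁ (s∈j c)) (ℚ.<-trans s<p (proj₂ p-at)))
          (ℚ.<-≤-trans lo<s (proj₂ (s∈j c)))
          (ℚ.<-≤-trans (proj₁ p-at′) (subst (_≤ Hi d j) level (proj₂ (s∈j d))))

    -- `p` can be drawn only if it lies on the low edge of `k`. By `end` the wall or frame edge
    -- there stops at the corner `q`, so nothing drawn on its low side reaches further.
    covered : T p → Furthest d (λ s → T s × s c ≡ p c × p d ≤ s d) q
    covered Tp = (q-drawn , trans q≡ lo≡p , subst (p d ≤_) (sym q≡′) (proj₂ p-at′)) , furthest
      where
      lo≡p : Lo c k ≡ p c
      lo≡p = ℚ.≤-antisym (proj₁ p-at) (ℚ.≮⇒≥ λ lo<p → absurd lo<p (T⇒ p Tp))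
        where
        absurd : Lo c k < p c → Covered c d p → ⊥
        absurd lo<p (inj₁ (on , _)) = ℚ.<-irrefl refl (ℚ.<-≤-trans lo<p (subst (_≤ Lo c k) (sym on) (box≤ o k)))
        absurd lo<p (inj₂ (inj₁ on)) = ℚ.<-irrefl refl (ℚ.<-≤-trans (proj₁ p-at′) (subst (_≤ Lo d k) (sym on) (box≤ o′ k)))
        absurd lo<p (inj₂ (inj₂ (j , done-j , p∈j))) = nothing-beyond done-j
          (ℚ.≤-<-trans (proj₁ (p∈j c)) (proj₂ p-at)) (ℚ.<-≤-trans lo<p (proj₂ (p∈j c)))
          (ℚ.<-≤-trans (proj₁ p-at′) (proj₂ (p∈j d)))
      furthest : ∀ s → T s × s c ≡ p c × p d ≤ s d → s d ≤ q d
      furthest s (Ts , on-p , _) = subst (s d ≤_) (sym q≡′) (ℚ.≮⇒≥ λ hi<s → absurd hi<s (T⇒ s Ts) (end lo≡p))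
        where
        s≡lo : s c ≡ Lo c k
        s≡lo = trans on-p (sym lo≡p)
        absurd : Hi d k < s d → Covered c d s → (low c k ≡ fl c × high d k ≡ fh d) ⊎ (Wall c (low c k) × sp c (low c k) ≡ high d k) → ⊥
        absurd hi<s (inj₁ (_ , _ , ≤hi)) (inj₁ (_ , high≡)) =
          ℚ.<-irrefl refl (ℚ.<-≤-trans hi<s (subst (s d ≤_) (trans (hi-box d) (cong (co d) (sym high≡))) ≤hi))
        absurd hi<s (inj₁ (on , _)) (inj₂ ((≢fl , _) , _)) =
          ≢fl (rank-injective N c (ι-injective (trans (sym s≡lo) (trans on (lo-box c)))))
        absurd hi<s (inj₂ (inj₁ on)) _ =
          ℚ.<-irrefl refl (ℚ.<-trans hi<s (ℚ.≤-<-trans (subst (_≤ Lo d k) (sym on) (box≤ o′ k)) (co-tile d k)))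
        absurd hi<s (inj₂ (inj₂ (j , done-j , s∈j))) end′ = cases (Lo c k <? Hi c j)
          where
          hi<hi : Hi d k < Hi d j
          hi<hi = ℚ.<-≤-trans hi<s (proj₂ (s∈j d))
          cases : Dec (Lo c k < Hi c j) → ⊥
          cases (yes k<j) = nothing-beyond done-j
            (ℚ.≤-<-trans (subst (Lo c j ≤_) s≡lo (proj₁ (s∈j c))) (co-tile c k)) k<j (ℚ.<-trans (co-tile d k) hi<hi)
          cases (no k≮j) = at-end end′
            where
            high≡low : high c j ≡ low c k
            high≡low = rank-injective N c (ι-injective (ℚ.≤-antisym (ℚ.≮⇒≥ k≮j) (subst (_≤ Hi c j) s≡lo (proj₂ (s∈j c)))))
            at-end : (low c k ≡ fl c × high d k ≡ fh d) ⊎ (Wall c (low c k) × sp c (low c k) ≡ high d k) → ⊥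
            at-end (inj₁ (low≡ , _)) = high≢fl c j (trans high≡low low≡)
            at-end (inj₂ (W , sp≡))  = ℚ.<-irrefl refl (ℚ.<-≤-trans hi<hi
              (subst (λ z → Hi d j ≤ co d z) sp≡ (Hi≤sp o W high-side high≡low)))

module Rho {m} {L R T B : Fin (suc m) → Fin (suc (suc m))} (diagonal : Diagonal L R T B) where
  open Diagonal diagonal
  open FromDiagonal diagonal
  private
    n = suc m
    N₀ = diagonal-ranks

    lo-square : ∀ c → lo (square n) c ≡ ι (rank N₀ c (fl c))
    lo-square X = sym (ι-def 0)
    lo-square Y = trans (sym (ι-def 0)) (cong ι (sym (trans (cong (n ℕ.∸_) (Fin.toℕ-fromℕ n)) (ℕ.n∸n≡0 n))))

    hi-square : ∀ c → hi (square n) c ≡ ι (rank N₀ c (fh c))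
    hi-square X = trans (sym (ι-def n)) (cong ι (sym (Fin.toℕ-fromℕ n)))
    hi-square Y = sym (ι-def n)

  diagonal-drawing : Drawing mosaic
  diagonal-drawing = drawing-in N₀ (square n) lo-square hi-square

  open Drawn-as diagonal-drawing

  module _ (N : Ranks mosaic) (x : Permutation′ n)
    (sorted : ∀ a b → Order._⟶_ N (x ⟨$⟩ʳ a) (x ⟨$⟩ʳ b) → a Fin.< b) where

    open Linear N x sorted

    -- The tiles need not be adjacent for `N`. But by `split` one of them sits at an end of the
    -- wall, and does so for all coordinates; this gives `Lo d i < Hi d j` for `N`.
    diagonal-position : ∀ {c d} → Opp c d → ∀ {i j} → Order.Adjacent N₀ c d i j → position i ℕ.< position j
    diagonal-position {c} {d} o {i} {j} (eq , lo<hi , _) = cases (split o eq)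
      where
      module M = Mosaic mosaic
      module G = Realization mosaic (rank-coordinates N)
      W : M.Wall c (low c j)
      W = (λ z → M.high≢fl c i (trans eq z)) , M.low≢fh c j , low-side , j , refl
      cases : low d i ≡ st c (low c j) ⊎ high d j ≡ sp c (low c j) ⊎ rank N₀ d (high d j) ℕ.≤ rank N₀ d (low d i) →
              position i ℕ.< position j
      cases (inj₁ low≡st) = low-then-high o eq (ℚ.≤-<-trans
        (subst (λ z → G.co d z ≤ G.Lo d j) (sym low≡st) (G.st≤Lo o W low-side refl)) (G.co-tile d j))
      cases (inj₂ (inj₁ high≡sp)) = low-then-high o eq (ℚ.<-≤-trans (G.co-tile d i)
        (subst (λ z → G.Hi d i ≤ G.co d z) (sym high≡sp) (G.Hi≤sp o W high-side eq)))
      cases (inj₂ (inj₂ hi≤lo)) = ⊥-elim (ℚ.<-irrefl refl (ℚ.<-≤-trans lo<hi (ι-mono-≤ hi≤lo)))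

    module Draw (a : Fin n) where
      private
        k = x ⟨$⟩ʳ a
        Tᵃ = Drawn x layout a

      drawn : Fin n → Bool
      drawn j = does (position j ℕ.<? toℕ a)

      open Corner N₀ (square n) lo-square hi-square drawn
        (λ o {i} {j} adj eq → dec-true (position i ℕ.<? toℕ a)
          (ℕ.<-trans (diagonal-position o adj) (true⇒ (position j ℕ.<? toℕ a) eq)))
        k
        (λ o {j} adj → dec-true (position j ℕ.<? toℕ a)
          (subst (position j ℕ.<_) (cong toℕ (Perm.inverseˡ x)) (diagonal-position o adj)))
        (λ eq → ℕ.<-irrefl (cong toℕ (Perm.inverseˡ x)) (true⇒ (position k ℕ.<? toℕ a) eq))
        Tᵃ

      drawn-tile : ∀ s b → b Fin.< a → s ∈ᴿ tile layout (x ⟨$⟩ʳ b) → ∃[ j ] drawn j ≡ true × s ∈ᴿ tile layout j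
      drawn-tile s b b<a s∈ = x ⟨$⟩ʳ b , dec-true (position _ ℕ.<? toℕ a)
        (subst (ℕ._< toℕ a) (cong toℕ (sym (Perm.inverseˡ x))) b<a) , s∈

      T⇒X : ∀ s → Tᵃ s → Covered X Y s
      T⇒X s (inj₁ on)                   = inj₁ on
      T⇒X s (inj₂ (inj₁ (on , _)))      = inj₂ (inj₁ on)
      T⇒X s (inj₂ (inj₂ (b , b<a , s∈))) = inj₂ (inj₂ (drawn-tile s b b<a s∈))

      T⇒Y : ∀ s → Tᵃ s → Covered Y X s
      T⇒Y s (inj₁ (on , _))             = inj₂ (inj₁ on)
      T⇒Y s (inj₂ (inj₁ on))            = inj₁ on
      T⇒Y s (inj₂ (inj₂ (b , b<a , s∈))) = inj₂ (inj₂ (drawn-tile s b b<a s∈))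

      tile⇒T : ∀ s j → drawn j ≡ true → s ∈ᴿ tile layout j → Tᵃ s
      tile⇒T s j eq s∈ = inj₂ (inj₂ (x ⟨$⟩ˡ j , true⇒ (position j ℕ.<? toℕ a) eq
        , subst (λ z → s ∈ᴿ tile layout z) (sym (Perm.inverseʳ x)) s∈))

      k<n : suc (toℕ k) ℕ.≤ n
      k<n = Fin.toℕ<n k

      p p′ : Point
      p = diagonalPoint n (toℕ k)
      p′ = diagonalPoint n (suc (toℕ k))

      reach-top-left : IsTopLeftFor Tᵃ p (topLeft (tile layout k))
      reach-top-left = uncovered XY T⇒X edge⇒T tile⇒T p q p-at p-at′ on-wall end refl refl
               , covered XY T⇒X edge⇒T tile⇒T p q p-at p-at′ on-wall end refl refl
        where
        q = topLeft (tile layout k)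
        edge⇒T : ∀ s → s X ≡ lo (square n) X → lo (square n) Y ≤ s Y → s Y ≤ hi (square n) Y → Tᵃ s
        edge⇒T s on p q = inj₁ (on , p , q)
        p-at : At low-side (p X) (Lo X k) (Hi X k)
        p-at = subst (λ z → At low-side z (Lo X k) (Hi X k)) (ι-def _) (ι-mono-≤ (L≤ k) , ι-mono-< (<R k))
        p-at′ : At high-side (p Y) (Lo Y k) (Hi Y k)
        p-at′ = subst (λ z → At high-side z (Lo Y k) (Hi Y k)) (ι-def _)
          (ι-mono-< (ℕ.∸-monoʳ-< (<B k) (ℕ.≤-pred (Fin.toℕ<n (B k)))) , ι-mono-≤ (ℕ.∸-monoʳ-≤ n (T≤ k)))
        on-wall : Lo X k ≡ p X ⊎ Hi Y k ≡ p Y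
        on-wall = [ (λ eq → inj₁ (trans (cong ι eq) (ι-def _)))
                  , (λ eq → inj₂ (trans (cong (λ z → ι (n ℕ.∸ z)) eq) (ι-def _))) ]′ (top-left-corner k)
        end : Lo X k ≡ p X → (low X k ≡ fl X × high Y k ≡ fh Y) ⊎ (Mosaic.Wall mosaic X (low X k) × sp X (low X k) ≡ high Y k)
        end eq = top-left-end k (ι-injective (trans eq (sym (ι-def _))))

      reach-bottom-right : IsBottomRightFor Tᵃ p′ (bottomRight (tile layout k))
      reach-bottom-right = uncovered YX T⇒Y edge⇒T tile⇒T p′ q p-at p-at′ on-wall end refl refl
                   , covered YX T⇒Y edge⇒T tile⇒T p′ q p-at p-at′ on-wall end refl refl
        where
        q = bottomRight (tile layout k)
        edge⇒T : ∀ s → s Y ≡ lo (square n) Y → lo (square n) X ≤ s X → s X ≤ hi (square n) X → Tᵃ s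
        edge⇒T s on p q = inj₂ (inj₁ (on , p , q))
        p-at : At low-side (p′ Y) (Lo Y k) (Hi Y k)
        p-at = subst (λ z → At low-side z (Lo Y k) (Hi Y k)) (ι-def _)
          (ι-mono-≤ (ℕ.∸-monoʳ-≤ n (<B k)) , ι-mono-< (ℕ.∸-monoʳ-< (s≤s (T≤ k)) k<n))
        p-at′ : At high-side (p′ X) (Lo X k) (Hi X k)
        p-at′ = subst (λ z → At high-side z (Lo X k) (Hi X k)) (ι-def _) (ι-mono-< (s≤s (L≤ k)) , ι-mono-≤ (<R k))
        on-wall : Lo Y k ≡ p′ Y ⊎ Hi X k ≡ p′ X
        on-wall = [ (λ eq → inj₁ (trans (cong (λ z → ι (n ℕ.∸ z)) eq) (ι-def _)))
                  , (λ eq → inj₂ (trans (cong ι eq) (ι-def _))) ]′ (bottom-right-corner k)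
        end : Lo Y k ≡ p′ Y → (low Y k ≡ fl Y × high X k ≡ fh X) ⊎ (Mosaic.Wall mosaic Y (low Y k) × sp Y (low Y k) ≡ high X k)
        end eq = bottom-right-end k (ℕ.∸-cancelˡ-≡ (ℕ.≤-pred (Fin.toℕ<n (B k))) k<n (ι-injective (trans eq (sym (ι-def _)))))

    isRho : IsRho x layout
    isRho = record
      { frame-square = refl
      ; draw-topLeft = λ a → Draw.reach-top-left a
      ; draw-bottomRight = λ a → Draw.reach-bottom-right a }

-- Wall shuffles

AllPairs-restrict : ∀ {A : Set} {P : A → Set} {R S : A → A → Set} →
  (∀ {x y} → P x → P y → R x y → S x y) → ∀ {xs} → All P xs → AllPairs R xs → AllPairs S xs
AllPairs-restrict f []         []         = []
AllPairs-restrict f (px ∷ pxs) (rx ∷ rxs) = All.zipWith (λ (py , r) → f px py r) (pxs , rx) ∷ AllPairs-restrict f pxs rxs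

module Shuffles {n} {M : Mosaic n} (N : Ranks M) (x : Permutation′ n)
  (sorted : ∀ a b → Order._⟶_ N (x ⟨$⟩ʳ a) (x ⟨$⟩ʳ b) → a Fin.< b) where
  open Mosaic M
  open Drawn-as (drawing N)

  open Linear N x sorted

  position-strict : ∀ {i j} → i ≢ j → position i ℕ.≤ position j → position i ℕ.< position j
  position-strict i≢j i≤j = ℕ.≤∧≢⇒< i≤j (λ eq → i≢j
    (trans (sym (Perm.inverseʳ x)) (trans (cong (x ⟨$⟩ʳ_) (Fin.toℕ-injective eq)) (Perm.inverseʳ x))))

  module OnWall (c : Axis) (k : Fin (suc n)) (W : Wall c k) where
    private
      d = other c
      o = opp c
      o′ = Opp-sym o
      w = segment c k

    -- `Recorded` in terms of labels: the tiles left out of the shuffle are the first on the low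
    -- side and the last on the high side, whose edges are at an end of the wall.
    data Read (i : Fin n) (y : ℚ) : Set where
      read-low  : high c i ≡ k → low d i ≢ st c k → y ≡ Lo d i → Read i y
      read-high : low c i ≡ k → high d i ≢ sp c k → y ≡ Hi d i → Read i y

    Reads : Fin n → Set
    Reads i = (high c i ≡ k × low d i ≢ st c k) ⊎ (low c i ≡ k × high d i ≢ sp c k)

    reads? : ∀ i → Dec (Reads i)
    reads? i = ((high c i Fin.≟ k) ×-dec ¬? (low d i Fin.≟ st c k)) ⊎-dec ((low c i Fin.≟ k) ×-dec ¬? (high d i Fin.≟ sp c k))

    height : Fin n → ℚ
    height i = if does (high c i Fin.≟ k) then Lo d i else Hi d i

    height-low : ∀ {i} → high c i ≡ k → height i ≡ Lo d i
    height-low {i} eq = cong (λ b → if b then Lo d i else Hi d i) (dec-true (high c i Fin.≟ k) eq)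

    height-high : ∀ {i} → low c i ≡ k → height i ≡ Hi d i
    height-high {i} eq = cong (λ b → if b then Lo d i else Hi d i) (dec-false (high c i Fin.≟ k)
      (λ eq′ → ℚ.<-irrefl (cong (co c) (trans eq (sym eq′))) (co-tile c i)))

    reads⇒read : ∀ {i} → Reads i → Read i (height i)
    reads⇒read (inj₁ (p , q)) = read-low p q (height-low p)
    reads⇒read (inj₂ (p , q)) = read-high p q (height-high p)

    read⇒reads : ∀ {i y} → Read i y → Reads i × y ≡ height i
    read⇒reads (read-low  p q eq) = inj₁ (p , q) , trans eq (sym (height-low p))
    read⇒reads (read-high p q eq) = inj₂ (p , q) , trans eq (sym (height-high p))

    st<lo : ∀ {i} → high c i ≡ k → low d i ≢ st c k → co d (st c k) < Lo d i
    st<lo eq ≢st = co-strict d (st≤Lo o W high-side eq) (≢-sym ≢st)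

    hi<sp : ∀ {i} → low c i ≡ k → high d i ≢ sp c k → Hi d i < co d (sp c k)
    hi<sp eq ≢sp = co-strict d (Hi≤sp o W low-side eq) ≢sp

    crosses : ∀ {m} → Wall d m → co d (st c k) < co d m → co d m < co d (sp c k) →
              At low-side (co c k) (co c (st d m)) (co c (sp d m)) →
              At high-side (co c k) (co c (st d m)) (co c (sp d m)) → ⊥
    crosses Wm st<m m<sp at-low at-high = no-crossing o W Wm (λ s → At-inside s st<m m<sp)
      (λ { low-side → at-low ; high-side → at-high })

    -- Otherwise the walls ending at the common height would cross this wall.
    read-apart : ∀ {i j} → high c i ≡ k → low d i ≢ st c k → low c j ≡ k → high d j ≢ sp c k → Lo d i ≢ Hi d j
    read-apart {i} {j} highᵢ ≢st lowⱼ ≢sp eq = crosses Wm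
      (st<lo highᵢ ≢st) (subst (_< co d (sp c k)) (sym eq) (hi<sp lowⱼ ≢sp))
      (along o′ Wm high-side low-side (sym common) (at-side low-side c lowⱼ))
      (along o′ Wm low-side high-side refl (at-side high-side c highᵢ))
      where
      common : low d i ≡ high d j
      common = rank-injective N d (ι-injective eq)
      Wm : Wall d (low d i)
      Wm = (λ z → high≢fl d j (trans (sym common) z)) , low≢fh d i , low-side , i , refl

    read-unique : ∀ {i j y} → Read i y → Read j y → i ≡ j
    read-unique {i} {j} (read-low p _ eq) (read-low p′ _ eq′) =
      tile-unique o high-side low-side (at-side high-side c p) (at-low d i) (at-side high-side c p′)
        (subst (λ z → At low-side z (Lo d j) (Hi d j)) (trans (sym eq′) eq) (at-low d j))
    read-unique {i} {j} (read-high p _ eq) (read-high p′ _ eq′) =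
      tile-unique o low-side high-side (at-side low-side c p) (at-high d i) (at-side low-side c p′)
        (subst (λ z → At high-side z (Lo d j) (Hi d j)) (trans (sym eq′) eq) (at-high d j))
    read-unique (read-low p q eq) (read-high p′ q′ eq′) = ⊥-elim (read-apart p q p′ q′ (trans (sym eq) eq′))
    read-unique (read-high p q eq) (read-low p′ q′ eq′) = ⊥-elim (read-apart p′ q′ p q (trans (sym eq′) eq))

    -- The relation `Shuffled` serves the single case of a high-side tile read before a low-side
    -- one.
    read-ordered : ∀ {i j y z} → Read i y → Read j z → y < z → position i ℕ.< position j
    read-ordered {i} {j} (read-low p _ refl) (read-low p′ _ refl) y<z =
      position-strict (λ i≡j → ℚ.<-irrefl (cong (Lo d) i≡j) y<z)
        (same-side o high-side (trans p (sym p′)) (ℚ.<-trans y<z (co-tile d j)))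
    read-ordered {i} {j} (read-high p _ refl) (read-high p′ _ refl) y<z =
      position-strict (λ i≡j → ℚ.<-irrefl (cong (Hi d) i≡j) y<z)
        (same-side o low-side (trans p (sym p′)) (ℚ.<-trans (co-tile d i) y<z))
    read-ordered (read-low p _ refl) (read-high p′ _ refl) y<z = low-then-high o (trans p (sym p′)) y<z
    read-ordered (read-high p _ refl) (read-low p′ _ refl) y<z = ⟶-position (Order.shuffled o (trans p (sym p′) , y<z))

    in-frame : co d (fl d) ≤ co d (st c k) × co d (sp c k) ≤ co d (fh d)
    in-frame =
      let _ , _ , s , _ = W
          i , _ , at-st = beside o W s low-side (ℚ.≤-refl , st<sp o W)
          j , _ , at-sp = beside o W s high-side (st<sp o W , ℚ.≤-refl)
      in ℚ.≤-trans (frame≤Lo o′ i) (proj₁ at-st) , ℚ.≤-trans (proj₂ at-sp) (Hi≤frame o′ j)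

    axis≡ : other d ≡ c
    axis≡ = other≡ o′

    read⇒recorded : ∀ {i y} → Read i y → Recorded layout w y i
    read⇒recorded {i} (read-low highᵢ ≢st refl) =
      segment d m , segment-isWall Wm , refl ,
      inj₁ ((refl , trans (cong (λ e → co e (sp d m)) axis≡) stop-k , ℚ.<⇒≤ st<m , ℚ.<⇒≤ m<sp)
           , edge-on high-side W highᵢ , edge-on low-side Wm refl)
      where
      m = low d i
      st<m : co d (st c k) < co d m
      st<m = st<lo highᵢ ≢st
      m<sp : co d m < co d (sp c k)
      m<sp = ℚ.<-≤-trans (co-tile d i) (Hi≤sp o W high-side highᵢ)
      Wm : Wall d m
      Wm = (λ m≡fl → ℚ.<-irrefl refl (ℚ.≤-<-trans (proj₁ in-frame) (subst (λ z → co d (st c k) < co d z) m≡fl st<m)))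
         , low≢fh d i , low-side , i , refl
      at-k : At high-side (co c k) (co c (st d m)) (co c (sp d m))
      at-k = along o′ Wm low-side high-side refl (at-side high-side c highᵢ)
      -- Wall `m` reaches `k` along the edge of `i`; going on, it would cross `k`.
      stop-k : co c (sp d m) ≡ co c k
      stop-k = ℚ.≤-antisym (ℚ.≮⇒≥ λ k<stop → crosses Wm st<m m<sp (ℚ.<⇒≤ (proj₁ at-k) , k<stop) at-k)
                           (proj₂ at-k)
    read⇒recorded {i} (read-high lowᵢ ≢sp refl) =
      segment d m , segment-isWall Wm , refl ,
      inj₂ ((refl , trans (cong (λ e → co e (st d m)) axis≡) start-k , ℚ.<⇒≤ st<m , ℚ.<⇒≤ m<sp)
           , edge-on low-side W lowᵢ , edge-on high-side Wm refl)
      where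
      m = high d i
      st<m : co d (st c k) < co d m
      st<m = ℚ.≤-<-trans (st≤Lo o W low-side lowᵢ) (co-tile d i)
      m<sp : co d m < co d (sp c k)
      m<sp = hi<sp lowᵢ ≢sp
      Wm : Wall d m
      Wm = high≢fl d i
         , (λ m≡fh → ℚ.<-irrefl refl (ℚ.<-≤-trans (subst (λ z → co d z < co d (sp c k)) m≡fh m<sp) (proj₂ in-frame)))
         , high-side , i , refl
      at-k : At low-side (co c k) (co c (st d m)) (co c (sp d m))
      at-k = along o′ Wm high-side low-side refl (at-side low-side c lowᵢ)
      start-k : co c (st d m) ≡ co c k
      start-k = ℚ.≤-antisym (proj₁ at-k)
        (ℚ.≮⇒≥ λ start<k → crosses Wm st<m m<sp at-k (start<k , ℚ.<⇒≤ (proj₂ at-k)))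

    edge-label : ∀ {i m} e s → pick s lowEdge highEdge e (tile layout i) ⊆ˢ segment e m → side s e i ≡ m
    edge-label {i} e low-side  ⊆m = rank-injective N e (ι-injective (pos≡ (⊆⇒⊑ (co-tile (other e) i) ⊆m)))
    edge-label {i} e high-side ⊆m = rank-injective N e (ι-injective (pos≡ (⊆⇒⊑ (co-tile (other e) i) ⊆m)))

    recorded⇒read : ∀ {i y} → Recorded layout w y i → Read i y
    recorded⇒read {i} (v , isWall-v , refl , rec) = cases (wall-is-segment v isWall-v) rec
      where
      -- Otherwise the tile in front of the start of wall `k` would overlap `i`, or it would have
      -- its edge in `m` and carry `m` past `k`.
      ends-low : ∀ m → Wall d m → co c (sp d m) ≡ co c k → high c i ≡ k → low d i ≡ m → low d i ≢ st c k
      ends-low m Wm stop-k highᵢ lowᵢ low≡st =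
        let m≡st = trans (sym lowᵢ) low≡st
            j , lo<k , k<hi , lo<st , st≤hi = across-start o W
              (subst (λ z → co d (fl d) < co d z) m≡st (proj₁ (wall-in-frame o′ Wm)))
        in beyond j lo<k k<hi (subst (λ z → Lo d j < co d z) (sym m≡st) lo<st) (subst (λ z → co d z ≤ Hi d j) (sym m≡st) st≤hi)
        where
        beyond : ∀ j → Lo c j < co c k → co c k < Hi c j → Lo d j < co d m → co d m ≤ Hi d j → ⊥
        beyond j lo<k k<hi lo<m m≤hi = cases′ (co d m <? Hi d j)
          where
          cases′ : Dec (co d m < Hi d j) → ⊥
          cases′ (yes m<hi) = ℚ.<-irrefl
            (trans (cong (co c) (sym highᵢ)) (cong (Hi c) (tile-unique o high-side low-side
              (at-side high-side c highᵢ) (at-side low-side d lowᵢ) (lo<k , ℚ.<⇒≤ k<hi) (ℚ.<⇒≤ lo<m , m<hi)))) k<hi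
          cases′ (no m≮hi) = ℚ.<-irrefl refl (ℚ.<-≤-trans k<hi (subst (Hi c j ≤_) stop-k
            (Hi≤sp o′ Wm high-side (rank-injective N d (ι-injective (ℚ.≤-antisym (ℚ.≮⇒≥ m≮hi) m≤hi))))))

      ends-high : ∀ m → Wall d m → co c (st d m) ≡ co c k → low c i ≡ k → high d i ≡ m → high d i ≢ sp c k
      ends-high m Wm start-k lowᵢ highᵢ high≡sp =
        let m≡sp = trans (sym highᵢ) high≡sp
            j , lo<k , k<hi , lo≤sp , sp<hi = across-stop o W
              (subst (λ z → co d z < co d (fh d)) m≡sp (proj₂ (wall-in-frame o′ Wm)))
        in beyond j lo<k k<hi (subst (λ z → Lo d j ≤ co d z) (sym m≡sp) lo≤sp) (subst (λ z → co d z < Hi d j) (sym m≡sp) sp<hi)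
        where
        beyond : ∀ j → Lo c j < co c k → co c k < Hi c j → Lo d j ≤ co d m → co d m < Hi d j → ⊥
        beyond j lo<k k<hi lo≤m m<hi = cases′ (Lo d j <? co d m)
          where
          cases′ : Dec (Lo d j < co d m) → ⊥
          cases′ (yes lo<m) = ℚ.<-irrefl
            (trans (cong (Lo c) (sym (tile-unique o low-side high-side
              (at-side low-side c lowᵢ) (at-side high-side d highᵢ) (ℚ.<⇒≤ lo<k , k<hi) (lo<m , ℚ.<⇒≤ m<hi)))) (cong (co c) lowᵢ)) lo<k
          cases′ (no lo≮m) = ℚ.<-irrefl refl (ℚ.≤-<-trans (subst (_≤ Lo c j) start-k
            (st≤Lo o′ Wm low-side (rank-injective N d (ι-injective (ℚ.≤-antisym lo≤m (ℚ.≮⇒≥ lo≮m)))))) lo<k)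

      Ends : Segment → Set
      Ends v = v EndsFromLow w × highEdge c (tile layout i) ⊆ˢ w × lowEdge d (tile layout i) ⊆ˢ v
             ⊎ v EndsFromHigh w × lowEdge c (tile layout i) ⊆ˢ w × highEdge d (tile layout i) ⊆ˢ v

      at-segment : ∀ m → Wall d m → Ends (segment d m) → Read i (co d m)
      at-segment m Wm (inj₁ ((_ , stop-k , _) , ⊆w , ⊆v)) =
        read-low highᵢ (ends-low m Wm (trans (cong (λ e → co e (sp d m)) (sym axis≡)) stop-k) highᵢ lowᵢ) (cong (co d) (sym lowᵢ))
        where
        highᵢ = edge-label c high-side ⊆w
        lowᵢ = edge-label d low-side ⊆v
      at-segment m Wm (inj₂ ((_ , start-k , _) , ⊆w , ⊆v)) =
        read-high lowᵢ (ends-high m Wm (trans (cong (λ e → co e (st d m)) (sym axis≡)) start-k) lowᵢ highᵢ) (cong (co d) (sym highᵢ))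
        where
        lowᵢ = edge-label c low-side ⊆w
        highᵢ = edge-label d high-side ⊆v

      normal-v : Ends v → normal v ≡ d
      normal-v (inj₁ ((eq , _) , _)) = eq
      normal-v (inj₂ ((eq , _) , _)) = eq

      on-segment : ∀ e m → e ≡ d → Wall e m → v ≡ segment e m → Ends v → Read i (pos v)
      on-segment _ m refl Wm eq ends = subst (λ v → Read i (pos v)) (sym eq) (at-segment m Wm (subst Ends eq ends))

      cases : ∃[ m ] Wall (normal v) m × v ≡ segment (normal v) m → Ends v → Read i (pos v)
      cases (m , Wm , eq) ends = on-segment (normal v) m (normal-v ends) Wm eq ends

    σ : List (Fin n)
    σ = filter reads? (oneLine x)

    in-oneLine : ∀ i → i ∈ oneLine x
    in-oneLine i = subst (_∈ oneLine x) (Perm.inverseʳ x) (∈-tabulate⁺ (x ⟨$⟩ˡ i))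

    reads⇔∈σ : ∀ {i} → (Reads i → i ∈ σ) × (i ∈ σ → Reads i)
    reads⇔∈σ {i} = (λ r → ∈-filter⁺ reads? (in-oneLine i) r) , (λ i∈σ → proj₂ (∈-filter⁻ reads? {xs = oneLine x} i∈σ))

    σ-subsequence : σ ≡ subsequenceOn σ x
    σ-subsequence = List.filter-≐ reads? (_∈? σ)
      ((λ {i} → proj₁ (reads⇔∈σ {i})) , (λ {i} → proj₂ (reads⇔∈σ {i}))) (oneLine x)
      where
      open DecMembership Fin._≟_ using (_∈?_)

    record-at : Fin n → ℚ × Fin n
    record-at i = height i , i

    oneLine-sorted : AllPairs (λ i j → position i ℕ.< position j) (oneLine x)
    oneLine-sorted = AllPairs.tabulate⁺-< λ {a} {b} a<b →
      subst₂ (λ i j → toℕ i ℕ.< toℕ j) (sym (Perm.inverseˡ x)) (sym (Perm.inverseˡ x)) a<b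

    -- Heights are distinct by `read-unique`, so trichotomy reverses the implication `read-ordered`.
    rising : ∀ {i j} → Reads i → Reads j → position i ℕ.< position j → height i < height j
    rising {i} {j} rᵢ rⱼ i<j with ℚ.<-cmp (height i) (height j)
    ... | tri< lt _ _ = lt
    ... | tri≈ _ eq _ = ⊥-elim (ℕ.<-irrefl (cong position
      (read-unique (reads⇒read rᵢ) (subst (Read j) (sym eq) (reads⇒read rⱼ)))) i<j)
    ... | tri> _ _ gt = ⊥-elim (ℕ.<-asym i<j (read-ordered (reads⇒read rⱼ) (reads⇒read rᵢ) gt))

    isWallShuffle : IsWallShuffle layout w σ
    isWallShuffle = map record-at σ
      , trans (sym (List.map-∘ σ)) (List.map-id σ)
      , AllPairs⇒Linked (AllPairs.map⁺ (AllPairs-restrict rising (All.all-filter reads? (oneLine x)) (AllPairs.filter⁺ reads? oneLine-sorted)))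
      , λ h i → mk⇔ (forth h i) (back h i)
      where
      forth : ∀ h i → (h , i) ∈ map record-at σ → Recorded layout w h i
      forth h i hi∈ with j , j∈σ , refl ← ∈-map⁻ record-at hi∈ = read⇒recorded (reads⇒read (proj₂ reads⇔∈σ j∈σ))
      back : ∀ h i → Recorded layout w h i → (h , i) ∈ map record-at σ
      back h i rec = let reads , eq = read⇒reads (recorded⇒read rec) in
        subst (λ y → (y , i) ∈ map record-at σ) (sym eq) (∈-map⁺ record-at (proj₁ reads⇔∈σ reads))

  shuffles : ∀ w → IsWall layout w → ∃[ σ ] IsWallShuffle layout w σ × σ ≡ subsequenceOn σ x
  shuffles w isW = at (wall-is-segment w isW)
    where
    at : ∃[ k ] Wall (normal w) k × w ≡ segment (normal w) k → ∃[ σ ] IsWallShuffle layout w σ × σ ≡ subsequenceOn σ x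
    at (k , W , eq) = σ , subst (λ v → IsWallShuffle layout v σ) (sym eq) isWallShuffle , σ-subsequence
      where open OnWall (normal w) k W

-- Representing a given rectangulation

module TieBreaking {n} (f : Fin n → ℚ) where

  smaller-values : Fin n → ℕ
  smaller-values k = sumℕ (λ m → [ does (f m <? f k) ]ℕ)

  -- Lexicographic order in base `n`: first by value, then by label.
  refined : Fin n → ℕ
  refined k = smaller-values k ℕ.* n ℕ.+ toℕ k

  smaller-mono : ∀ {k m} → f k < f m → smaller-values k ℕ.< smaller-values m
  smaller-mono {k} {m} fk<fm = sumℕ-mono-< (λ j → indicator-mono (f j <? f k) (f j <? f m) (λ lt → ℚ.<-trans lt fk<fm)) k
    (indicator-< (f k <? f k) (f k <? f m) (ℚ.<-irrefl refl) fk<fm)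

  lexicographic : ∀ {k m} → smaller-values k ℕ.< smaller-values m → refined k ℕ.< refined m
  lexicographic {k} {m} lt = ℕ.<-≤-trans
    (ℕ.+-monoʳ-< (smaller-values k ℕ.* n) (Fin.toℕ<n k))
    (ℕ.≤-trans (subst (ℕ._≤ smaller-values m ℕ.* n) (ℕ.+-comm n _) (ℕ.*-monoˡ-≤ n lt)) (ℕ.m≤m+n _ (toℕ m)))

  refined-mono : ∀ {k m} → f k < f m → refined k ℕ.< refined m
  refined-mono lt = lexicographic (smaller-mono lt)

  refined-cancel : ∀ {k m} → refined k ℕ.≤ refined m → f k ≤ f m
  refined-cancel k≤m = ℚ.≮⇒≥ λ fm<fk → ℕ.<-irrefl refl (ℕ.<-≤-trans (refined-mono fm<fk) k≤m)

  refined-injective : ∀ {k m} → refined k ≡ refined m → k ≡ m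
  refined-injective {k} {m} eq with ℕ.<-cmp (smaller-values k) (smaller-values m)
  ... | tri< lt _ _ = ⊥-elim (ℕ.<-irrefl eq (lexicographic lt))
  ... | tri> _ _ gt = ⊥-elim (ℕ.<-irrefl (sym eq) (lexicographic gt))
  ... | tri≈ _ same _ = Fin.toℕ-injective (ℕ.+-cancelˡ-≡ (smaller-values m ℕ.* n) _ _
    (trans (cong (λ z → z ℕ.* n ℕ.+ toℕ k) (sym same)) eq))

flip-side : Side → Side
flip-side low-side  = high-side
flip-side high-side = low-side

-- The two kinds of half-open intervals differ only in their ends.
pick-exact : ∀ s {y a b} → At s y a b → ¬ At (flip-side s) y a b → pick s a b ≡ y
pick-exact low-side  (a≤y , y<b) ¬at = ℚ.≤-antisym a≤y (ℚ.≮⇒≥ λ a<y → ¬at (a<y , ℚ.<⇒≤ y<b))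
pick-exact high-side (a<y , y≤b) ¬at = ℚ.≤-antisym (ℚ.≮⇒≥ λ y<b → ¬at (ℚ.<⇒≤ a<y , y<b)) y≤b

pick-outside : ∀ s {y a b} → pick s a b ≡ y → ¬ At (flip-side s) y a b
pick-outside low-side  refl (a<a , _) = ℚ.<-irrefl refl a<a
pick-outside high-side refl (_ , b<b) = ℚ.<-irrefl refl b<b

flip-flip : ∀ s → flip-side (flip-side s) ≡ s
flip-flip low-side  = refl
flip-flip high-side = refl

module Representation {m} (R : Layout (suc m)) (generic : IsGenericTiling R)
  (S : Labelled (dissection R (IsGenericTiling.isTiling generic))) where
  open IsGenericTiling generic using (isTiling) renaming (generic to no-four)
  open IsTiling isTiling
  open Labelled S using (num; diagonal; l≡; r≡; t≡; b≡; fl≡; fr≡; ft≡; fb≡)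
  open FromDiagonal diagonal
  private
    n = suc m

  place : Axis → Fin (suc n) → ℚ
  place X k = Labelled.xs S k
  place Y k = ℚ.- Labelled.ys S k

  numbered : Fin n → Rect
  numbered i = tile R (num ⟨$⟩ʳ i)

  lo-place : ∀ c i → lo (numbered i) c ≡ place c (low c i)
  lo-place X i = l≡ i
  lo-place Y i = trans (sym (neg-involutive _)) (cong ℚ.-_ (b≡ i))

  hi-place : ∀ c i → hi (numbered i) c ≡ place c (high c i)
  hi-place X i = r≡ i
  hi-place Y i = trans (sym (neg-involutive _)) (cong ℚ.-_ (t≡ i))

  lo-frame-place : ∀ c → lo (frame R) c ≡ place c (fl c)
  lo-frame-place X = fl≡
  lo-frame-place Y = trans (sym (neg-involutive _)) (cong ℚ.-_ fb≡)

  hi-frame-place : ∀ c → hi (frame R) c ≡ place c (fh c)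
  hi-frame-place X = fr≡
  hi-frame-place Y = trans (sym (neg-involutive _)) (cong ℚ.-_ ft≡)

  coordinates : Coordinates mosaic
  coordinates = record
    { co = place
    ; co-tile = λ c i → subst₂ _<_ (lo-place c i) (hi-place c i) (nondegenerate (num ⟨$⟩ʳ i) c)
    ; co-frame = λ c → subst₂ _<_ (lo-frame-place c) (hi-frame-place c)
        (ℚ.≤-<-trans (proj₁ (in-frame c)) (ℚ.<-≤-trans (nondegenerate zero c) (proj₂ (in-frame c)))) }
    where
    in-frame : ∀ c → lo (frame R) c ≤ lo (tile R zero) c × hi (tile R zero) c ≤ hi (frame R) c
    in-frame c = proj₁ (inside zero (lo (tile R zero)) (λ c → ℚ.≤-refl , ℚ.<⇒≤ (nondegenerate zero c)) c)
               , proj₂ (inside zero (hi (tile R zero)) (λ c → ℚ.<⇒≤ (nondegenerate zero c) , ℚ.≤-refl) c)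

  module Re = Realization mosaic coordinates
  open Mosaic mosaic using (side; Wall; low≢fh; high≢fl)

  At-corner : Side → Axis → ℚ → Fin n → Set
  At-corner s c y i = place c (side s c i) ≡ y

  corner-at : ∀ s c {y i} → At-corner s c y i → At s y (Re.Lo c i) (Re.Hi c i)
  corner-at s c {i = i} refl = Re.at-side s c {i} refl

  corner-side : ∀ s c {i y} → pick s (Re.Lo c i) (Re.Hi c i) ≡ y → At-corner s c y i
  corner-side low-side  c eq = eq
  corner-side high-side c eq = eq

  side-corner : ∀ s c {i y} → At-corner s c y i → pick s (Re.Lo c i) (Re.Hi c i) ≡ y
  side-corner low-side  c eq = eq
  side-corner high-side c eq = eq

  one-side : ∀ s s′ c {y i} → At-corner s c y i → At-corner s′ c y i → s ≡ s′
  one-side low-side  low-side  c _ _ = refl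
  one-side high-side high-side c _ _ = refl
  one-side low-side  high-side c p q = ⊥-elim (ℚ.<-irrefl (trans p (sym q)) (Re.co-tile c _))
  one-side high-side low-side  c p q = ⊥-elim (ℚ.<-irrefl (trans q (sym p)) (Re.co-tile c _))

  four-corners : ∀ {c d} → Opp c d → ∀ x y → (∀ s s′ → ∃[ i ] At-corner s c x i × At-corner s′ d y i) → ⊥
  four-corners {c} {d} o x y quadrant = no-four p (λ k → num ⟨$⟩ʳ chosen k) chosen-injective corners
    where
    decode₁ decode₂ : Fin 4 → Side
    decode₁ k = proj₁ (decode k)
    decode₂ k = proj₂ (decode k)

    chosen : Fin 4 → Fin n
    chosen k = proj₁ (quadrant (decode₁ k) (decode₂ k))

    at₁ : ∀ k → At-corner (decode₁ k) c x (chosen k)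
    at₁ k = proj₁ (proj₂ (quadrant (decode₁ k) (decode₂ k)))

    at₂ : ∀ k → At-corner (decode₂ k) d y (chosen k)
    at₂ k = proj₂ (proj₂ (quadrant (decode₁ k) (decode₂ k)))

    chosen-injective : Injective _≡_ _≡_ (λ k → num ⟨$⟩ʳ chosen k)
    chosen-injective {k} {k′} eq = trans (sym (encode-decode k)) (trans
      (cong₂ encode
        (one-side _ _ c (at₁ k) (subst (At-corner (decode₁ k′) c x) (sym same) (at₁ k′)))
        (one-side _ _ d (at₂ k) (subst (At-corner (decode₂ k′) d y) (sym same) (at₂ k′))))
      (encode-decode k′))
      where
      same : chosen k ≡ chosen k′
      same = trans (sym (Perm.inverseˡ num)) (trans (cong (num ⟨$⟩ˡ_) eq) (Perm.inverseˡ num))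

    p : Point
    p = point c x y

    either : ∀ s e i {z} → At-corner s e z i → z ≡ lo (numbered i) e ⊎ z ≡ hi (numbered i) e
    either low-side  e i refl = inj₁ (sym (lo-place e i))
    either high-side e i refl = inj₂ (sym (hi-place e i))

    corners : ∀ k → p IsCornerOf numbered (chosen k)
    corners k = both o (λ e → p e ≡ lo (numbered (chosen k)) e ⊎ p e ≡ hi (numbered (chosen k)) e)
      (subst (λ z → z ≡ lo (numbered (chosen k)) c ⊎ z ≡ hi (numbered (chosen k)) c) (sym (point-on c x y)) (either (decode₁ k) c (chosen k) (at₁ k)))
      (subst (λ z → z ≡ lo (numbered (chosen k)) d ⊎ z ≡ hi (numbered (chosen k)) d) (sym (point-off o x y)) (either (decode₂ k) d (chosen k) (at₂ k)))

  -- If two tiles met only in a corner, the tiles in the other two quadrants would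
  -- have a corner there as well.
  opposite-corners : ∀ {c d} → Opp c d → ∀ s s′ {i j x y} → At-corner s c x i → At-corner s′ d y i →
    At-corner (flip-side s) c x j → At-corner (flip-side s′) d y j → ⊥
  opposite-corners {c} {d} o s s′ {i} {j} {x} {y} iₓ iᵧ jₓ jᵧ = four-corners o x y quadrants
    where
    -- The tile in a third quadrant extends neither into that of `i` nor into that of `j`, so it has
    -- its corner at the point.
    other-corner : ∀ s s′ {i j} → At-corner s c x i → At-corner s′ d y i →
      At-corner (flip-side s) c x j → At-corner (flip-side s′) d y j →
      ∃[ f ] At-corner s c x f × At-corner (flip-side s′) d y f
    other-corner s s′ {i} {j} iₓ iᵧ jₓ jᵧ =
      let frame₁ = proj₁ (Re.tile-in-frame o s s′ (corner-at s c iₓ) (corner-at s′ d iᵧ))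
          frame₂ = proj₂ (Re.tile-in-frame o (flip-side s) (flip-side s′) (corner-at (flip-side s) c jₓ) (corner-at (flip-side s′) d jᵧ))
          f , f₁ , f₂ = Re.tile-at o s (flip-side s′) frame₁ frame₂
      in f
       , corner-side s c (pick-exact s f₁ (λ at → pick-outside (flip-side s) (side-corner (flip-side s) c jₓ)
           (subst₂ (λ t g → At t x (Re.Lo c g) (Re.Hi c g)) (sym (flip-flip s))
             (Re.tile-unique o (flip-side s) (flip-side s′) at f₂ (corner-at (flip-side s) c jₓ) (corner-at (flip-side s′) d jᵧ)) f₁)))
       , corner-side (flip-side s′) d (pick-exact (flip-side s′) f₂ (λ at → pick-outside s′ (side-corner s′ d iᵧ)
           (subst (λ g → At (flip-side s′) y (Re.Lo d g) (Re.Hi d g))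
             (Re.tile-unique o s s′ f₁ (subst (λ t → At t y (Re.Lo d f) (Re.Hi d f)) (flip-flip s′) at) (corner-at s c iₓ) (corner-at s′ d iᵧ))
             f₂)))

    Quadrant : Side → Side → Set
    Quadrant t t′ = ∃[ f ] At-corner t c x f × At-corner t′ d y f

    all-quadrants : ∀ {t t′} → Quadrant t t′ → Quadrant t (flip-side t′) → Quadrant (flip-side t) t′ →
                    Quadrant (flip-side t) (flip-side t′) → ∀ u u′ → Quadrant u u′
    all-quadrants {low-side}  {low-side}  p q r s low-side  low-side  = p
    all-quadrants {low-side}  {low-side}  p q r s low-side  high-side = q
    all-quadrants {low-side}  {low-side}  p q r s high-side low-side  = r
    all-quadrants {low-side}  {low-side}  p q r s high-side high-side = s
    all-quadrants {low-side}  {high-side} p q r s low-side  low-side  = q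
    all-quadrants {low-side}  {high-side} p q r s low-side  high-side = p
    all-quadrants {low-side}  {high-side} p q r s high-side low-side  = s
    all-quadrants {low-side}  {high-side} p q r s high-side high-side = r
    all-quadrants {high-side} {low-side}  p q r s low-side  low-side  = r
    all-quadrants {high-side} {low-side}  p q r s low-side  high-side = s
    all-quadrants {high-side} {low-side}  p q r s high-side low-side  = p
    all-quadrants {high-side} {low-side}  p q r s high-side high-side = q
    all-quadrants {high-side} {high-side} p q r s low-side  low-side  = s
    all-quadrants {high-side} {high-side} p q r s low-side  high-side = r
    all-quadrants {high-side} {high-side} p q r s high-side low-side  = q
    all-quadrants {high-side} {high-side} p q r s high-side high-side = p

    quadrants : ∀ u u′ → Quadrant u u′
    quadrants = all-quadrants {s} {s′} (i , iₓ , iᵧ) (other-corner s s′ iₓ iᵧ jₓ jᵧ)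
      (let f , p , q = other-corner (flip-side s) (flip-side s′) jₓ jᵧ
             (subst (λ t → At-corner t c x i) (sym (flip-flip s)) iₓ) (subst (λ t → At-corner t d y i) (sym (flip-flip s′)) iᵧ)
       in f , p , subst (λ t → At-corner t d y f) (flip-flip s′) q)
      (j , jₓ , jᵧ)

  ranks : Ranks mosaic
  ranks = record
    { rank = λ c → TieBreaking.refined (place c)
    ; rank-tile = λ c i → TieBreaking.refined-mono (place c) (Re.co-tile c i)
    ; rank-frame = λ c → TieBreaking.refined-mono (place c) (Re.co-frame c)
    ; rank-injective = λ c → TieBreaking.refined-injective (place c) }

  open Drawn-as (drawing ranks) using (Touch; Precedes⇔Touch)

  -- Contact in a single point is contact of two opposite corners.
  overlap-strict : ∀ {c d} → Opp c d → ∀ {i j} → Re.Hi c i ≡ Re.Lo c j → Re.Lo d i ≤ Re.Hi d j → Re.Lo d j ≤ Re.Hi d i →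
                   Re.Lo d i < Re.Hi d j × Re.Lo d j < Re.Hi d i
  overlap-strict o {i} {j} eq p q =
      ℚ.≰⇒> (λ hi≤lo → opposite-corners o high-side low-side {i} {j} refl refl (sym eq) (ℚ.≤-antisym hi≤lo p))
    , ℚ.≰⇒> (λ hi≤lo → opposite-corners o high-side high-side {i} {j} refl refl (sym eq) (ℚ.≤-antisym q hi≤lo))

  -- Equal coordinates alone do not give equal labels. But the tile that starts at the wall of `i`
  -- at a common height covers a point of `j`, hence is `j`.
  same-wall : ∀ {c d} → Opp c d → ∀ {i j} → Re.Hi c i ≡ Re.Lo c j → Re.Lo d i < Re.Hi d j → Re.Lo d j < Re.Hi d i →
              high c i ≡ low c j
  same-wall {c} {d} o {i} {j} eq p q =
    let z , i≤z , j≤z , least = larger (Re.Lo d i) (Re.Lo d j)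
        W = high≢fl c i
          , (λ high≡fh → ℚ.<-irrefl (trans (sym eq) (cong (place c) high≡fh)) (ℚ.<-≤-trans (Re.co-tile c j) (Re.Hi≤frame o j)))
          , high-side , i , refl
        f , lowf , at-f = Re.beside o W low-side low-side
          (Re.along o W high-side low-side refl (i≤z , least (Re.co-tile d i) q))
        f≡j = Re.tile-unique o low-side low-side (Re.at-side low-side c lowf) at-f
          (ℚ.≤-reflexive (sym eq) , subst (_< Re.Hi c j) (sym eq) (Re.co-tile c j)) (j≤z , least p (Re.co-tile d j))
    in trans (sym lowf) (cong (low c) f≡j)

  precedes⇒touch : ∀ c {i j} → Precedes c R (num ⟨$⟩ʳ i) (num ⟨$⟩ʳ j) → Touch c (other c) i j
  precedes⇒touch c {i} {j} (p , (on , lo≤ , ≤hi) , (on′ , lo≤′ , ≤hi′)) =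
    let d = other c
        o = opp c
        eq = trans (sym (hi-place c i)) (trans (sym on) (trans on′ (lo-place c j)))
        p , q = overlap-strict o {i} {j} eq
          (subst₂ _≤_ (lo-place d i) (hi-place d j) (ℚ.≤-trans lo≤ ≤hi′))
          (subst₂ _≤_ (lo-place d j) (hi-place d i) (ℚ.≤-trans lo≤′ ≤hi))
    in same-wall o eq p q
     , ι-mono-≤ (ℕ.<⇒≤ (TieBreaking.refined-mono (place d) p)) , ι-mono-≤ (ℕ.<⇒≤ (TieBreaking.refined-mono (place d) q))

  touch⇒precedes : ∀ c {i j} → Touch c (other c) i j → Precedes c R (num ⟨$⟩ʳ i) (num ⟨$⟩ʳ j)
  touch⇒precedes c {i} {j} (eq , p , q) =
    let d = other c
        p′ = subst₂ _≤_ (sym (lo-place d i)) (sym (hi-place d j)) (TieBreaking.refined-cancel (place d) (ι-cancel-≤ p))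
        q′ = subst₂ _≤_ (sym (lo-place d j)) (sym (hi-place d i)) (TieBreaking.refined-cancel (place d) (ι-cancel-≤ q))
        z = lo (numbered i) d ℚ.⊔ lo (numbered j) d
        x = hi (numbered i) c
        on = point-on c x z
        off = point-off (opp c) x z
    in point c x z
     , (on , subst (lo (numbered i) d ≤_) (sym off) (ℚ.p≤p⊔q (lo (numbered i) d) (lo (numbered j) d))
           , subst (_≤ hi (numbered i) d) (sym off) (ℚ.⊔-lub (ℚ.<⇒≤ (nondegenerate _ d)) q′))
     , (trans on (trans (hi-place c i) (trans (cong (place c) eq) (sym (lo-place c j))))
           , subst (lo (numbered j) d ≤_) (sym off) (ℚ.p≤q⊔p (lo (numbered i) d) (lo (numbered j) d))
           , subst (_≤ hi (numbered j) d) (sym off) (ℚ.⊔-lub p′ (ℚ.<⇒≤ (nondegenerate _ d))))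

  same : R ≅ rank-layout ranks
  same = Perm.flip num , λ c i j →
    let back : ∀ i → num ⟨$⟩ʳ (num ⟨$⟩ˡ i) ≡ i
        back i = Perm.inverseʳ num
    in mk⇔
      (λ prec → Equivalence.from (Precedes⇔Touch (opp c)) (precedes⇒touch c (subst₂ (Precedes c R) (sym (back i)) (sym (back j)) prec)))
      (λ prec → subst₂ (Precedes c R) (back i) (back j) (touch⇒precedes c (Equivalence.to (Precedes⇔Touch (opp c)) prec)))

proposition4p2 : (n : ℕ) → n ≥ 1 → (R : Layout n) → IsGenericTiling R → ∃[ x ] IsGamma {n} x R
proposition4p2 (suc m) _ R generic = x , record
  { D = Drawn-as.layout diagonal-drawing
  ; G = rank-layout ranks
  ; isRho = isRho ranks x sorted
  ; D-generic = Drawn-as.isGenericTiling diagonal-drawing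
  ; G-generic = Drawn-as.isGenericTiling (drawing ranks)
  ; mosaic = ranks-equivalent ranks diagonal-ranks diagonal-drawing (λ c a b → ι-mono-<)
  ; shuffles = Shuffles.shuffles ranks x sorted
  ; same = same
  }
  where
  S : Labelled (dissection R (IsGenericTiling.isTiling generic))
  S = label (dissection R (IsGenericTiling.isTiling generic))
  open Representation R generic S
  open Rho (Labelled.diagonal S)
  open FromDiagonal (Labelled.diagonal S) using (diagonal-ranks)
  order = topological-sort (Order.sortable ranks)
  x = proj₁ order
  sorted = proj₂ order
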